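{- Let $p$ be a prime, $l\ge1$ an integer, and let $f\in\mathbb{Q}_p[X]$ be a nonzero polynomial. Let $\mathcal{R}_f\subset\mathbb{Z}_p$ be the set of roots of $f$ in $\mathbb{Z}_p$. Then the sequence $(\mathcal{L}_{p^l}(f(n)))_{n\ge0}$ of elements of $\mathbb{Z}_p$ is (a) $k$-regular for every integer $k\ge2$ if $\mathcal{R}_f=\varnothing$; (b) strictly $p$-regular if $\varnothing\neq\mathcal{R}_f\subset\mathbb{Q}$; (c) not regular if $\mathcal{R}_f\not\subset\mathbb{Q}$. In particular, these conditions do not depend on $l$.
   Context: $\mathbb{N}=\{0,1,2,\ldots\}$. For nonzero $x\in\mathbb{Q}_p$ put $\nu_{p^l}(x)=\lfloor\nu_p(x)/l\rfloor$ and $\mathcal{L}_{p^l}(x)=p^{ -l\,\nu_{p^l}(x)}x\in\mathbb{Z}_p$; put $\mathcal{L}_{p^l}(0)=0$. For an integer $k\ge2$, the $k$-kernel of $\mathbf{a}=(a_n)_{n\ge0}$ is $\{(a_{k^in+j})_{n\ge0}: i\ge0,\ 0\le j\le k^i-1\}$. A sequence with values in a $\mathbb{Z}$-module $R$ is $k$-regular if the $\mathbb{Z}$-submodule of $R^{\mathbb{N}}$ generated by its $k$-kernel is finitely generated. It is regular if it is $k$-regular for some $k\ge2$. It is strictly $k$-regular if it is $k$-regular and is not $m$-regular for any integer $m\ge2$ multiplicatively independent of $k$ (i.e. with $k^a\neq m^c$ for all integers $a,c\ge1$). -}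

module Defs where

open import Algebra.Bundles using (CommutativeRing)
open import Algebra.Module.Bundles using (Module)
open import Algebra.Module.Structures using (IsLeftModule)
open import Algebra.Module.Structures.Biased using (IsModuleFromLeft)
open import Algebra.Structures using (IsCommutativeRing)
open import Axiom.ExcludedMiddle using (ExcludedMiddle)
open import Data.Fin.Base using (Fin; toℕ)
open import Data.Integer.Base as ℤ using (ℤ; +_; -[1+_]; _⊖_; _/ℕ_; _%ℕ_)
open import Data.Integer.Divisibility.Signed
open import Data.Integer.DivMod using (a≡a%ℕn+[a/ℕn]*n)
import Data.Integer.Properties as ℤP
open import Data.Integer.Tactic.RingSolver using (solve-∀)
open import Data.List.Base using (List; []; _∷_)
open import Data.List.Relation.Unary.Any using (Any)
open import Data.Nat.Base as ℕ using (ℕ; zero; suc; NonZero)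
import Data.Nat.Properties as ℕP
open import Data.Nat.Primality using (Prime; prime⇒nonZero)
open import Data.Product.Base using (Σ; ∃; _×_; _,_; proj₁; proj₂)
open import Data.Rational.Base using (ℚ; ↥_; ↧_)
open import Level using (0ℓ; _⊔_)
open import Relation.Binary.PropositionalEquality
  using (_≡_; _≢_; refl; sym; trans; cong; cong₂; subst)
import Relation.Binary.Reasoning.Setoid as SetoidReasoning
open import Relation.Nullary using (¬_; yes; no; contradiction)
open import Relation.Unary using (Pred; _≐_)

------------------------------------------------------------------------
-- k-regular sequences with values in a ℤ-module

ℤ-ring : CommutativeRing 0ℓ 0ℓ
ℤ-ring = ℤP.+-*-commutativeRing

MultiplicativelyIndependent : ℕ → ℕ → Set
MultiplicativelyIndependent k m =
  ∀ a c → 1 ℕ.≤ a → 1 ℕ.≤ c → k ℕ.^ a ≢ m ℕ.^ c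

module Regularity {m ℓ} (M : Module ℤ-ring m ℓ) where
  open Module M

  Sequence : Set m
  Sequence = ℕ → Carrierᴹ

  _≋_ : Sequence → Sequence → Set ℓ
  s ≋ t = ∀ n → s n ≈ᴹ t n

  -- The ℤ-submodule generated by S, as the least submodule containing S.
  data Span {ℓ′} (S : Pred Sequence ℓ′) : Pred Sequence (m ⊔ ℓ ⊔ ℓ′) where
    gen   : ∀ {s} → S s → Span S s
    nil   : Span S (λ _ → 0ᴹ)
    plus  : ∀ {s t} → Span S s → Span S t → Span S (λ n → s n +ᴹ t n)
    scale : ∀ (c : ℤ) {s} → Span S s → Span S (λ n → c *ₗ s n)
    resp  : ∀ {s t} → s ≋ t → Span S s → Span S t

  Kernel : ℕ → Sequence → Pred Sequence ℓ
  Kernel k a s =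
    ∃ λ i → Σ (Fin (k ℕ.^ i)) λ j → s ≋ λ n → a (k ℕ.^ i ℕ.* n ℕ.+ toℕ j)

  Family : ∀ {r} → (Fin r → Sequence) → Pred Sequence ℓ
  Family g s = ∃ λ i → s ≋ g i

  KRegular : ℕ → Sequence → Set (m ⊔ ℓ)
  KRegular k a =
    ∃ λ r → Σ (Fin r → Sequence) λ g → Span (Kernel k a) ≐ Span (Family g)

  Regular : Sequence → Set (m ⊔ ℓ)
  Regular a = ∃ λ k → 2 ℕ.≤ k × KRegular k a

  StrictlyRegular : ℕ → Sequence → Set (m ⊔ ℓ)
  StrictlyRegular k a =
    KRegular k a ×
    (∀ m → 2 ℕ.≤ m → MultiplicativelyIndependent k m → ¬ KRegular m a)

------------------------------------------------------------------------
-- Polynomials as coefficient lists, constant term first; trailing zero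
-- coefficients are allowed.

module Polynomials {c ℓ} (R : CommutativeRing c ℓ) where
  open CommutativeRing R

  Polynomial : Set c
  Polynomial = List Carrier

  NonZeroPolynomial : Polynomial → Set (c ⊔ ℓ)
  NonZeroPolynomial = Any (λ c → ¬ c ≈ 0#)

  eval : Polynomial → Carrier → Carrier
  eval []       x = 0#
  eval (c ∷ cs) x = c + x * eval cs x

------------------------------------------------------------------------
-- p-adic numbers

module Padic (p : ℕ) (p-prime : Prime p) where

  private
    instance
      p-nonZero : NonZero p
      p-nonZero = prime⇒nonZero p-prime

  P : ℕ → ℤ
  P n = + (p ℕ.^ n)

  P-+ : ∀ m n → P (m ℕ.+ n) ≡ P m ℤ.* P n
  P-+ m n = trans (cong +_ (ℕP.^-distribˡ-+-* p m n))
                  (ℤP.pos-* (p ℕ.^ m) (p ℕ.^ n))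

  P-nonZero : ∀ {n} → ℤ.NonZero (P n)
  P-nonZero {n} = ℕP.m^n≢0 p n

  private
    P-∣-P : ∀ m n → P n ∣ P (m ℕ.+ n)
    P-∣-P m n = divides (P m) (P-+ m n)

    cast : ∀ {d a b} → a ≡ b → d ∣ a → d ∣ b
    cast refl q = q

  ----------------------------------------------------------------------
  -- ℤₚ as the inverse limit of the rings ℤ / pⁿ: the n-th component of an
  -- element is represented by an integer, which only matters modulo pⁿ.

  record ℤₚ : Set where
    constructor mkℤₚ
    field
      approx   : ℕ → ℤ
      coherent : ∀ n → P n ∣ approx (suc n) ℤ.- approx n
  open ℤₚ public

  infix 4 _≈ᶻ_
  record _≈ᶻ_ (x y : ℤₚ) : Set where
    constructor mk≈ᶻ
    field
      congruent : ∀ n → P n ∣ approx x n ℤ.- approx y n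
  open _≈ᶻ_ public

  fromℤ : ℤ → ℤₚ
  fromℤ i .approx   n = i
  fromℤ i .coherent n = divides (+ 0) (lemma i (P n))
    where
    lemma : ∀ i q → i ℤ.- i ≡ + 0 ℤ.* q
    lemma = solve-∀

  infixl 6 _+ᶻ_
  infixl 7 _*ᶻ_
  infix  8 -ᶻ_

  private abstract
    Δ+ : ∀ a b c d → (a ℤ.- b) ℤ.+ (c ℤ.- d) ≡ (a ℤ.+ c) ℤ.- (b ℤ.+ d)
    Δ+ = solve-∀

    Δ* : ∀ a b c d →
         a ℤ.* (c ℤ.- d) ℤ.+ d ℤ.* (a ℤ.- b) ≡ (a ℤ.* c) ℤ.- (b ℤ.* d)
    Δ* = solve-∀

    Δ- : ∀ a b → ℤ.- (a ℤ.- b) ≡ (ℤ.- a) ℤ.- (ℤ.- b)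
    Δ- = solve-∀

    Δ-swap : ∀ a b → ℤ.- (a ℤ.- b) ≡ b ℤ.- a
    Δ-swap = solve-∀

    Δ-trans : ∀ a b c → (a ℤ.- b) ℤ.+ (b ℤ.- c) ≡ a ℤ.- c
    Δ-trans = solve-∀

    ∣-+ : ∀ {d} a b c e → d ∣ a ℤ.- b → d ∣ c ℤ.- e →
          d ∣ (a ℤ.+ c) ℤ.- (b ℤ.+ e)
    ∣-+ a b c e q r = cast (Δ+ a b c e) (∣m∣n⇒∣m+n q r)

    ∣-* : ∀ {d} a b c e → d ∣ a ℤ.- b → d ∣ c ℤ.- e →
          d ∣ (a ℤ.* c) ℤ.- (b ℤ.* e)
    ∣-* a b c e q r =
      cast (Δ* a b c e) (∣m∣n⇒∣m+n (∣n⇒∣m*n a r) (∣n⇒∣m*n e q))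

    ∣-neg : ∀ {d} a b → d ∣ a ℤ.- b → d ∣ (ℤ.- a) ℤ.- (ℤ.- b)
    ∣-neg a b q = cast (Δ- a b) (∣m⇒∣-m q)

    ∣-trans′ : ∀ {d} a b c → d ∣ a ℤ.- b → d ∣ b ℤ.- c → d ∣ a ℤ.- c
    ∣-trans′ a b c q r = cast (Δ-trans a b c) (∣m∣n⇒∣m+n q r)

    ∣-sym : ∀ {d} a b → d ∣ a ℤ.- b → d ∣ b ℤ.- a
    ∣-sym a b q = cast (Δ-swap a b) (∣m⇒∣-m q)

  _+ᶻ_ : ℤₚ → ℤₚ → ℤₚ
  (x +ᶻ y) .approx   n = approx x n ℤ.+ approx y n
  (x +ᶻ y) .coherent n = ∣-+ (approx x (suc n)) (approx x n)
    (approx y (suc n)) (approx y n) (coherent x n) (coherent y n)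

  _*ᶻ_ : ℤₚ → ℤₚ → ℤₚ
  (x *ᶻ y) .approx   n = approx x n ℤ.* approx y n
  (x *ᶻ y) .coherent n = ∣-* (approx x (suc n)) (approx x n)
    (approx y (suc n)) (approx y n) (coherent x n) (coherent y n)

  -ᶻ_ : ℤₚ → ℤₚ
  (-ᶻ x) .approx   n = ℤ.- approx x n
  (-ᶻ x) .coherent n =
    ∣-neg (approx x (suc n)) (approx x n) (coherent x n)

  pointwise : ∀ {x y} → (∀ n → approx x n ≡ approx y n) → x ≈ᶻ y
  pointwise {x} {y} eq .congruent n = divides (+ 0)
    (trans (cong (ℤ._- approx y n) (eq n)) (ℤP.+-inverseʳ (approx y n)))

  private
    ≈ᶻ-sym : ∀ {x y} → x ≈ᶻ y → y ≈ᶻ x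
    ≈ᶻ-sym {x} {y} q .congruent n =
      ∣-sym (approx x n) (approx y n) (congruent q n)

    ≈ᶻ-trans : ∀ {x y z} → x ≈ᶻ y → y ≈ᶻ z → x ≈ᶻ z
    ≈ᶻ-trans {x} {y} {z} q r .congruent n =
      ∣-trans′ (approx x n) (approx y n) (approx z n)
               (congruent q n) (congruent r n)

    +ᶻ-cong : ∀ {x y u v} → x ≈ᶻ y → u ≈ᶻ v → (x +ᶻ u) ≈ᶻ (y +ᶻ v)
    +ᶻ-cong {x} {y} {u} {v} q r .congruent n =
      ∣-+ (approx x n) (approx y n) (approx u n) (approx v n)
          (congruent q n) (congruent r n)

    *ᶻ-cong : ∀ {x y u v} → x ≈ᶻ y → u ≈ᶻ v → (x *ᶻ u) ≈ᶻ (y *ᶻ v)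
    *ᶻ-cong {x} {y} {u} {v} q r .congruent n =
      ∣-* (approx x n) (approx y n) (approx u n) (approx v n)
          (congruent q n) (congruent r n)

    -ᶻ-cong : ∀ {x y} → x ≈ᶻ y → (-ᶻ x) ≈ᶻ (-ᶻ y)
    -ᶻ-cong {x} {y} q .congruent n =
      ∣-neg (approx x n) (approx y n) (congruent q n)

  ℤₚ-isCommutativeRing :
    IsCommutativeRing _≈ᶻ_ _+ᶻ_ _*ᶻ_ -ᶻ_ (fromℤ (+ 0)) (fromℤ (+ 1))
  ℤₚ-isCommutativeRing = record
    { isRing = record
      { +-isAbelianGroup = record
        { isGroup = record
          { isMonoid = record
            { isSemigroup = record
              { isMagma = record
                { isEquivalence = record
                  { refl  = pointwise λ _ → refl
                  ; sym   = ≈ᶻ-sym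
                  ; trans = ≈ᶻ-trans
                  }
                ; ∙-cong = +ᶻ-cong
                }
              ; assoc = λ x y z → pointwise λ n →
                  ℤP.+-assoc (approx x n) (approx y n) (approx z n)
              }
            ; identity = (λ x → pointwise λ n → ℤP.+-identityˡ (approx x n))
                       , (λ x → pointwise λ n → ℤP.+-identityʳ (approx x n))
            }
          ; inverse = (λ x → pointwise λ n → ℤP.+-inverseˡ (approx x n))
                    , (λ x → pointwise λ n → ℤP.+-inverseʳ (approx x n))
          ; ⁻¹-cong = -ᶻ-cong
          }
        ; comm = λ x y → pointwise λ n →
            ℤP.+-comm (approx x n) (approx y n)
        }
      ; *-cong = *ᶻ-cong
      ; *-assoc = λ x y z → pointwise λ n →
          ℤP.*-assoc (approx x n) (approx y n) (approx z n)
      ; *-identity = (λ x → pointwise λ n → ℤP.*-identityˡ (approx x n))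
                   , (λ x → pointwise λ n → ℤP.*-identityʳ (approx x n))
      ; distrib = (λ x y z → pointwise λ n →
                     ℤP.*-distribˡ-+ (approx x n) (approx y n) (approx z n))
                , (λ x y z → pointwise λ n →
                     ℤP.*-distribʳ-+ (approx x n) (approx y n) (approx z n))
      }
    ; *-comm = λ x y → pointwise λ n → ℤP.*-comm (approx x n) (approx y n)
    }

  ℤₚ-commutativeRing : CommutativeRing 0ℓ 0ℓ
  ℤₚ-commutativeRing = record { isCommutativeRing = ℤₚ-isCommutativeRing }

  private module Z = CommutativeRing ℤₚ-commutativeRing

  ℤₚ-isLeftModule :
    IsLeftModule (CommutativeRing.ring ℤ-ring)
      _≈ᶻ_ _+ᶻ_ (fromℤ (+ 0)) -ᶻ_ (λ c x → fromℤ c *ᶻ x)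
  ℤₚ-isLeftModule = record
    { isLeftSemimodule = record
      { +ᴹ-isCommutativeMonoid = Z.+-isCommutativeMonoid
      ; isPreleftSemimodule = record
        { *ₗ-cong      = λ { refl q → Z.*-congˡ q }
        ; *ₗ-zeroˡ     = Z.zeroˡ
        ; *ₗ-distribʳ  = λ x c d → pointwise λ n → ℤP.*-distribʳ-+ (approx x n) c d
        ; *ₗ-identityˡ = Z.*-identityˡ
        ; *ₗ-assoc     = λ c d x → pointwise λ n → ℤP.*-assoc c d (approx x n)
        ; *ₗ-zeroʳ     = λ c → Z.zeroʳ (fromℤ c)
        ; *ₗ-distribˡ  = λ c x y → Z.distribˡ (fromℤ c) x y
        }
      }
    ; -ᴹ‿cong    = Z.-‿cong
    ; -ᴹ‿inverse = Z.-‿inverse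
    }

  ℤₚ-module : Module ℤ-ring 0ℓ 0ℓ
  ℤₚ-module = record
    { isModule = IsModuleFromLeft.isModule
        {commutativeRing = ℤ-ring} (record { isLeftModule = ℤₚ-isLeftModule }) }

  ----------------------------------------------------------------------
  -- ℚₚ = ℤₚ[1/p]: the pair of num and exponent stands for num / p^exponent.

  π^_ : ℕ → ℤₚ
  π^ n = fromℤ (P n)

  infix 9 π^_

  record ℚₚ : Set where
    constructor _/p^_
    field
      num      : ℤₚ
      exponent : ℕ
  open ℚₚ public

  infix 5 _/p^_
  infix 4 _≈ᵠ_
  record _≈ᵠ_ (x y : ℚₚ) : Set where
    constructor mk≈ᵠ
    field
      cross : π^ exponent y *ᶻ num x ≈ᶻ π^ exponent x *ᶻ num y
  open _≈ᵠ_ public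

  infixl 6 _+ᵠ_
  infixl 7 _*ᵠ_
  infix  8 -ᵠ_

  _+ᵠ_ : ℚₚ → ℚₚ → ℚₚ
  (a /p^ d) +ᵠ (b /p^ e) = (π^ e *ᶻ a +ᶻ π^ d *ᶻ b) /p^ (d ℕ.+ e)

  _*ᵠ_ : ℚₚ → ℚₚ → ℚₚ
  (a /p^ d) *ᵠ (b /p^ e) = (a *ᶻ b) /p^ (d ℕ.+ e)

  -ᵠ_ : ℚₚ → ℚₚ
  -ᵠ (a /p^ d) = (-ᶻ a) /p^ d

  ι : ℤₚ → ℚₚ
  ι a = a /p^ 0

  0ᵠ : ℚₚ
  0ᵠ = ι (fromℤ (+ 0))

  private
    module ZR = SetoidReasoning Z.setoid

  far : ∀ x k n → P n ∣ approx x (k ℕ.+ n) ℤ.- approx x n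
  far x zero    n = congruent (Z.refl {x}) n
  far x (suc k) n =
    ∣-trans′ (approx x (suc k ℕ.+ n)) (approx x (k ℕ.+ n)) (approx x n)
      (∣-trans (P-∣-P k n) (coherent x (k ℕ.+ n))) (far x k n)

  π-cancel : ∀ k {x y} → π^ k *ᶻ x ≈ᶻ π^ k *ᶻ y → x ≈ᶻ y
  π-cancel k {x} {y} q .congruent n =
    ∣-trans′ (approx x n) (approx x (k ℕ.+ n)) (approx y n)
      (∣-sym (approx x (k ℕ.+ n)) (approx x n) (far x k n))
      (∣-trans′ (approx x (k ℕ.+ n)) (approx y (k ℕ.+ n)) (approx y n)
        (*-cancelˡ-∣ (P k) {P n} {{P-nonZero {k}}}
          (cast (Δ (P k) (approx x (k ℕ.+ n)) (approx y (k ℕ.+ n)))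
            (subst (_∣ (P k ℤ.* approx x (k ℕ.+ n) ℤ.- P k ℤ.* approx y (k ℕ.+ n)))
              (P-+ k n) (congruent q (k ℕ.+ n)))))
        (far y k n))
    where
    Δ : ∀ c a b → c ℤ.* a ℤ.- c ℤ.* b ≡ c ℤ.* (a ℤ.- b)
    Δ = solve-∀

  -- Equalities in ℚₚ that hold already for integer representatives.
  pointwiseᵠ : ∀ {x y} →
    (∀ n → P (exponent y) ℤ.* approx (num x) n ≡
           P (exponent x) ℤ.* approx (num y) n) → x ≈ᵠ y
  pointwiseᵠ eq = mk≈ᵠ (pointwise eq)

  π-+ : ∀ m n → π^ (m ℕ.+ n) ≈ᶻ π^ m *ᶻ π^ n
  π-+ m n = pointwise λ _ → P-+ m n

  private
    open import Algebra.Solver.Ring.NaturalCoefficients.Default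
      Z.commutativeSemiring using (solve; _:=_; _:+_; _:*_)

    ≈ᵠ-trans : ∀ {x y z} → x ≈ᵠ y → y ≈ᵠ z → x ≈ᵠ z
    ≈ᵠ-trans {a /p^ d} {b /p^ e} {c /p^ f} (mk≈ᵠ q) (mk≈ᵠ r) =
      mk≈ᵠ (π-cancel e (begin
        π^ e *ᶻ (π^ f *ᶻ a)  ≈⟨ swap (π^ e) (π^ f) a ⟩
        π^ f *ᶻ (π^ e *ᶻ a)  ≈⟨ Z.*-congˡ q ⟩
        π^ f *ᶻ (π^ d *ᶻ b)  ≈⟨ swap (π^ f) (π^ d) b ⟩
        π^ d *ᶻ (π^ f *ᶻ b)  ≈⟨ Z.*-congˡ r ⟩
        π^ d *ᶻ (π^ e *ᶻ c)  ≈⟨ swap (π^ d) (π^ e) c ⟩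
        π^ e *ᶻ (π^ d *ᶻ c)  ∎))
      where
      open ZR
      swap : ∀ u v w → u *ᶻ (v *ᶻ w) ≈ᶻ v *ᶻ (u *ᶻ w)
      swap = solve 3 (λ u v w → u :* (v :* w) := v :* (u :* w)) Z.refl

    +ᵠ-cong : ∀ {x x′ y y′} → x ≈ᵠ x′ → y ≈ᵠ y′ → (x +ᵠ y) ≈ᵠ (x′ +ᵠ y′)
    +ᵠ-cong {a /p^ d} {a′ /p^ d′} {b /p^ e} {b′ /p^ e′} (mk≈ᵠ q) (mk≈ᵠ r) =
      mk≈ᵠ (begin
        π^ (d′ ℕ.+ e′) *ᶻ (π^ e *ᶻ a +ᶻ π^ d *ᶻ b)
          ≈⟨ Z.*-congʳ (π-+ d′ e′) ⟩
        π^ d′ *ᶻ π^ e′ *ᶻ (π^ e *ᶻ a +ᶻ π^ d *ᶻ b)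
          ≈⟨ expand (π^ d′) (π^ e′) (π^ e) a (π^ d) b ⟩
        π^ e′ *ᶻ π^ e *ᶻ (π^ d′ *ᶻ a) +ᶻ π^ d′ *ᶻ π^ d *ᶻ (π^ e′ *ᶻ b)
          ≈⟨ Z.+-cong (Z.*-congˡ q) (Z.*-congˡ r) ⟩
        π^ e′ *ᶻ π^ e *ᶻ (π^ d *ᶻ a′) +ᶻ π^ d′ *ᶻ π^ d *ᶻ (π^ e *ᶻ b′)
          ≈⟨ collect (π^ d) (π^ e) (π^ e′) a′ (π^ d′) b′ ⟩
        π^ d *ᶻ π^ e *ᶻ (π^ e′ *ᶻ a′ +ᶻ π^ d′ *ᶻ b′)
          ≈⟨ Z.*-congʳ (π-+ d e) ⟨
        π^ (d ℕ.+ e) *ᶻ (π^ e′ *ᶻ a′ +ᶻ π^ d′ *ᶻ b′) ∎)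
      where
      open ZR
      expand : ∀ d′ e′ e a d b → d′ *ᶻ e′ *ᶻ (e *ᶻ a +ᶻ d *ᶻ b) ≈ᶻ
               e′ *ᶻ e *ᶻ (d′ *ᶻ a) +ᶻ d′ *ᶻ d *ᶻ (e′ *ᶻ b)
      expand = solve 6 (λ d′ e′ e a d b → d′ :* e′ :* (e :* a :+ d :* b) :=
               e′ :* e :* (d′ :* a) :+ d′ :* d :* (e′ :* b)) Z.refl
      collect : ∀ d e e′ a′ d′ b′ →
                e′ *ᶻ e *ᶻ (d *ᶻ a′) +ᶻ d′ *ᶻ d *ᶻ (e *ᶻ b′) ≈ᶻ
                d *ᶻ e *ᶻ (e′ *ᶻ a′ +ᶻ d′ *ᶻ b′)
      collect = solve 6 (λ d e e′ a′ d′ b′ →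
                e′ :* e :* (d :* a′) :+ d′ :* d :* (e :* b′) :=
                d :* e :* (e′ :* a′ :+ d′ :* b′)) Z.refl

    *ᵠ-cong : ∀ {x x′ y y′} → x ≈ᵠ x′ → y ≈ᵠ y′ → (x *ᵠ y) ≈ᵠ (x′ *ᵠ y′)
    *ᵠ-cong {a /p^ d} {a′ /p^ d′} {b /p^ e} {b′ /p^ e′} (mk≈ᵠ q) (mk≈ᵠ r) =
      mk≈ᵠ (begin
        π^ (d′ ℕ.+ e′) *ᶻ (a *ᶻ b)       ≈⟨ Z.*-congʳ (π-+ d′ e′) ⟩
        π^ d′ *ᶻ π^ e′ *ᶻ (a *ᶻ b)       ≈⟨ shuffle (π^ d′) (π^ e′) a b ⟩
        (π^ d′ *ᶻ a) *ᶻ (π^ e′ *ᶻ b)     ≈⟨ Z.*-cong q r ⟩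
        (π^ d *ᶻ a′) *ᶻ (π^ e *ᶻ b′)     ≈⟨ shuffle (π^ d) (π^ e) a′ b′ ⟨
        π^ d *ᶻ π^ e *ᶻ (a′ *ᶻ b′)       ≈⟨ Z.*-congʳ (π-+ d e) ⟨
        π^ (d ℕ.+ e) *ᶻ (a′ *ᶻ b′)       ∎)
      where
      open ZR
      shuffle : ∀ d e a b → d *ᶻ e *ᶻ (a *ᶻ b) ≈ᶻ (d *ᶻ a) *ᶻ (e *ᶻ b)
      shuffle = solve 4 (λ d e a b →
                d :* e :* (a :* b) := (d :* a) :* (e :* b)) Z.refl

    -ᵠ-cong : ∀ {x x′} → x ≈ᵠ x′ → (-ᵠ x) ≈ᵠ (-ᵠ x′)
    -ᵠ-cong {a /p^ d} {a′ /p^ d′} (mk≈ᵠ q) = mk≈ᵠ (begin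
        π^ d′ *ᶻ (-ᶻ a)    ≈⟨ pull (π^ d′) a ⟩
        -ᶻ (π^ d′ *ᶻ a)    ≈⟨ Z.-‿cong q ⟩
        -ᶻ (π^ d *ᶻ a′)    ≈⟨ pull (π^ d) a′ ⟨
        π^ d *ᶻ (-ᶻ a′)    ∎)
      where
      open ZR
      pull : ∀ u v → u *ᶻ (-ᶻ v) ≈ᶻ -ᶻ (u *ᶻ v)
      pull u v = pointwise λ n →
        sym (ℤP.neg-distribʳ-* (approx u n) (approx v n))

    +ᵠ-comm : ∀ x y → (x +ᵠ y) ≈ᵠ (y +ᵠ x)
    +ᵠ-comm (a /p^ d) (b /p^ e) = pointwiseᵠ λ n →
      eq (P d) (P e) (approx a n) (approx b n) (P-+ e d) (P-+ d e)
      where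
      int : ∀ D E a b → (E ℤ.* D) ℤ.* (E ℤ.* a ℤ.+ D ℤ.* b) ≡
                        (D ℤ.* E) ℤ.* (D ℤ.* b ℤ.+ E ℤ.* a)
      int = solve-∀
      eq : ∀ {U V} D E a b → U ≡ E ℤ.* D → V ≡ D ℤ.* E →
           U ℤ.* (E ℤ.* a ℤ.+ D ℤ.* b) ≡ V ℤ.* (D ℤ.* b ℤ.+ E ℤ.* a)
      eq D E a b refl refl = int D E a b

    +ᵠ-assoc : ∀ x y z → ((x +ᵠ y) +ᵠ z) ≈ᵠ (x +ᵠ (y +ᵠ z))
    +ᵠ-assoc (a /p^ d) (b /p^ e) (c /p^ f) = pointwiseᵠ λ n →
      eq (P d) (P e) (P f) (approx a n) (approx b n) (approx c n) (P-+ d e)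
         (P-+ e f) (trans (P-+ d (e ℕ.+ f)) (cong (P d ℤ.*_) (P-+ e f)))
         (trans (P-+ (d ℕ.+ e) f) (cong (ℤ._* P f) (P-+ d e)))
      where
      int : ∀ D E F a b c →
        (D ℤ.* (E ℤ.* F)) ℤ.* (F ℤ.* (E ℤ.* a ℤ.+ D ℤ.* b) ℤ.+ (D ℤ.* E) ℤ.* c) ≡
        ((D ℤ.* E) ℤ.* F) ℤ.* ((E ℤ.* F) ℤ.* a ℤ.+ D ℤ.* (F ℤ.* b ℤ.+ E ℤ.* c))
      int = solve-∀
      eq : ∀ {DE EF U V} D E F a b c → DE ≡ D ℤ.* E → EF ≡ E ℤ.* F →
           U ≡ D ℤ.* (E ℤ.* F) → V ≡ (D ℤ.* E) ℤ.* F →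
           U ℤ.* (F ℤ.* (E ℤ.* a ℤ.+ D ℤ.* b) ℤ.+ DE ℤ.* c) ≡
           V ℤ.* (EF ℤ.* a ℤ.+ D ℤ.* (F ℤ.* b ℤ.+ E ℤ.* c))
      eq D E F a b c refl refl refl refl = int D E F a b c

    +ᵠ-identityˡ : ∀ x → (0ᵠ +ᵠ x) ≈ᵠ x
    +ᵠ-identityˡ (a /p^ d) = pointwiseᵠ λ n → int (P d) (approx a n)
      where
      int : ∀ D a → D ℤ.* (D ℤ.* + 0 ℤ.+ + 1 ℤ.* a) ≡ D ℤ.* a
      int = solve-∀

    -ᵠ-inverseˡ : ∀ x → ((-ᵠ x) +ᵠ x) ≈ᵠ 0ᵠ
    -ᵠ-inverseˡ (a /p^ d) = pointwiseᵠ λ n → int (P d) (P (d ℕ.+ d)) (approx a n)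
      where
      int : ∀ D Q a → + 1 ℤ.* (D ℤ.* (ℤ.- a) ℤ.+ D ℤ.* a) ≡ Q ℤ.* + 0
      int = solve-∀

    *ᵠ-comm : ∀ x y → (x *ᵠ y) ≈ᵠ (y *ᵠ x)
    *ᵠ-comm (a /p^ d) (b /p^ e) = pointwiseᵠ λ n → cong₂ ℤ._*_
      (cong P (ℕP.+-comm e d)) (ℤP.*-comm (approx a n) (approx b n))

    *ᵠ-assoc : ∀ x y z → ((x *ᵠ y) *ᵠ z) ≈ᵠ (x *ᵠ (y *ᵠ z))
    *ᵠ-assoc (a /p^ d) (b /p^ e) (c /p^ f) = pointwiseᵠ λ n → cong₂ ℤ._*_
      (cong P (sym (ℕP.+-assoc d e f)))
      (ℤP.*-assoc (approx a n) (approx b n) (approx c n))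

    *ᵠ-identityˡ : ∀ x → (ι (fromℤ (+ 1)) *ᵠ x) ≈ᵠ x
    *ᵠ-identityˡ (a /p^ d) = pointwiseᵠ λ n →
      cong (P d ℤ.*_) (ℤP.*-identityˡ (approx a n))

    *ᵠ-distribˡ : ∀ x y z → (x *ᵠ (y +ᵠ z)) ≈ᵠ (x *ᵠ y +ᵠ x *ᵠ z)
    *ᵠ-distribˡ (a /p^ d) (b /p^ e) (c /p^ f) = pointwiseᵠ λ n →
      eq (P d) (P e) (P f) (approx a n) (approx b n) (approx c n)
         (P-+ d e) (P-+ d f)
         (trans (P-+ (d ℕ.+ e) (d ℕ.+ f)) (cong₂ ℤ._*_ (P-+ d e) (P-+ d f)))
         (trans (P-+ d (e ℕ.+ f)) (cong (P d ℤ.*_) (P-+ e f)))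
      where
      int : ∀ D E F a b c →
        ((D ℤ.* E) ℤ.* (D ℤ.* F)) ℤ.* (a ℤ.* (F ℤ.* b ℤ.+ E ℤ.* c)) ≡
        (D ℤ.* (E ℤ.* F)) ℤ.* ((D ℤ.* F) ℤ.* (a ℤ.* b) ℤ.+ (D ℤ.* E) ℤ.* (a ℤ.* c))
      int = solve-∀
      eq : ∀ {DE DF U V} D E F a b c → DE ≡ D ℤ.* E → DF ≡ D ℤ.* F →
           U ≡ (D ℤ.* E) ℤ.* (D ℤ.* F) → V ≡ D ℤ.* (E ℤ.* F) →
           U ℤ.* (a ℤ.* (F ℤ.* b ℤ.+ E ℤ.* c)) ≡
           V ℤ.* (DF ℤ.* (a ℤ.* b) ℤ.+ DE ℤ.* (a ℤ.* c))
      eq D E F a b c refl refl refl refl = int D E F a b c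

  ℚₚ-isCommutativeRing : IsCommutativeRing _≈ᵠ_ _+ᵠ_ _*ᵠ_ -ᵠ_
                           0ᵠ (ι (fromℤ (+ 1)))
  ℚₚ-isCommutativeRing = record
    { isRing = record
      { +-isAbelianGroup = record
        { isGroup = record
          { isMonoid = record
            { isSemigroup = record
              { isMagma = record
                { isEquivalence = record
                  { refl  = mk≈ᵠ Z.refl
                  ; sym   = λ q → mk≈ᵠ (Z.sym (cross q))
                  ; trans = ≈ᵠ-trans
                  }
                ; ∙-cong = +ᵠ-cong
                }
              ; assoc = +ᵠ-assoc
              }
            ; identity = +ᵠ-identityˡ
                       , λ x → ≈ᵠ-trans (+ᵠ-comm x _) (+ᵠ-identityˡ x)
            }
          ; inverse = -ᵠ-inverseˡ
                    , λ x → ≈ᵠ-trans (+ᵠ-comm x _) (-ᵠ-inverseˡ x)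
          ; ⁻¹-cong = -ᵠ-cong
          }
        ; comm = +ᵠ-comm
        }
      ; *-cong = *ᵠ-cong
      ; *-assoc = *ᵠ-assoc
      ; *-identity = *ᵠ-identityˡ
                   , λ x → ≈ᵠ-trans (*ᵠ-comm x _) (*ᵠ-identityˡ x)
      ; distrib = *ᵠ-distribˡ
                , λ x y z → ≈ᵠ-trans (*ᵠ-comm (y +ᵠ z) x)
                    (≈ᵠ-trans (*ᵠ-distribˡ x y z)
                      (+ᵠ-cong (*ᵠ-comm x y) (*ᵠ-comm x z)))
      }
    ; *-comm = *ᵠ-comm
    }

  ℚₚ-commutativeRing : CommutativeRing 0ℓ 0ℓ
  ℚₚ-commutativeRing = record { isCommutativeRing = ℚₚ-isCommutativeRing }

  private module Q = CommutativeRing ℚₚ-commutativeRing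

  infix 9 p^_
  p^_ : ℤ → ℚₚ
  p^ (+ n)    = ι (π^ n)
  p^ -[1+ n ] = fromℤ (+ 1) /p^ suc n

  infix 4 _∈p^_ℤₚ
  _∈p^_ℤₚ : ℚₚ → ℤ → Set
  x ∈p^ v ℤₚ = ∃ λ y → x ≈ᵠ p^ v *ᵠ ι y

  -- v is the largest integer with x ∈ pᵛ ℤₚ.
  IsValuation : ℚₚ → ℤ → Set
  IsValuation x v = x ∈p^ v ℤₚ × ¬ x ∈p^ ℤ.suc v ℤₚ

  private
    module QR = SetoidReasoning Q.setoid

  p^-⊖ : ∀ m n → p^ (m ⊖ n) ≈ᵠ (π^ m /p^ n)
  p^-⊖ zero    zero    = Q.refl
  p^-⊖ zero    (suc n) = Q.refl
  p^-⊖ (suc m) zero    = Q.refl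
  p^-⊖ (suc m) (suc n) = subst (λ i → p^ i ≈ᵠ (π^ suc m /p^ suc n))
    (sym (ℤP.[1+m]⊖[1+n]≡m⊖n m n))
    (Q.trans (p^-⊖ m n) (pointwiseᵠ λ _ →
      eq (P 1) (P m) (P n) (P-+ 1 m) (P-+ 1 n)))
    where
    int : ∀ c M N → (c ℤ.* N) ℤ.* M ≡ N ℤ.* (c ℤ.* M)
    int = solve-∀
    eq : ∀ {M′ N′} c M N → M′ ≡ c ℤ.* M → N′ ≡ c ℤ.* N → N′ ℤ.* M ≡ N ℤ.* M′
    eq c M N refl refl = int c M N

  p^-+ : ∀ i j → p^ (i ℤ.+ j) ≈ᵠ p^ i *ᵠ p^ j
  p^-+ (+ m)    (+ n)    = pointwiseᵠ λ _ → cong (+ 1 ℤ.*_) (P-+ m n)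
  p^-+ (+ m)    -[1+ n ] = Q.trans (p^-⊖ m (suc n))
    (pointwiseᵠ λ _ → cong (P (suc n) ℤ.*_) (sym (ℤP.*-identityʳ (P m))))
  p^-+ -[1+ m ] (+ n)    =
    Q.trans (p^-+ (+ n) -[1+ m ]) (Q.*-comm (p^ (+ n)) (p^ -[1+ m ]))
  p^-+ -[1+ m ] -[1+ n ] = pointwiseᵠ λ _ →
    cong (λ k → P (suc k) ℤ.* + 1) (ℕP.+-suc m n)

  divisible : ∀ x k → P k ∣ approx x k → ∃ λ y → x ≈ᶻ π^ k *ᶻ y
  divisible x k k∣x = y , mk≈ᶻ λ n →
    subst (λ i → P n ∣ approx x n ℤ.- i)
      (trans (_∣_.equality (q n)) (ℤP.*-comm (quotient (q n)) (P k)))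
      (∣-sym (approx x (n ℕ.+ k)) (approx x n)
        (subst (λ i → P n ∣ approx x i ℤ.- approx x n) (ℕP.+-comm k n)
          (far x k n)))
    where
    Δ : ∀ a b → (a ℤ.- b) ℤ.+ b ≡ a
    Δ = solve-∀
    Δ′ : ∀ a b c → a ℤ.* c ℤ.- b ℤ.* c ≡ (a ℤ.- b) ℤ.* c
    Δ′ = solve-∀
    q : ∀ n → P k ∣ approx x (n ℕ.+ k)
    q n = cast (Δ (approx x (n ℕ.+ k)) (approx x k))
               (∣m∣n⇒∣m+n (far x n k) k∣x)
    y : ℤₚ
    y .approx   n = quotient (q n)
    y .coherent n = *-cancelʳ-∣ (P k) {P n} {{P-nonZero {k}}}
      (subst (_∣ (quotient (q (suc n)) ℤ.- quotient (q n)) ℤ.* P k) (P-+ n k)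
        (cast (trans (cong₂ ℤ._-_ (_∣_.equality (q (suc n)))
                                  (_∣_.equality (q n)))
                     (Δ′ (quotient (q (suc n))) (quotient (q n)) (P k)))
              (coherent x (n ℕ.+ k))))

  indivisible : ∀ x k y → x ≈ᶻ π^ k *ᶻ y → P k ∣ approx x k
  indivisible x k y q = cast (Δ (approx x k) (P k ℤ.* approx y k))
    (∣m∣n⇒∣m+n (congruent q k) (∣m⇒∣m*n (approx y k) ∣-refl))
    where
    Δ : ∀ a b → (a ℤ.- b) ℤ.+ b ≡ a
    Δ = solve-∀

  last-power : ∀ x n → ¬ P n ∣ approx x n →
    ∃ λ v → P v ∣ approx x v × ¬ P (suc v) ∣ approx x (suc v)
  last-power x zero    P∤x =
    contradiction (divides (approx x 0) (sym (ℤP.*-identityʳ (approx x 0)))) P∤x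
  last-power x (suc n) P∤x with P n ∣? approx x n
  ... | yes P∣x = n , P∣x , P∤x
  ... | no  P∤  = last-power x n P∤

  nonzero-power : ExcludedMiddle 0ℓ → ∀ a → ¬ a ≈ᶻ fromℤ (+ 0) →
    ∃ λ n → ¬ P n ∣ approx a n
  nonzero-power em a a≉0 with em {∃ λ n → ¬ P n ∣ approx a n}
  ... | yes found = found
  ... | no  none  = contradiction (mk≈ᶻ all) a≉0
    where
    all : ∀ n → P n ∣ approx a n ℤ.- + 0
    all n with P n ∣? approx a n
    ... | yes P∣a = cast (sym (ℤP.+-identityʳ (approx a n))) P∣a
    ... | no  P∤a = contradiction (n , P∤a) none

  quotient-form : ∀ v d y →
    p^ (v ⊖ d) *ᵠ ι y ≈ᵠ ((π^ v *ᶻ y) /p^ d)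
  quotient-form v d y = Q.trans (Q.*-congʳ {ι y} (p^-⊖ v d))
    (pointwiseᵠ λ n → cong (λ e → P e ℤ.* (P v ℤ.* approx y n))
      (sym (ℕP.+-identityʳ d)))

  num≈ : ∀ {a b d} → (a /p^ d) ≈ᵠ (b /p^ d) → a ≈ᶻ b
  num≈ {d = d} q = π-cancel d (cross q)

  suc-⊖ : ∀ v d → ℤ.suc (v ⊖ d) ≡ suc v ⊖ d
  suc-⊖ v d = ℤP.distribʳ-⊖-+-pos 1 v d

  in-ideal : ∀ a d v → P v ∣ approx a v → (a /p^ d) ∈p^ (v ⊖ d) ℤₚ
  in-ideal a d v P∣a with divisible a v P∣a
  ... | y , q = y , Q.trans {a /p^ d} {π^ v *ᶻ y /p^ d} {p^ (v ⊖ d) *ᵠ ι y}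
    (mk≈ᵠ (Z.*-congˡ {π^ d} {a} {π^ v *ᶻ y} q))
    (Q.sym {p^ (v ⊖ d) *ᵠ ι y} {π^ v *ᶻ y /p^ d} (quotient-form v d y))

  not-in-ideal : ∀ a d v → ¬ P (suc v) ∣ approx a (suc v) →
    ¬ (a /p^ d) ∈p^ ℤ.suc (v ⊖ d) ℤₚ
  not-in-ideal a d v P∤a (y , q) = P∤a (indivisible a (suc v) y
    (num≈ {a} {π^ suc v *ᶻ y} {d}
      (Q.trans {a /p^ d} {p^ (suc v ⊖ d) *ᵠ ι y} {π^ suc v *ᶻ y /p^ d}
        (subst (λ i → (a /p^ d) ≈ᵠ p^ i *ᵠ ι y) (suc-⊖ v d) q)
        (quotient-form (suc v) d y))))

  num≉0 : ∀ a d → ¬ (a /p^ d) ≈ᵠ 0ᵠ → ¬ a ≈ᶻ fromℤ (+ 0)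
  num≉0 a d x≉0 a≈0 = x≉0 (mk≈ᵠ
    (Z.trans {π^ 0 *ᶻ a} {π^ 0 *ᶻ fromℤ (+ 0)} {π^ d *ᶻ fromℤ (+ 0)}
      (Z.*-congˡ {π^ 0} {a} {fromℤ (+ 0)} a≈0)
      (pointwise λ _ → sym (ℤP.*-zeroʳ (P d)))))

  integral : ∀ l .{{_ : NonZero l}} x v → x ∈p^ v ℤₚ →
    ∃ λ y → ι y ≈ᵠ p^ (ℤ.- (+ l ℤ.* (v /ℕ l))) *ᵠ x
  integral l x v (w , x≈) = π^ r *ᶻ w , Q.sym (begin
    p^ (ℤ.- s) *ᵠ x                 ≈⟨ Q.*-congˡ {p^ (ℤ.- s)} x≈ ⟩
    p^ (ℤ.- s) *ᵠ (p^ v *ᵠ ι w)     ≈⟨ Q.*-assoc (p^ (ℤ.- s)) (p^ v) (ι w) ⟨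
    p^ (ℤ.- s) *ᵠ p^ v *ᵠ ι w       ≈⟨ Q.*-congʳ {ι w} (p^-+ (ℤ.- s) v) ⟨
    p^ (ℤ.- s ℤ.+ v) *ᵠ ι w         ≡⟨ cong (λ i → p^ i *ᵠ ι w) exponent≡ ⟩
    ι (π^ r *ᶻ w)                   ∎)
    where
    open QR
    r = v %ℕ l
    s = + l ℤ.* (v /ℕ l)
    int : ∀ L u r → ℤ.- (L ℤ.* u) ℤ.+ (r ℤ.+ u ℤ.* L) ≡ r
    int = solve-∀
    exponent≡ : ℤ.- s ℤ.+ v ≡ + r
    exponent≡ = trans (cong (λ i → ℤ.- s ℤ.+ i) (a≡a%ℕn+[a/ℕn]*n v l))
                      (int (+ l) (v /ℕ l) (+ r))

  largest-power : ExcludedMiddle 0ℓ → ∀ a → ¬ a ≈ᶻ fromℤ (+ 0) →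
    ∃ λ v → P v ∣ approx a v × ¬ P (suc v) ∣ approx a (suc v)
  largest-power em a a≉0 =
    last-power a (proj₁ (nonzero-power em a a≉0))
                 (proj₂ (nonzero-power em a a≉0))

  assemble : ∀ a d →
    (∃ λ v → P v ∣ approx a v × ¬ P (suc v) ∣ approx a (suc v)) →
    ∃ (IsValuation (a /p^ d))
  assemble a d (v , P∣a , P∤a) =
    v ⊖ d , in-ideal a d v P∣a , not-in-ideal a d v P∤a

  -- Opaque only for type-checking speed: the value of a valuation, and the
  -- integral multiple below, are determined up to equality by their types.
  opaque
    valuation : ExcludedMiddle 0ℓ → ∀ x → ¬ x ≈ᵠ 0ᵠ → ∃ (IsValuation x)
    valuation em (a /p^ d) x≉0 = assemble a d (largest-power em a (num≉0 a d x≉0))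

  -- The excluded middle is what decides whether a p-adic number vanishes.
  module _ (em : ExcludedMiddle 0ℓ) where

    ν : ∀ x → ¬ x ≈ᵠ 0ᵠ → ℤ
    ν x x≉0 = proj₁ (valuation em x x≉0)

    module _ (l : ℕ) .{{_ : NonZero l}} where

      -- _/ℕ_ rounds towards -∞.
      νˡ : ∀ x → ¬ x ≈ᵠ 0ᵠ → ℤ
      νˡ x x≉0 = ν x x≉0 /ℕ l

      opaque
        𝓛-integral : ∀ x (x≉0 : ¬ x ≈ᵠ 0ᵠ) →
          ∃ λ y → ι y ≈ᵠ p^ (ℤ.- (+ l ℤ.* νˡ x x≉0)) *ᵠ x
        𝓛-integral x x≉0 =
          integral l x (ν x x≉0) (proj₁ (proj₂ (valuation em x x≉0)))

      𝓛 : ℚₚ → ℤₚ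
      𝓛 x with em {x ≈ᵠ 0ᵠ}
      ... | yes _   = fromℤ (+ 0)
      ... | no  x≉0 = proj₁ (𝓛-integral x x≉0)

  -- The image of ℚ in ℚₚ: x is the fraction a / b when b x = a.
  Rational : Pred ℚₚ 0ℓ
  Rational x = ∃ λ (q : ℚ) → ι (fromℤ (↧ q)) *ᵠ x ≈ᵠ ι (fromℤ (↥ q))

  open Polynomials ℚₚ-commutativeRing public
  open Regularity ℤₚ-module public

  Roots : Polynomial → Pred ℤₚ 0ℓ
  Roots f x = eval f (ι x) ≈ᵠ 0ᵠ

  𝓛-values : ExcludedMiddle 0ℓ → (l : ℕ) .{{_ : NonZero l}} →
             Polynomial → ℕ → ℤₚ
  𝓛-values em l f n = 𝓛 em l (eval f (ι (fromℤ (+ n))))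

{-# OPTIONS --safe #-}

-- Multiplying f by a power of pˡ makes its coefficients p-adic integers without
-- changing 𝓛 (f n); then y = 𝓛 x is characterised by x = pˡ^q y with pˡ ∤ y.
--
-- Regularity. ℤ is Noetherian, so it is enough that some non-zero integer
-- multiple of the sequence lies in a finitely generated module of sequences
-- that is stable under s ↦ (s (k n + j))ₙ for all j < k. By compactness of ℤₚ one
-- may work on a small ball. Away from the roots, 𝓛 (f n) is f n divided by a
-- constant power of p. Near a root c / b, it is up to a constant factor
-- H n · 𝓛 (p^ρ (b n - c)ᵉ) for a polynomial H, and n ↦ p n + j carries b n - c
-- either to p (b n - c′), with c′ in a finite set, or to a p-adic unit.
--
-- Irregularity. Modulo pˢ the k-kernel of a regular sequence is finite. The
-- member n ↦ 𝓛 (f (kⁱ n + j)) is, for large s, locally constant modulo pˢ at exactly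
-- those γ ∈ ℤₚ for which kⁱ γ + j is not a root. Writing k = pᵗ k′ with p ∤ k′, a root α
-- gives such points γ = (α - j) / kⁱ for all j ≡ α mod p^(t i), and these are
-- infinitely many if α is irrational or k′ ≥ 2.
module Submission where

open import Defs
open import Axiom.ExcludedMiddle using (ExcludedMiddle)
open import Data.Nat.Base using (ℕ; _≤_; NonZero)
open import Data.Nat.Primality using (Prime)
open import Data.Product.Base using (_×_)
open import Function.Bundles using (_⇔_)
open import Level using (0ℓ)
open import Relation.Nullary using (¬_)
open import Relation.Unary using (Empty; Satisfiable; _⊆_; _⊈_; _⊢_)

open import Algebra.Bundles using (CommutativeRing)
import Algebra.Properties.CommutativeSemiring.Exp as CommutativeExp
import Algebra.Properties.Semiring.Exp as Exp
import Algebra.Solver.Ring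
open import Algebra.Solver.Ring.AlmostCommutativeRing
  using (fromCommutativeRing; _-Raw-AlmostCommutative⟶_)
open import Data.Fin.Base as Fin using (Fin; toℕ; fromℕ<)
import Data.Fin.Properties as FinP
open import Data.Integer.Base as ℤ using (ℤ; +_; -[1+_]; _/ℕ_; _%ℕ_)
open import Data.Integer.Divisibility.Signed
open import Data.Integer.DivMod using (a≡a%ℕn+[a/ℕn]*n; n%ℕd<d)
import Data.Integer.GCD as ℤGCD
import Data.Integer.Properties as ℤP
import Data.Integer.Tactic.RingSolver as ℤSolver
open import Data.List.Base
  using (List; []; _∷_; _++_; length; map; filter; lookup; tabulate; allFin; upTo; cartesianProductWith)
open import Data.List.Membership.Propositional using (_∈_; find)
open import Data.List.Membership.Propositional.Properties
  using (∈-++⁺ˡ; ∈-++⁺ʳ; ∈-++⁻; ∈-map⁺; ∈-map⁻; ∈-upTo⁺; ∈-upTo⁻; ∈-lookup;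
         ∈-cartesianProductWith⁺; ∈-cartesianProductWith⁻)
import Data.List.Properties as ListP
open import Data.List.Relation.Unary.All as All using (All; []; _∷_)
import Data.List.Relation.Unary.All.Properties as AllP
open import Data.List.Relation.Unary.AllPairs as AllPairs using (AllPairs; []; _∷_)
import Data.List.Relation.Unary.AllPairs.Properties as AllPairsP
open import Data.List.Relation.Unary.Any as Any using (Any; here; there)
import Data.List.Relation.Unary.Any.Properties as AnyP
open import Data.List.Relation.Unary.Unique.Propositional using (Unique)
import Data.List.Relation.Unary.Unique.Propositional.Properties as UniqueP
open import Data.Maybe.Base using (nothing; just)
open import Data.Nat.Base as ℕ using (zero; suc; _<_; z≤n; s≤s)
open import Data.Nat.Coprimality as Coprimality using (Coprime)
import Data.Nat.Divisibility as ℕ∣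
open import Data.Nat.DivMod using (_/_; _%_; m≡m%n+[m/n]*n; m%n<n; m<n*o⇒m/o<n)
import Data.Nat.GCD as GCD
open import Data.Nat.Induction using (<-rec)
open import Data.Nat.Primality using (prime⇒nonZero; prime⇒nonTrivial; prime⇒irreducible; euclidsLemma)
import Data.Nat.Properties as ℕP
import Data.Nat.Tactic.RingSolver as ℕSolver
open import Data.Product.Base using (Σ; ∃; ∃₂; _,_; proj₁; proj₂)
open import Data.Rational.Base as ℚ using (mkℚ; ↥_; ↧_)
import Data.Rational.Properties as ℚP
open import Data.Sum.Base as Sum using (_⊎_; inj₁; inj₂; [_,_]′)
open import Function.Base using (_∘_; id)
open import Function.Bundles using (mk⇔)
open import Relation.Binary.Definitions using (tri<; tri≈; tri>)
open import Relation.Binary.PropositionalEquality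
  using (_≡_; _≢_; refl; sym; trans; cong; cong₂; subst; subst₂; module ≡-Reasoning)
import Relation.Binary.Reasoning.Setoid as SetoidReasoning
open import Relation.Nullary using (Dec; yes; no; ¬?; contradiction)
open import Relation.Unary using (Pred; Decidable)

-- When l ≥ 2 the map 𝓛 is not multiplicative; in general only units can be taken out of it. Hence
-- the factor H of F = (X - α)ᵉ H is not normalised on its own: on a ball where its valuation is a
-- constant v, the power pᵛ joins the powers of p beside the linear factor, and only a unit is left
-- to be taken out. Powers of pˡ are invisible to 𝓛, so the exponent ρ of p matters only modulo l;
-- this keeps the family attached to a rational root finite.
--
-- Irregularity is detected modulo pˢ with s = t + l, where t is the valuation of (1 + p)ᵉ - 1 and e
-- is the multiplicity of α. Approaching one point along w = 1 and along w = 1 + p gives y and (1 +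
-- p)ᵉ y modulo pˢ with pˡ ∤ y, and these differ. The unit 1 + p suits every prime and every e ≥ 1,
-- whereas a root of unity such as -1 would fail for even e.
--
-- Base p escapes this argument at a rational root α = c / b: the points (α - j) / pⁱ with 0 ≤ j <
-- pⁱ are fractions with denominator b and bounded numerator. The same finiteness closes the family
-- of linear factors.

-- Divisibility, units and polynomial division in ℤₚ

module Arithmetic (p : ℕ) (p-prime : Prime p) where
  open Padic p p-prime hiding (Polynomial; NonZeroPolynomial; eval)

  module Z = CommutativeRing ℤₚ-commutativeRing
  module ZR = SetoidReasoning Z.setoid
  module ZPoly = Polynomials ℤₚ-commutativeRing
  open Exp Z.semiring public using (_^_; ^-congˡ)
  open CommutativeExp Z.commutativeSemiring public using (^-distrib-*)

  instance
    p≢0 : NonZero p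
    p≢0 = prime⇒nonZero p-prime

  p≥2 : 2 ≤ p
  p≥2 = ℕ.nonTrivial⇒n>1 p {{prime⇒nonTrivial p-prime}}

  infixl 6 _-ᶻ_
  _-ᶻ_ : ℤₚ → ℤₚ → ℤₚ
  x -ᶻ y = x +ᶻ (-ᶻ y)

  p∤1 : ¬ p ℕ∣.∣ 1
  p∤1 p∣1 = ℕP.<⇒≱ p≥2 (ℕ∣.∣⇒≤ p∣1)

  p∤1+p : ¬ p ℕ∣.∣ suc p
  p∤1+p p∣ = p∤1 (ℕ∣.∣m+n∣m⇒∣n (subst (p ℕ∣.∣_) (ℕP.+-comm 1 p) p∣) ℕ∣.∣-refl)

  0ᶻ 1ᶻ : ℤₚ
  0ᶻ = fromℤ (+ 0)
  1ᶻ = fromℤ (+ 1)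

  private
    fromℤ-homomorphism :
      ℤ.+-*-rawRing -Raw-AlmostCommutative⟶ fromCommutativeRing ℤₚ-commutativeRing
    fromℤ-homomorphism = record
      { ⟦_⟧    = fromℤ
      ; +-homo = λ _ _ → pointwise λ _ → refl
      ; *-homo = λ _ _ → pointwise λ _ → refl
      ; -‿homo = λ _ → pointwise λ _ → refl
      ; 0-homo = pointwise λ _ → refl
      ; 1-homo = pointwise λ _ → refl
      }

    weaklyDecide : (i j : ℤ) → _
    weaklyDecide i j with i ℤP.≟ j
    ... | yes i≡j = just (Z.reflexive (cong fromℤ i≡j))
    ... | no  _   = nothing

  module Solver = Algebra.Solver.Ring ℤ.+-*-rawRing
    (fromCommutativeRing ℤₚ-commutativeRing) fromℤ-homomorphism weaklyDecide

  open Solver using (solve; _:=_; _:+_; _:*_; _:-_; :-_; con)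

  fromℤ-* : ∀ i j → fromℤ (i ℤ.* j) ≈ᶻ fromℤ i *ᶻ fromℤ j
  fromℤ-* i j = pointwise λ _ → refl

  -- Integers modulo powers of p

  P-suc : ∀ n → P (suc n) ≡ P 1 ℤ.* P n
  P-suc n = P-+ 1 n

  private
    shuffle : ∀ a b c → a ℤ.* b ℤ.* c ≡ b ℤ.* (a ℤ.* c)
    shuffle = ℤSolver.solve-∀

    shuffle′ : ∀ a b c → a ℤ.* (b ℤ.* c) ≡ c ℤ.* (a ℤ.* b)
    shuffle′ = ℤSolver.solve-∀

  P1∣-prime : ∀ x y → P 1 ∣ x ℤ.* y → P 1 ∣ x ⊎ P 1 ∣ y
  P1∣-prime x y q = Sum.map back back (euclidsLemma ℤ.∣ x ∣ ℤ.∣ y ∣ p-prime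
    (subst (p ℕ∣.∣_) (ℤP.abs-* x y)
      (subst (ℕ∣._∣ ℤ.∣ x ℤ.* y ∣) (ℕP.^-identityʳ p) (∣⇒∣ᵤ q))))
    where
    back : ∀ {z} → p ℕ∣.∣ ℤ.∣ z ∣ → P 1 ∣ z
    back {z} r = ∣ᵤ⇒∣ (subst (ℕ∣._∣ ℤ.∣ z ∣) (sym (ℕP.^-identityʳ p)) r)

  P-suc-∣ : ∀ n z → P n ∣ z → P (suc n) ∣ z ℤ.* P 1
  P-suc-∣ n z q = subst₂ _∣_ (sym (P-suc n)) (ℤP.*-comm (P 1) z) (*-monoʳ-∣ (P 1) q)

  -- Primality lets one factor p at a time be removed from x or from y. The asymmetric form is the
  -- one that gets applied: if x has valuation at most a, the remaining pᵇ must come from y; a = 0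
  -- cancels units.
  P-∣-* : ∀ a b x y → P (a ℕ.+ b) ∣ x ℤ.* y → P (suc a) ∣ x ⊎ P b ∣ y
  P-∣-* a zero    x y q = inj₂ (divides y (sym (ℤP.*-identityʳ y)))
  P-∣-* a (suc b) x y q
    with P1∣-prime x y (∣-trans (divides (P (a ℕ.+ b)) e) q)
    where
    e : P (a ℕ.+ suc b) ≡ P (a ℕ.+ b) ℤ.* P 1
    e = trans (cong P (ℕP.+-suc a b))
          (trans (P-suc (a ℕ.+ b)) (ℤP.*-comm (P 1) (P (a ℕ.+ b))))
  ... | inj₂ (divides y′ refl) = Sum.map id (P-suc-∣ b y′)
    (P-∣-* a b x y′ (*-cancelˡ-∣ (P 1) {P (a ℕ.+ b)} {x ℤ.* y′} {{P-nonZero {1}}}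
      (subst₂ _∣_ (trans (cong P (ℕP.+-suc a b)) (P-suc (a ℕ.+ b))) (shuffle′ x y′ (P 1)) q)))
  P-∣-* zero    (suc b) x y q | inj₁ r = inj₁ r
  P-∣-* (suc a) (suc b) x y q | inj₁ (divides x′ refl) = Sum.map (P-suc-∣ (suc a) x′) id
    (P-∣-* a (suc b) x′ y (*-cancelˡ-∣ (P 1) {P (a ℕ.+ suc b)} {x′ ℤ.* y} {{P-nonZero {1}}}
      (subst₂ _∣_ (P-suc (a ℕ.+ suc b)) (shuffle x′ (P 1) y) q)))

  P0∣ : ∀ x → P 0 ∣ x
  P0∣ x = divides x (sym (ℤP.*-identityʳ x))

  P∣P : ∀ {m n} → m ≤ n → P m ∣ P n
  P∣P {m} {n} m≤n = divides (P (n ℕ.∸ m))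
    (trans (cong P (sym (ℕP.m∸n+n≡m m≤n))) (P-+ (n ℕ.∸ m) m))

  -- Divisibility and congruence in ℤₚ

  -- The n-th component alone determines x modulo pⁿ; coherence carries the condition to all later
  -- components.
  Div : ℕ → ℤₚ → Set
  Div n x = P n ∣ approx x n

  infix 4 _≡_[p^_]
  _≡_[p^_] : ℤₚ → ℤₚ → ℕ → Set
  x ≡ y [p^ n ] = Div n (x -ᶻ y)

  Div-from-far : ∀ {x} m n → P n ∣ approx x (m ℕ.+ n) → Div n x
  Div-from-far {x} m n q = subst (P n ∣_) (id₁ (approx x (m ℕ.+ n)) (approx x n))
    (∣m∣n⇒∣m-n q (far x m n))
    where
    id₁ : ∀ a b → a ℤ.- (a ℤ.- b) ≡ b
    id₁ = ℤSolver.solve-∀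

  Div-to-far : ∀ {x} m n → Div n x → P n ∣ approx x (m ℕ.+ n)
  Div-to-far {x} m n q = subst (P n ∣_) (id₁ (approx x (m ℕ.+ n)) (approx x n))
    (∣m∣n⇒∣m+n q (far x m n))
    where
    id₁ : ∀ a b → b ℤ.+ (a ℤ.- b) ≡ a
    id₁ = ℤSolver.solve-∀

  Div-≈ : ∀ {x y} n → x ≈ᶻ y → Div n x → Div n y
  Div-≈ {x} {y} n x≈y q = subst (P n ∣_) (id₁ (approx x n) (approx y n))
    (∣m∣n⇒∣m-n q (congruent x≈y n))
    where
    id₁ : ∀ a b → a ℤ.- (a ℤ.- b) ≡ b
    id₁ = ℤSolver.solve-∀

  Div-* : ∀ a b x y → Div (a ℕ.+ b) (x *ᶻ y) → Div (suc a) x ⊎ Div b y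
  Div-* a b x y q = Sum.map left (Div-from-far {y} (suc a) b)
    (P-∣-* a b (approx x (suc a ℕ.+ b)) (approx y (suc a ℕ.+ b))
      (Div-to-far {x *ᶻ y} 1 (a ℕ.+ b) q))
    where
    left : P (suc a) ∣ approx x (suc a ℕ.+ b) → Div (suc a) x
    left r = Div-from-far {x} b (suc a)
      (subst (λ i → P (suc a) ∣ approx x i) (ℕP.+-comm (suc a) b) r)

  Div-mono : ∀ {x m n} → m ≤ n → Div n x → Div m x
  Div-mono {x} {m} {n} m≤n q = Div-from-far {x} (n ℕ.∸ m) m
    (subst (λ i → P m ∣ approx x i) (sym (ℕP.m∸n+n≡m m≤n))
      (∣-trans (P∣P m≤n) q))

  Div-+ : ∀ {x y} n → Div n x → Div n y → Div n (x +ᶻ y)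
  Div-+ n = ∣m∣n⇒∣m+n

  Div-neg : ∀ {x} n → Div n x → Div n (-ᶻ x)
  Div-neg n = ∣m⇒∣-m

  Div-*ʳ : ∀ {x} n y → Div n y → Div n (x *ᶻ y)
  Div-*ʳ {x} n y = ∣n⇒∣m*n (approx x n)

  Div-*ˡ : ∀ {x} n y → Div n x → Div n (x *ᶻ y)
  Div-*ˡ {x} n y = ∣m⇒∣m*n (approx y n)

  Div-π : ∀ n → Div n (π^ n)
  Div-π n = ∣-refl

  Div-0 : ∀ n → Div n 0ᶻ
  Div-0 n = divides (+ 0) refl

  Div-π* : ∀ m n x → Div n x → Div (m ℕ.+ n) (π^ m *ᶻ x)
  Div-π* m n x q = subst (_∣ P m ℤ.* approx x (m ℕ.+ n)) (sym (P-+ m n))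
    (*-monoʳ-∣ (P m) (Div-to-far {x} m n q))

  Div-π*⁻¹ : ∀ m n x → Div (m ℕ.+ n) (π^ m *ᶻ x) → Div n x
  Div-π*⁻¹ m n x q = Div-from-far {x} m n
    (*-cancelˡ-∣ (P m) {{P-nonZero {m}}}
      (subst (_∣ P m ℤ.* approx x (m ℕ.+ n)) (P-+ m n) q))

  ≡-refl : ∀ {x} n → x ≡ x [p^ n ]
  ≡-refl {x} n = congruent (Z.refl {x}) n

  ≈⇒≡ : ∀ {x y} n → x ≈ᶻ y → x ≡ y [p^ n ]
  ≈⇒≡ n q = congruent q n

  ≡-sym : ∀ {x y} n → x ≡ y [p^ n ] → y ≡ x [p^ n ]
  ≡-sym {x} {y} n q = Div-≈ n
    (solve 2 (λ x y → :- (x :- y) := y :- x) Z.refl x y) (Div-neg {x -ᶻ y} n q)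

  ≡-trans : ∀ {x y z} n → x ≡ y [p^ n ] → y ≡ z [p^ n ] → x ≡ z [p^ n ]
  ≡-trans {x} {y} {z} n q r = Div-≈ n
    (solve 3 (λ x y z → (x :- y) :+ (y :- z) := x :- z) Z.refl x y z)
    (Div-+ {x -ᶻ y} {y -ᶻ z} n q r)

  ≡-+ : ∀ {x y u v} n → x ≡ y [p^ n ] → u ≡ v [p^ n ] → x +ᶻ u ≡ y +ᶻ v [p^ n ]
  ≡-+ {x} {y} {u} {v} n q r = Div-≈ n
    (solve 4 (λ x y u v → (x :- y) :+ (u :- v) := (x :+ u) :- (y :+ v)) Z.refl x y u v)
    (Div-+ {x -ᶻ y} {u -ᶻ v} n q r)

  ≡-* : ∀ {x y u v} n → x ≡ y [p^ n ] → u ≡ v [p^ n ] → x *ᶻ u ≡ y *ᶻ v [p^ n ]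
  ≡-* {x} {y} {u} {v} n q r = Div-≈ n
    (solve 4 (λ x y u v → u :* (x :- y) :+ y :* (u :- v) := (x :* u) :- (y :* v)) Z.refl x y u v)
    (Div-+ {u *ᶻ (x -ᶻ y)} {y *ᶻ (u -ᶻ v)} n
      (Div-*ʳ {u} n (x -ᶻ y) q) (Div-*ʳ {y} n (u -ᶻ v) r))

  ≡-^ : ∀ {x y} n e → x ≡ y [p^ n ] → x ^ e ≡ y ^ e [p^ n ]
  ≡-^         n zero    q = ≡-refl {1ᶻ} n
  ≡-^ {x} {y} n (suc e) q = ≡-* {x} {y} {x ^ e} {y ^ e} n q (≡-^ n e q)

  ≡-eval : ∀ {x y} n F → x ≡ y [p^ n ] → ZPoly.eval F x ≡ ZPoly.eval F y [p^ n ]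
  ≡-eval n []      q = ≡-refl {0ᶻ} n
  ≡-eval {x} {y} n (c ∷ F) q =
    ≡-+ {c} {c} {x *ᶻ ZPoly.eval F x} {y *ᶻ ZPoly.eval F y} n (≡-refl {c} n)
      (≡-* {x} {y} {ZPoly.eval F x} {ZPoly.eval F y} n q (≡-eval n F q))

  ≡-Div : ∀ {x y} n → x ≡ y [p^ n ] → Div n y → Div n x
  ≡-Div {x} {y} n q r = Div-≈ n
    (solve 2 (λ x y → (x :- y) :+ y := x) Z.refl x y) (Div-+ {x -ᶻ y} {y} n q r)

  ≡-mono : ∀ {x y m n} → m ≤ n → x ≡ y [p^ n ] → x ≡ y [p^ m ]
  ≡-mono {x} {y} = Div-mono {x -ᶻ y}

  ≡-approx : ∀ x n → fromℤ (approx x n) ≡ x [p^ n ]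
  ≡-approx x n = congruent (Z.refl {fromℤ (approx x n)}) n

  difference : ∀ {x y} n → x ≡ y [p^ n ] → ∃ λ z → x ≈ᶻ y +ᶻ π^ n *ᶻ z
  difference {x} {y} n q = z , (begin
    x                ≈⟨ solve 2 (λ x y → x := y :+ (x :- y)) Z.refl x y ⟩
    y +ᶻ (x -ᶻ y)    ≈⟨ Z.+-congˡ {y} eq ⟩
    y +ᶻ π^ n *ᶻ z   ∎)
    where
    open ZR
    z = proj₁ (divisible (x -ᶻ y) n q)
    eq = proj₂ (divisible (x -ᶻ y) n q)

  all-Div⇒≈0 : ∀ {x} → (∀ n → Div n x) → x ≈ᶻ 0ᶻ
  all-Div⇒≈0 {x} h = mk≈ᶻ λ n →
    subst (P n ∣_) (sym (ℤP.+-identityʳ (approx x n))) (h n)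

  ≈0⇒Div : ∀ {x} n → x ≈ᶻ 0ᶻ → Div n x
  ≈0⇒Div n q = Div-≈ n (Z.sym q) (Div-0 n)

  -≈0⇒≈ : ∀ {x y} → x -ᶻ y ≈ᶻ 0ᶻ → x ≈ᶻ y
  -≈0⇒≈ {x} {y} q = begin
    x               ≈⟨ solve 2 (λ x y → x := (x :- y) :+ y) Z.refl x y ⟩
    (x -ᶻ y) +ᶻ y   ≈⟨ Z.+-congʳ {y} q ⟩
    0ᶻ +ᶻ y         ≈⟨ Z.+-identityˡ y ⟩
    y               ∎
    where open ZR

  ≈⇒-≈0 : ∀ {x y} → x ≈ᶻ y → x -ᶻ y ≈ᶻ 0ᶻ
  ≈⇒-≈0 {x} {y} q = Z.trans (Z.+-congʳ { -ᶻ y } q) (Z.-‿inverseʳ y)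

  n<p^n : ∀ n → n < p ℕ.^ n
  n<p^n zero    = s≤s z≤n
  n<p^n (suc n) = ℕP.<-≤-trans (s≤s (n<p^n n)) (begin
    suc (p ℕ.^ n)         ≤⟨ ℕP.+-monoˡ-≤ (p ℕ.^ n) (ℕ.>-nonZero⁻¹ (p ℕ.^ n) {{ℕP.m^n≢0 p n}}) ⟩
    p ℕ.^ n ℕ.+ p ℕ.^ n   ≡⟨ cong (p ℕ.^ n ℕ.+_) (ℕP.+-identityʳ (p ℕ.^ n)) ⟨
    2 ℕ.* p ℕ.^ n         ≤⟨ ℕP.*-monoˡ-≤ (p ℕ.^ n) p≥2 ⟩
    p ℕ.* p ℕ.^ n         ∎)
    where open ℕP.≤-Reasoning

  small-Div⇒≡0 : ∀ n i → ℤ.∣ i ∣ < p ℕ.^ n → P n ∣ i → i ≡ + 0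
  small-Div⇒≡0 n i i<p q with ℤ.∣ i ∣ in eq
  ... | zero  = ℤP.∣i∣≡0⇒i≡0 eq
  ... | suc k = contradiction (ℕ∣.∣⇒≤ (subst (p ℕ.^ n ℕ∣.∣_) eq (∣⇒∣ᵤ q))) (ℕP.<⇒≱ i<p)

  fromℤ-≉0 : ∀ i → i ≢ + 0 → ¬ fromℤ i ≈ᶻ 0ᶻ
  -- The exponent ∣i∣ is large enough because ∣i∣ < p^∣i∣.
  fromℤ-≉0 i i≢0 q = i≢0 (small-Div⇒≡0 ℤ.∣ i ∣ i (n<p^n ℤ.∣ i ∣) (≈0⇒Div {fromℤ i} ℤ.∣ i ∣ q))

  fromℤ-injective : ∀ {i j} → fromℤ i ≈ᶻ fromℤ j → i ≡ j
  fromℤ-injective {i} {j} q with i ℤ.- j ℤP.≟ + 0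
  ... | yes i-j≡0 = ℤP.i-j≡0⇒i≡j i j i-j≡0
  ... | no  i-j≢0 = contradiction
    (Z.trans (pointwise λ _ → refl) (≈⇒-≈0 {fromℤ i} {fromℤ j} q))
    (fromℤ-≉0 (i ℤ.- j) i-j≢0)

  -- Inverses: if u w = 1 - p z then w (1 + p z + ... + (p z)ⁿ⁻¹) inverts u
  -- modulo pⁿ.
  private
    geometric : ℤ → ℕ → ℤ
    geometric t zero    = + 0
    geometric t (suc n) = + 1 ℤ.+ t ℤ.* geometric t n

    geometric-inverse : ∀ u w z → u ℤ.* w ≡ + 1 ℤ.- P 1 ℤ.* z → ∀ n →
      P n ∣ u ℤ.* w ℤ.* geometric (P 1 ℤ.* z) n ℤ.- + 1
    geometric-inverse u w z eq zero    = P0∣ (u ℤ.* w ℤ.* + 0 ℤ.- + 1)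
    geometric-inverse u w z eq (suc n) = lemma (P-suc n) eq (geometric-inverse u w z eq n)
      where
      g = geometric (P 1 ℤ.* z) n
      int : ∀ P₁ z g → (+ 1 ℤ.- P₁ ℤ.* z) ℤ.* (+ 1 ℤ.+ P₁ ℤ.* z ℤ.* g) ℤ.- + 1 ≡
            z ℤ.* (P₁ ℤ.* ((+ 1 ℤ.- P₁ ℤ.* z) ℤ.* g ℤ.- + 1))
      int = ℤSolver.solve-∀
      lemma : ∀ {Ps Pn uw} → Ps ≡ P 1 ℤ.* Pn → uw ≡ + 1 ℤ.- P 1 ℤ.* z →
        Pn ∣ uw ℤ.* g ℤ.- + 1 →
        Ps ∣ uw ℤ.* (+ 1 ℤ.+ P 1 ℤ.* z ℤ.* g) ℤ.- + 1
      lemma refl refl q = subst (_ ∣_) (sym (int (P 1) z g))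
        (∣n⇒∣m*n z (*-monoʳ-∣ (P 1) q))

    bézout : ∀ u → ¬ p ℕ∣.∣ u → ∃₂ λ w z → + u ℤ.* w ≡ + 1 ℤ.- P 1 ℤ.* z
    bézout u p∤u with Coprimality.coprime-Bézout coprime
      where
      coprime : Coprime u p
      coprime (d∣u , d∣p) with prime⇒irreducible p-prime d∣p
      ... | inj₁ d≡1 = d≡1
      ... | inj₂ refl = contradiction d∣u p∤u
    ... | GCD.Bézout.+- x y eq = + x , ℤ.- + y , (begin
      + u ℤ.* + x                    ≡⟨ ℤP.*-comm (+ u) (+ x) ⟩
      + x ℤ.* + u                    ≡⟨ ℤP.pos-* x u ⟨
      + (x ℕ.* u)                    ≡⟨ cong +_ eq ⟨
      + 1 ℤ.+ + (y ℕ.* p)            ≡⟨ cong (λ i → + 1 ℤ.+ i) (ℤP.pos-* y p) ⟩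
      + 1 ℤ.+ + y ℤ.* + p            ≡⟨ cong (λ i → + 1 ℤ.+ + y ℤ.* + i) (ℕP.^-identityʳ p) ⟨
      + 1 ℤ.+ + y ℤ.* P 1            ≡⟨ int (+ y) (P 1) ⟩
      + 1 ℤ.- P 1 ℤ.* (ℤ.- + y)      ∎)
      where
      open ≡-Reasoning
      int : ∀ y q → + 1 ℤ.+ y ℤ.* q ≡ + 1 ℤ.- q ℤ.* (ℤ.- y)
      int = ℤSolver.solve-∀
    ... | GCD.Bézout.-+ x y eq = ℤ.- + x , + y , (begin
      + u ℤ.* (ℤ.- + x)              ≡⟨ int (+ u) (+ x) ⟩
      + 1 ℤ.- (+ 1 ℤ.+ + x ℤ.* + u)  ≡⟨ cong (λ i → + 1 ℤ.- (+ 1 ℤ.+ i)) (ℤP.pos-* x u) ⟨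
      + 1 ℤ.- + (1 ℕ.+ x ℕ.* u)      ≡⟨ cong (λ i → + 1 ℤ.- + i) eq ⟩
      + 1 ℤ.- + (y ℕ.* p)            ≡⟨ cong (λ i → + 1 ℤ.- i) (ℤP.pos-* y p) ⟩
      + 1 ℤ.- + y ℤ.* + p            ≡⟨ cong (λ i → + 1 ℤ.- + y ℤ.* + i) (ℕP.^-identityʳ p) ⟨
      + 1 ℤ.- + y ℤ.* P 1            ≡⟨ cong (λ i → + 1 ℤ.- i) (ℤP.*-comm (+ y) (P 1)) ⟩
      + 1 ℤ.- P 1 ℤ.* + y            ∎)
      where
      open ≡-Reasoning
      int : ∀ u x → u ℤ.* (ℤ.- x) ≡ + 1 ℤ.- (+ 1 ℤ.+ x ℤ.* u)
      int = ℤSolver.solve-∀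

  p∤⇒¬Div : ∀ u → ¬ p ℕ∣.∣ u → ¬ P 1 ∣ + u
  p∤⇒¬Div u p∤u q = p∤u (subst (ℕ∣._∣ u) (ℕP.^-identityʳ p) (∣⇒∣ᵤ q))

  unit-divides : ∀ u → ¬ p ℕ∣.∣ u → ∀ x → ∃ λ y → fromℤ (+ u) *ᶻ y ≈ᶻ x
  unit-divides u p∤u x = y , mk≈ᶻ near
    where
    w = proj₁ (bézout u p∤u)
    z = proj₁ (proj₂ (bézout u p∤u))
    inv : ℕ → ℤ
    inv n = w ℤ.* geometric (P 1 ℤ.* z) n
    near : ∀ n → P n ∣ + u ℤ.* (inv n ℤ.* approx x n) ℤ.- approx x n
    near n = subst (P n ∣_) (int (+ u) w (geometric (P 1 ℤ.* z) n) (approx x n))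
      (∣m⇒∣m*n (approx x n)
        (geometric-inverse (+ u) w z (proj₂ (proj₂ (bézout u p∤u))) n))
      where
      int : ∀ u w g x → (u ℤ.* w ℤ.* g ℤ.- + 1) ℤ.* x ≡ u ℤ.* (w ℤ.* g ℤ.* x) ℤ.- x
      int = ℤSolver.solve-∀
    y : ℤₚ
    y .approx n = inv n ℤ.* approx x n
    -- Modulo pⁿ, u times the difference of two consecutive approximations of y is the corresponding
    -- difference for x, hence 0; as p ∤ u, the factor u cancels.
    y .coherent n = [ (λ q → contradiction q (p∤⇒¬Div u p∤u)) , id ]′
      (P-∣-* 0 n (+ u) _ (subst (P n ∣_)
        (int (+ u) (inv (suc n) ℤ.* approx x (suc n)) (approx x (suc n))
             (inv n ℤ.* approx x n) (approx x n))
        (∣m∣n⇒∣m+n (∣m∣n⇒∣m-n (∣-trans (P∣P (ℕP.n≤1+n n)) (near (suc n))) (near n))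
                   (coherent x n))))
      where
      int : ∀ u y′ x′ y x → ((u ℤ.* y′ ℤ.- x′) ℤ.- (u ℤ.* y ℤ.- x)) ℤ.+ (x′ ℤ.- x)
                            ≡ u ℤ.* (y′ ℤ.- y)
      int = ℤSolver.solve-∀

  module Domain (em : ExcludedMiddle 0ℓ) where

    maximal-power : ∀ {x} → ¬ x ≈ᶻ 0ᶻ → ∃ λ v → Div v x × ¬ Div (suc v) x
    maximal-power {x} = largest-power em x

    -- With v the valuation of x, divisibility of x y by p^(v + n) leaves pⁿ to y, for every n.
    no-zero-divisors : ∀ {x y} → x *ᶻ y ≈ᶻ 0ᶻ → ¬ x ≈ᶻ 0ᶻ → y ≈ᶻ 0ᶻ
    no-zero-divisors {x} {y} xy≈0 x≉0 with maximal-power x≉0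
    ... | v , _ , ¬div = all-Div⇒≈0 λ n →
      [ (λ q → contradiction q ¬div) , id ]′
        (Div-* v n x y (≈0⇒Div {x *ᶻ y} (v ℕ.+ n) xy≈0))

    *-≉0 : ∀ {x y} → ¬ x ≈ᶻ 0ᶻ → ¬ y ≈ᶻ 0ᶻ → ¬ x *ᶻ y ≈ᶻ 0ᶻ
    *-≉0 x≉0 y≉0 xy≈0 = y≉0 (no-zero-divisors xy≈0 x≉0)

    *-cancelˡ : ∀ {d x y} → ¬ d ≈ᶻ 0ᶻ → d *ᶻ x ≈ᶻ d *ᶻ y → x ≈ᶻ y
    *-cancelˡ {d} {x} {y} d≉0 q = -≈0⇒≈ (no-zero-divisors
      (Z.trans (solve 3 (λ d x y → d :* (x :- y) := d :* x :- d :* y) Z.refl d x y)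
               (≈⇒-≈0 q)) d≉0)

    ^-≉0 : ∀ {x} e → ¬ x ≈ᶻ 0ᶻ → ¬ x ^ e ≈ᶻ 0ᶻ
    ^-≉0 zero    x≉0 = fromℤ-≉0 (+ 1) λ ()
    ^-≉0 (suc e) x≉0 = *-≉0 x≉0 (^-≉0 e x≉0)

    open ZPoly using (eval; NonZeroPolynomial)

    -- The quotient of c ∷ F by X - a does not involve c.
    quotients : ℤₚ → List ℤₚ → List ℤₚ
    quotients a []      = []
    quotients a (c ∷ F) = eval (c ∷ F) a ∷ quotients a F

    length-quotients : ∀ a F → length (quotients a F) ≡ length F
    length-quotients a []      = refl
    length-quotients a (c ∷ F) = cong suc (length-quotients a F)

    -- Synthetic division: the coefficients of the quotient are the Horner values at a of the
    -- successive tails of the coefficient list.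
    division : ∀ a c F x →
      eval (c ∷ F) x ≈ᶻ eval (c ∷ F) a +ᶻ (x -ᶻ a) *ᶻ eval (quotients a F) x
    division a c [] x = solve 3 (λ a c x →
      c :+ x :* con (+ 0) := (c :+ a :* con (+ 0)) :+ (x :- a) :* con (+ 0)) Z.refl a c x
    division a c (d ∷ F) x = begin
      c +ᶻ x *ᶻ eval (d ∷ F) x
        ≈⟨ Z.+-congˡ {c} (Z.*-congˡ {x} (division a d F x)) ⟩
      c +ᶻ x *ᶻ (u +ᶻ (x -ᶻ a) *ᶻ v)
        ≈⟨ solve 5 (λ a c x u v → c :+ x :* (u :+ (x :- a) :* v) :=
             (c :+ a :* u) :+ (x :- a) :* (u :+ x :* v)) Z.refl a c x u v ⟩
      (c +ᶻ a *ᶻ u) +ᶻ (x -ᶻ a) *ᶻ (u +ᶻ x *ᶻ v) ∎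
      where
      open ZR
      u = eval (d ∷ F) a
      v = eval (quotients a F) x

    private
      constant-root : ∀ {a} c {y} → y ≈ᶻ 0ᶻ → c +ᶻ a *ᶻ y ≈ᶻ 0ᶻ → c ≈ᶻ 0ᶻ
      constant-root {a} c {y} y≈0 q = begin
        c                ≈⟨ solve 2 (λ a c → c := c :+ a :* con (+ 0)) Z.refl a c ⟩
        c +ᶻ a *ᶻ 0ᶻ     ≈⟨ Z.+-congˡ {c} (Z.*-congˡ {a} y≈0) ⟨
        c +ᶻ a *ᶻ y      ≈⟨ q ⟩
        0ᶻ               ∎
        where open ZR

      value≉0⇒NonZero : ∀ {a} F → ¬ eval F a ≈ᶻ 0ᶻ → NonZeroPolynomial (quotients a F)
      value≉0⇒NonZero []      v≉0 = contradiction Z.refl v≉0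
      value≉0⇒NonZero (c ∷ F) v≉0 = here v≉0

      -- If c is non-zero but c + a F(a) vanishes, then F(a) cannot vanish, and it is the next entry
      -- of the quotient.
      quotients-nonZero : ∀ a F → NonZeroPolynomial F → NonZeroPolynomial (quotients a F)
      quotients-nonZero a (c ∷ F) (there nz) = there (quotients-nonZero a F nz)
      quotients-nonZero a (c ∷ F) (here c≉0) with em {eval (c ∷ F) a ≈ᶻ 0ᶻ}
      ... | no  v≉0 = here v≉0
      ... | yes v≈0 = there (value≉0⇒NonZero F λ w≈0 → c≉0 (constant-root c w≈0 v≈0))

    root-quotient-nonZero : ∀ a c F → NonZeroPolynomial (c ∷ F) →
      eval (c ∷ F) a ≈ᶻ 0ᶻ → NonZeroPolynomial (quotients a F)
    root-quotient-nonZero a c F (there nz)  v≈0 = quotients-nonZero a F nz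
    root-quotient-nonZero a c F (here c≉0) v≈0 =
      value≉0⇒NonZero F λ w≈0 → c≉0 (constant-root c w≈0 v≈0)

    root-division : ∀ a c F → eval (c ∷ F) a ≈ᶻ 0ᶻ → ∀ x →
      eval (c ∷ F) x ≈ᶻ (x -ᶻ a) *ᶻ eval (quotients a F) x
    root-division a c F v≈0 x = Z.trans (division a c F x)
      (Z.trans (Z.+-congʳ v≈0) (Z.+-identityˡ _))

    Factorisation : List ℤₚ → ℤₚ → Set
    Factorisation F a = ∃₂ λ e H →
      (∀ x → eval F x ≈ᶻ (x -ᶻ a) ^ e *ᶻ eval H x) × ¬ eval H a ≈ᶻ 0ᶻ

    -- Each division by X - a shortens the coefficient list by one and keeps it non-zero, so the
    -- process stops at the multiplicity of a, which may be 0.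
    factorisation : ∀ F → NonZeroPolynomial F → ∀ a → Factorisation F a
    factorisation F nz a = go (length F) F refl nz
      where
      go : ∀ n F → length F ≡ n → NonZeroPolynomial F → Factorisation F a
      go n F eq nz with em {eval F a ≈ᶻ 0ᶻ}
      go n F eq nz | no v≉0 = 0 , F , (λ x → Z.sym (Z.*-identityˡ (eval F x))) , v≉0
      go (suc n) (c ∷ F) eq nz | yes v≈0
        with go n (quotients a F) (trans (length-quotients a F) (ℕP.suc-injective eq))
               (root-quotient-nonZero a c F nz v≈0)
      ... | e , H , split , H≉0 = suc e , H , (λ x → begin
          eval (c ∷ F) x                       ≈⟨ root-division a c F v≈0 x ⟩
          (x -ᶻ a) *ᶻ eval (quotients a F) x   ≈⟨ Z.*-congˡ {x -ᶻ a} (split x) ⟩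
          (x -ᶻ a) *ᶻ ((x -ᶻ a) ^ e *ᶻ eval H x)
            ≈⟨ Z.*-assoc (x -ᶻ a) ((x -ᶻ a) ^ e) (eval H x) ⟨
          (x -ᶻ a) ^ suc e *ᶻ eval H x ∎) , H≉0
        where open ZR

    -- In a domain, the roots other than y survive division by X - y. The bound counts list entries,
    -- so trailing zeros only weaken it.
    roots-bound : ∀ F → NonZeroPolynomial F → ∀ ys →
      AllPairs (λ x y → ¬ x ≈ᶻ y) ys → All (λ y → eval F y ≈ᶻ 0ᶻ) ys →
      length ys < length F
    roots-bound (c ∷ F) nz []       _          _          = s≤s z≤n
    roots-bound (c ∷ F) nz (y ∷ ys) (y≉ ∷ ap) (Fy ∷ Fys) =
      s≤s (subst (length ys <_) (length-quotients y F)
        (roots-bound (quotients y F) (root-quotient-nonZero y c F nz Fy) ys ap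
          (All.zipWith (λ {x} (y≉x , Fx≈0) → no-zero-divisors
              (Z.trans (Z.sym (root-division y c F Fy x)) Fx≈0)
              (λ q → y≉x (Z.sym (-≈0⇒≈ q)))) (y≉ , Fys))))

-- The map 𝓛 on ℤₚ, and clearing denominators

module Normalisation (p : ℕ) (p-prime : Prime p) where
  open Padic p p-prime hiding (Polynomial; NonZeroPolynomial; eval)
  open Arithmetic p p-prime
  open Solver using (solve; _:=_; _:+_; _:*_; _:-_; :-_; con)

  Scaled : ℕ → ℕ → ℤₚ → ℤₚ → Set
  Scaled l q x y = x ≈ᶻ π^ (l ℕ.* q) *ᶻ y × ¬ Div l y

  -- The graph of 𝓛 on ℤₚ.
  data Normalised (l : ℕ) (x y : ℤₚ) : Set where
    vanishing : x ≈ᶻ 0ᶻ → y ≈ᶻ 0ᶻ → Normalised l x y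
    scaled    : ∀ q → Scaled l q x y → Normalised l x y

  π-+-* : ∀ m n x → π^ (m ℕ.+ n) *ᶻ x ≈ᶻ π^ m *ᶻ (π^ n *ᶻ x)
  π-+-* m n x = Z.trans (Z.*-congʳ {x} (π-+ m n)) (Z.*-assoc (π^ m) (π^ n) x)

  private
    -- Comparing the two representations would leave a factor pˡ in y.
    ¬lower : ∀ l q d {x y y′} → Scaled l q x y → ¬ Scaled l (q ℕ.+ suc d) x y′
    ¬lower l q d {x} {y} {y′} (x≈ , ¬div) (x≈′ , _) =
      ¬div (Div-≈ l (Z.sym (π-cancel (l ℕ.* q) (begin
        π^ (l ℕ.* q) *ᶻ y                               ≈⟨ x≈ ⟨
        x                                               ≈⟨ x≈′ ⟩
        π^ (l ℕ.* (q ℕ.+ suc d)) *ᶻ y′                  ≡⟨ cong (λ i → π^ i *ᶻ y′) e ⟩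
        π^ (l ℕ.* q ℕ.+ (l ℕ.+ l ℕ.* d)) *ᶻ y′          ≈⟨ π-+-* (l ℕ.* q) (l ℕ.+ l ℕ.* d) y′ ⟩
        π^ (l ℕ.* q) *ᶻ (π^ (l ℕ.+ l ℕ.* d) *ᶻ y′)      ≈⟨ Z.*-congˡ {π^ (l ℕ.* q)} (π-+-* l (l ℕ.* d) y′) ⟩
        π^ (l ℕ.* q) *ᶻ (π^ l *ᶻ (π^ (l ℕ.* d) *ᶻ y′))  ∎)))
        (Div-*ˡ {π^ l} l (π^ (l ℕ.* d) *ᶻ y′) (Div-π l)))
      where
      open ZR
      e : l ℕ.* (q ℕ.+ suc d) ≡ l ℕ.* q ℕ.+ (l ℕ.+ l ℕ.* d)
      e = trans (ℕP.*-distribˡ-+ l q (suc d)) (cong (l ℕ.* q ℕ.+_) (ℕP.*-suc l d))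

    ¬less : ∀ l q q′ {x y y′} → q < q′ → Scaled l q x y → ¬ Scaled l q′ x y′
    ¬less l q q′ {x} {y} {y′} q<q′ s s′ = ¬lower l q (q′ ℕ.∸ suc q) s
      (subst (λ i → Scaled l i x y′) (sym (trans (ℕP.+-suc q _) (ℕP.m+[n∸m]≡n q<q′))) s′)

  Scaled-unique : ∀ l {q q′ x y y′} → Scaled l q x y → Scaled l q′ x y′ → y ≈ᶻ y′
  Scaled-unique l {q} {q′} s s′ with ℕP.<-cmp q q′
  ... | tri< q<q′ _ _ = contradiction s′ (¬less l q q′ q<q′ s)
  ... | tri> _ _ q′<q = contradiction s (¬less l q′ q q′<q s′)
  ... | tri≈ _ refl _ = π-cancel (l ℕ.* q) (Z.trans (Z.sym (proj₁ s)) (proj₁ s′))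

  Scaled-exponents : ∀ l {q q′ x y y′} → Scaled l q x y → Scaled l q′ x y′ → q ≡ q′
  Scaled-exponents l {q} {q′} s s′ with ℕP.<-cmp q q′
  ... | tri< q<q′ _ _ = contradiction s′ (¬less l q q′ q<q′ s)
  ... | tri> _ _ q′<q = contradiction s (¬less l q′ q q′<q s′)
  ... | tri≈ _ q≡q′ _ = q≡q′

  ¬Scaled-0 : ∀ l {q x y} → x ≈ᶻ 0ᶻ → ¬ Scaled l q x y
  ¬Scaled-0 l {q} {x} {y} x≈0 (x≈ , ¬div) = ¬div (≈0⇒Div {y} l
    (π-cancel (l ℕ.* q) (Z.trans (Z.sym x≈) (Z.trans x≈0 (Z.sym (Z.zeroʳ (π^ (l ℕ.* q))))))))

  Normalised-unique : ∀ l {x y y′} → Normalised l x y → Normalised l x y′ → y ≈ᶻ y′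
  Normalised-unique l (vanishing _ y≈0) (vanishing _ y′≈0) = Z.trans y≈0 (Z.sym y′≈0)
  Normalised-unique l (vanishing x≈0 _) (scaled q s)       = contradiction s (¬Scaled-0 l x≈0)
  Normalised-unique l (scaled q s)      (vanishing x≈0 _)  = contradiction s (¬Scaled-0 l x≈0)
  Normalised-unique l (scaled q s)      (scaled q′ s′)     = Scaled-unique l s s′

  Scaled-resp : ∀ l {q x x′ y y′} → x ≈ᶻ x′ → y ≈ᶻ y′ → Scaled l q x y → Scaled l q x′ y′
  Scaled-resp l {q} x≈x′ y≈y′ (x≈ , ¬div) =
    Z.trans (Z.sym x≈x′) (Z.trans x≈ (Z.*-congˡ {π^ (l ℕ.* q)} y≈y′)) ,
    λ div → ¬div (Div-≈ l (Z.sym y≈y′) div)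

  Normalised-resp : ∀ l {x x′ y y′} → x ≈ᶻ x′ → y ≈ᶻ y′ → Normalised l x y → Normalised l x′ y′
  Normalised-resp l x≈x′ y≈y′ (vanishing x≈0 y≈0) =
    vanishing (Z.trans (Z.sym x≈x′) x≈0) (Z.trans (Z.sym y≈y′) y≈0)
  Normalised-resp l x≈x′ y≈y′ (scaled q s) = scaled q (Scaled-resp l x≈x′ y≈y′ s)

  ≉0⇒Scaled : ∀ l {x y} → ¬ x ≈ᶻ 0ᶻ → Normalised l x y → ∃ λ q → Scaled l q x y
  ≉0⇒Scaled l x≉0 (vanishing x≈0 _) = contradiction x≈0 x≉0
  ≉0⇒Scaled l x≉0 (scaled q s)      = q , s

  Scaled-unit : ∀ l .{{_ : NonZero l}} {q x y} u → ¬ Div 1 u → Scaled l q x y → Scaled l q (u *ᶻ x) (u *ᶻ y)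
  Scaled-unit l {q} {x} {y} u ¬div-u (x≈ , ¬div) =
    Z.trans (Z.*-congˡ {u} x≈)
      (solve 3 (λ u k y → u :* (k :* y) := k :* (u :* y)) Z.refl u (π^ (l ℕ.* q)) y) ,
    λ div → [ ¬div-u , ¬div ]′ (Div-* 0 l u y div)

  Normalised-unit : ∀ l .{{_ : NonZero l}} {x y} u → ¬ Div 1 u →
    Normalised l x y → Normalised l (u *ᶻ x) (u *ᶻ y)
  Normalised-unit l u ¬div-u (vanishing x≈0 y≈0) = vanishing
    (Z.trans (Z.*-congˡ {u} x≈0) (Z.zeroʳ u)) (Z.trans (Z.*-congˡ {u} y≈0) (Z.zeroʳ u))
  Normalised-unit l u ¬div-u (scaled q s) = scaled q (Scaled-unit l u ¬div-u s)

  Normalised-π : ∀ l m {x y} → Normalised l x y → Normalised l (π^ (l ℕ.* m) *ᶻ x) y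
  Normalised-π l m (vanishing x≈0 y≈0) = vanishing
    (Z.trans (Z.*-congˡ {π^ (l ℕ.* m)} x≈0) (Z.zeroʳ (π^ (l ℕ.* m)))) y≈0
  Normalised-π l m {x} {y} (scaled q (x≈ , ¬div)) = scaled (m ℕ.+ q)
    (Z.trans (Z.*-congˡ {π^ (l ℕ.* m)} x≈) (Z.trans (Z.sym (π-+-* (l ℕ.* m) (l ℕ.* q) y))
      (Z.reflexive (cong (λ i → π^ i *ᶻ y) (sym (ℕP.*-distribˡ-+ l m q))))) , ¬div)

  Scaled-exponent : ∀ l {q x y B} → Scaled l q x y → ¬ Div (suc B) x → l ℕ.* q ≤ B
  Scaled-exponent l {q} {x} {y} {B} (x≈ , _) ¬div with ℕP.≤-total (l ℕ.* q) B
  ... | inj₁ lq≤B = lq≤B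
  ... | inj₂ B≤lq with ℕP.m≤n⇒m<n∨m≡n B≤lq
  ...   | inj₂ B≡lq = ℕP.≤-reflexive (sym B≡lq)
  ...   | inj₁ B<lq = contradiction (Div-mono {x} B<lq (Div-≈ (l ℕ.* q) (Z.sym x≈)
                        (Div-*ˡ {π^ (l ℕ.* q)} (l ℕ.* q) y (Div-π (l ℕ.* q))))) ¬div

  -- This is the continuity of 𝓛 away from 0. Division by p^(l q) costs at most B digits of
  -- precision, and because l ≤ r the remaining change cannot make y divisible by pˡ, so the
  -- exponent q is preserved.
  Scaled-perturb : ∀ l {q x y x′ B r} → Scaled l q x y → l ℕ.* q ≤ B → l ≤ r →
    x′ ≡ x [p^ B ℕ.+ r ] → ∃ λ y′ → Scaled l q x′ y′ × y′ ≡ y [p^ r ]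
  Scaled-perturb l {q} {x} {y} {x′} {B} {r} (x≈ , ¬div) lq≤B l≤r x′≡x =
    y +ᶻ w , ((begin
      x′                                   ≈⟨ proj₂ diff ⟩
      x +ᶻ π^ (B ℕ.+ r) *ᶻ z               ≈⟨ Z.+-congʳ {π^ (B ℕ.+ r) *ᶻ z} x≈ ⟩
      k *ᶻ y +ᶻ π^ (B ℕ.+ r) *ᶻ z          ≡⟨ cong (λ i → k *ᶻ y +ᶻ π^ i *ᶻ z) e ⟩
      k *ᶻ y +ᶻ π^ (l ℕ.* q ℕ.+ (s ℕ.+ r)) *ᶻ z  ≈⟨ Z.+-congˡ {k *ᶻ y} (π-+-* (l ℕ.* q) (s ℕ.+ r) z) ⟩
      k *ᶻ y +ᶻ k *ᶻ w                     ≈⟨ Z.distribˡ k y w ⟨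
      k *ᶻ (y +ᶻ w)                        ∎) ,
      λ div → ¬div (≡-Div {y} {y +ᶻ w} l (≡-sym {y +ᶻ w} {y} l (≡-mono {y +ᶻ w} {y} l≤r near)) div)) , near
    where
    open ZR
    diff = difference {x′} {x} (B ℕ.+ r) x′≡x
    z = proj₁ diff
    k = π^ (l ℕ.* q)
    s = B ℕ.∸ l ℕ.* q
    w = π^ (s ℕ.+ r) *ᶻ z
    e : B ℕ.+ r ≡ l ℕ.* q ℕ.+ (s ℕ.+ r)
    e = trans (cong (ℕ._+ r) (sym (ℕP.m+[n∸m]≡n lq≤B))) (ℕP.+-assoc (l ℕ.* q) s r)
    near : y +ᶻ w ≡ y [p^ r ]
    near = Div-≈ r (solve 2 (λ y w → w := (y :+ w) :- y) Z.refl y w)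
      (Div-*ˡ {π^ (s ℕ.+ r)} r z (Div-mono {π^ (s ℕ.+ r)} (ℕP.m≤n+m r s) (Div-π (s ℕ.+ r))))

  -- Clearing denominators

  -- This is p^D f only when D bounds every exponent, because the subtraction is truncated; the
  -- lemmas on evaluation and roots assume that bound.
  clear : ℕ → Padic.Polynomial p p-prime → List ℤₚ
  clear D = map (λ c → π^ (D ℕ.∸ exponent c) *ᶻ num c)

  evalᵠ : Padic.Polynomial p p-prime → ℤₚ → ℚₚ
  evalᵠ f x = Padic.eval p p-prime f (ι x)

  -- Arithmetic in ℚₚ adds exponents and never reduces a fraction, so the comparison is stated with
  -- the denominators multiplied out.
  clear-eval : ∀ D f → All (λ c → exponent c ≤ D) f → ∀ x →
    π^ (exponent (evalᵠ f x)) *ᶻ ZPoly.eval (clear D f) x ≈ᶻ π^ D *ᶻ num (evalᵠ f x)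
  clear-eval D []      []        x =
    Z.trans (Z.zeroʳ (π^ 0)) (Z.sym (Z.zeroʳ (π^ D)))
  clear-eval D (c ∷ f) (e≤D ∷ h) x = begin
    π^ (e ℕ.+ d) *ᶻ (m *ᶻ b +ᶻ x *ᶻ E)
      ≈⟨ Z.*-congʳ {m *ᶻ b +ᶻ x *ᶻ E} (π-+ e d) ⟩
    π^ e *ᶻ π^ d *ᶻ (m *ᶻ b +ᶻ x *ᶻ E)
      ≈⟨ solve 6 (λ e d m b x E → e :* d :* (m :* b :+ x :* E) :=
           (e :* m) :* (d :* b) :+ e :* x :* (d :* E)) Z.refl (π^ e) (π^ d) m b x E ⟩
    (π^ e *ᶻ m) *ᶻ (π^ d *ᶻ b) +ᶻ π^ e *ᶻ x *ᶻ (π^ d *ᶻ E)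
      ≈⟨ Z.+-cong {(π^ e *ᶻ m) *ᶻ (π^ d *ᶻ b)} {π^ D *ᶻ (π^ d *ᶻ b)} (Z.*-congʳ {π^ d *ᶻ b} em≈D)
           (Z.*-congˡ {π^ e *ᶻ x} (clear-eval D f h x)) ⟩
    π^ D *ᶻ (π^ d *ᶻ b) +ᶻ π^ e *ᶻ x *ᶻ (π^ D *ᶻ a)
      ≈⟨ solve 6 (λ D d b e x a → D :* (d :* b) :+ e :* x :* (D :* a) :=
           D :* (d :* b :+ e :* (x :* a))) Z.refl (π^ D) (π^ d) b (π^ e) x a ⟩
    π^ D *ᶻ (π^ d *ᶻ b +ᶻ π^ e *ᶻ (x *ᶻ a)) ∎
    where
    open ZR
    e = exponent c
    b = num c
    d = exponent (evalᵠ f x)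
    a = num (evalᵠ f x)
    m = π^ (D ℕ.∸ e)
    E = ZPoly.eval (clear D f) x
    em≈D : π^ e *ᶻ m ≈ᶻ π^ D
    em≈D = Z.trans (Z.sym (π-+ e (D ℕ.∸ e))) (Z.reflexive (cong π^_ (ℕP.m+[n∸m]≡n e≤D)))

  ≈0ᵠ⇒num≈0 : ∀ {x} → x ≈ᵠ 0ᵠ → num x ≈ᶻ 0ᶻ
  ≈0ᵠ⇒num≈0 {x} q = Z.trans (Z.sym (Z.*-identityˡ (num x)))
    (Z.trans (cross q) (Z.zeroʳ (π^ exponent x)))

  num≈0⇒≈0ᵠ : ∀ {x} → num x ≈ᶻ 0ᶻ → x ≈ᵠ 0ᵠ
  num≈0⇒≈0ᵠ {x} q = mk≈ᵠ (Z.trans (Z.*-identityˡ (num x))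
    (Z.trans q (Z.sym (Z.zeroʳ (π^ exponent x)))))

  π-≈0 : ∀ k {x} → π^ k *ᶻ x ≈ᶻ 0ᶻ → x ≈ᶻ 0ᶻ
  π-≈0 k q = π-cancel k (Z.trans q (Z.sym (Z.zeroʳ (π^ k))))

  clear-nonZero : ∀ D {f} → Padic.NonZeroPolynomial p p-prime f →
    ZPoly.NonZeroPolynomial (clear D f)
  clear-nonZero D (here {c} c≉0) =
    here λ q → c≉0 (num≈0⇒≈0ᵠ (π-≈0 (D ℕ.∸ exponent c) q))
  clear-nonZero D (there nz)     = there (clear-nonZero D nz)

  module _ {D : ℕ} {f : Padic.Polynomial p p-prime} (h : All (λ c → exponent c ≤ D) f) {x : ℤₚ} where

    root⇒clear-root : Roots f x → ZPoly.eval (clear D f) x ≈ᶻ 0ᶻ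
    root⇒clear-root r = π-≈0 (exponent (evalᵠ f x)) (Z.trans (clear-eval D f h x)
      (Z.trans (Z.*-congˡ {π^ D} (≈0ᵠ⇒num≈0 r)) (Z.zeroʳ (π^ D))))

    clear-root⇒root : ZPoly.eval (clear D f) x ≈ᶻ 0ᶻ → Roots f x
    clear-root⇒root r = num≈0⇒≈0ᵠ (π-≈0 D (Z.trans (Z.sym (clear-eval D f h x))
      (Z.trans (Z.*-congˡ {π^ exponent (evalᵠ f x)} r) (Z.zeroʳ (π^ exponent (evalᵠ f x))))))

  -- 𝓛 in terms of ℤₚ

  private
    module Q = CommutativeRing ℚₚ-commutativeRing
    module QR = SetoidReasoning Q.setoid

    ι-cong : ∀ {x y} → x ≈ᶻ y → ι x ≈ᵠ ι y
    ι-cong {x} {y} q = mk≈ᵠ (Z.*-congˡ {π^ 0} q)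

    ι-injective : ∀ {x y} → ι x ≈ᵠ ι y → x ≈ᶻ y
    ι-injective {x} {y} q = π-cancel 0 (cross q)

    ι-π : ∀ t z → ι (π^ t *ᶻ z) ≈ᵠ p^ (+ t) *ᵠ ι z
    ι-π t z = Q.refl {ι (π^ t *ᶻ z)}

    p^-merge : ∀ i j z → p^ (i ℤ.+ j) *ᵠ ι z ≈ᵠ p^ i *ᵠ (p^ j *ᵠ ι z)
    p^-merge i j z = Q.trans (Q.*-congʳ {ι z} (p^-+ i j)) (Q.*-assoc (p^ i) (p^ j) (ι z))

    p^-inverse : ∀ i x → p^ (ℤ.- i) *ᵠ (p^ i *ᵠ x) ≈ᵠ x
    p^-inverse i x = begin
      p^ (ℤ.- i) *ᵠ (p^ i *ᵠ x)  ≈⟨ Q.*-assoc (p^ (ℤ.- i)) (p^ i) x ⟨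
      p^ (ℤ.- i) *ᵠ p^ i *ᵠ x    ≈⟨ Q.*-congʳ {x} (p^-+ (ℤ.- i) i) ⟨
      p^ (ℤ.- i ℤ.+ i) *ᵠ x      ≡⟨ cong (λ j → p^ j *ᵠ x) (ℤP.+-inverseˡ i) ⟩
      p^ (+ 0) *ᵠ x              ≈⟨ Q.*-identityˡ x ⟩
      x                          ∎
      where open QR

    p^-solve : ∀ i {x y} → y ≈ᵠ p^ i *ᵠ x → x ≈ᵠ p^ (ℤ.- i) *ᵠ y
    p^-solve i {x} {y} q = Q.sym (Q.trans (Q.*-congˡ {p^ (ℤ.- i)} q) (p^-inverse i x))

    above-valuation : ∀ {x v w z} t → ¬ x ∈p^ ℤ.suc v ℤₚ → w ≡ ℤ.suc v ℤ.+ + t →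
      ¬ x ≈ᵠ p^ w *ᵠ ι z
    above-valuation {x} {v} {w} {z} t ¬in eq q = ¬in (π^ t *ᶻ z ,
      Q.trans q (subst (λ w → p^ w *ᵠ ι z ≈ᵠ p^ (ℤ.suc v) *ᵠ ι (π^ t *ᶻ z)) (sym eq)
        (p^-merge (ℤ.suc v) (+ t) z)))

    exponent₁ : ∀ ν r t → let l = + 1 ℤ.+ r ℤ.+ t in
      l ℤ.* ν ℤ.+ l ≡ + 1 ℤ.+ (r ℤ.+ ν ℤ.* l) ℤ.+ t
    exponent₁ = ℤSolver.solve-∀

    exponent₂ : ∀ l ν m → l ℤ.* ν ℤ.+ l ℤ.+ m ℤ.* l ≡
                l ℤ.* (+ 1 ℤ.+ m ℤ.+ ν)
    exponent₂ = ℤSolver.solve-∀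

    -- Write v = r + l u with 0 ≤ r < l and t = l - 1 - r, so that v + 1 + t = l u + l. If pˡ
    -- divided y, then x would lie in p^(v + 1) ℤₚ, against the choice of v. The exponent of `X` is
    -- q = E + u; were it negative, the integrality of `X` would again place x in p^(v + 1) ℤₚ.
    normalised : ∀ l .{{_ : NonZero l}} {x v y E X} → ¬ x ∈p^ ℤ.suc v ℤₚ →
      ι y ≈ᵠ p^ (ℤ.- (+ l ℤ.* (v /ℕ l))) *ᵠ x → ι X ≈ᵠ p^ (+ (l ℕ.* E)) *ᵠ x →
      ∃ λ q → Scaled l q X y
    normalised l {x} {v} {y} {E} {X} ¬in y≈ X≈ =
      [ (λ (q , eq) → q , ι-injective (X≈y q eq) , ¬div)
      , (λ (m , eq) → contradiction (p^-solve (+ (l ℕ.* E)) X≈)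
          (above-valuation {v = v} (t ℕ.+ m ℕ.* l) ¬in (negative m eq))) ]′ (sign-cases (+ E ℤ.+ u))
      where
      u = v /ℕ l
      r = v %ℕ l
      t = l ℕ.∸ suc r
      l≡ : + l ≡ + 1 ℤ.+ + r ℤ.+ + t
      l≡ = cong +_ (sym (ℕP.m+[n∸m]≡n (n%ℕd<d v l)))
      v≡ : ℤ.suc v ℤ.+ + t ≡ + l ℤ.* u ℤ.+ + l
      v≡ = trans (cong (λ i → + 1 ℤ.+ i ℤ.+ + t) (a≡a%ℕn+[a/ℕn]*n v l))
        (lemma l≡)
        where
        lemma : ∀ {L} → L ≡ + 1 ℤ.+ + r ℤ.+ + t →
          + 1 ℤ.+ (+ r ℤ.+ u ℤ.* L) ℤ.+ + t ≡ L ℤ.* u ℤ.+ L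
        lemma refl = sym (exponent₁ u (+ r) (+ t))
      x≈ : x ≈ᵠ p^ (+ l ℤ.* u) *ᵠ ι y
      x≈ = subst (λ i → x ≈ᵠ p^ i *ᵠ ι y) (ℤP.neg-involutive (+ l ℤ.* u))
             (p^-solve (ℤ.- (+ l ℤ.* u)) y≈)
      sign-cases : ∀ i → (∃ λ q → i ≡ + q) ⊎ (∃ λ m → i ≡ -[1+ m ])
      sign-cases (+ q)    = inj₁ (q , refl)
      sign-cases -[1+ m ] = inj₂ (m , refl)
      ¬div : ¬ Div l y
      ¬div div = above-valuation {v = v} {z = z} t ¬in (sym v≡) (begin
        x                                     ≈⟨ x≈ ⟩
        p^ (+ l ℤ.* u) *ᵠ ι y                 ≈⟨ Q.*-congˡ {p^ (+ l ℤ.* u)} (ι-cong y≈z) ⟩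
        p^ (+ l ℤ.* u) *ᵠ (p^ (+ l) *ᵠ ι z)   ≈⟨ p^-merge (+ l ℤ.* u) (+ l) z ⟨
        p^ (+ l ℤ.* u ℤ.+ + l) *ᵠ ι z         ∎)
        where
        open QR
        z = proj₁ (divisible y l div)
        y≈z = proj₂ (divisible y l div)
      X≈y : ∀ q → + E ℤ.+ u ≡ + q → ι X ≈ᵠ ι (π^ (l ℕ.* q) *ᶻ y)
      X≈y q eq = begin
        ι X                                            ≈⟨ X≈ ⟩
        p^ (+ (l ℕ.* E)) *ᵠ x                          ≈⟨ Q.*-congˡ {p^ (+ (l ℕ.* E))} x≈ ⟩
        p^ (+ (l ℕ.* E)) *ᵠ (p^ (+ l ℤ.* u) *ᵠ ι y)    ≈⟨ p^-merge (+ (l ℕ.* E)) (+ l ℤ.* u) y ⟨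
        p^ (+ (l ℕ.* E) ℤ.+ + l ℤ.* u) *ᵠ ι y          ≡⟨ cong (λ i → p^ i *ᵠ ι y) e ⟩
        p^ (+ (l ℕ.* q)) *ᵠ ι y                        ≈⟨ ι-π (l ℕ.* q) y ⟨
        ι (π^ (l ℕ.* q) *ᶻ y)                          ∎
        where
        open QR
        e : + (l ℕ.* E) ℤ.+ + l ℤ.* u ≡ + (l ℕ.* q)
        e = trans (cong (ℤ._+ + l ℤ.* u) (ℤP.pos-* l E))
              (trans (sym (ℤP.*-distribˡ-+ (+ l) (+ E) u))
                (trans (cong (+ l ℤ.*_) eq) (sym (ℤP.pos-* l q))))
      negative : ∀ m → + E ℤ.+ u ≡ -[1+ m ] →
        ℤ.- + (l ℕ.* E) ≡ ℤ.suc v ℤ.+ + (t ℕ.+ m ℕ.* l)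
      negative m eq = sym (begin
        ℤ.suc v ℤ.+ (+ t ℤ.+ + (m ℕ.* l))     ≡⟨ ℤP.+-assoc (ℤ.suc v) (+ t) (+ (m ℕ.* l)) ⟨
        ℤ.suc v ℤ.+ + t ℤ.+ + (m ℕ.* l)       ≡⟨ cong₂ ℤ._+_ v≡ (ℤP.pos-* m l) ⟩
        + l ℤ.* u ℤ.+ + l ℤ.+ + m ℤ.* + l     ≡⟨ exponent₂ (+ l) u (+ m) ⟩
        + l ℤ.* (+ suc m ℤ.+ u)               ≡⟨ cong (+ l ℤ.*_) (e eq) ⟩
        + l ℤ.* (ℤ.- + E)                     ≡⟨ ℤP.neg-distribʳ-* (+ l) (+ E) ⟨
        ℤ.- (+ l ℤ.* + E)                     ≡⟨ cong ℤ.-_ (ℤP.pos-* l E) ⟨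
        ℤ.- + (l ℕ.* E)                       ∎)
        where
        open ≡-Reasoning
        int : ∀ E u → ℤ.- (E ℤ.+ u) ℤ.+ u ≡ ℤ.- E
        int = ℤSolver.solve-∀
        e : + E ℤ.+ u ≡ -[1+ m ] → + suc m ℤ.+ u ≡ ℤ.- + E
        e eq = trans (cong (λ i → ℤ.- i ℤ.+ u) (sym eq)) (int (+ E) u)

  -- The hypothesis is X = p^(l E) x without denominators. The factor p^(l E) shifts the valuation
  -- by a multiple of l, which 𝓛 does not see.
  𝓛-Normalised : ∀ (em : ExcludedMiddle 0ℓ) l .{{_ : NonZero l}} x E X →
    π^ exponent x *ᶻ X ≈ᶻ π^ (l ℕ.* E) *ᶻ num x → Normalised l X (𝓛 em l x)
  𝓛-Normalised em l x E X q with em {x ≈ᵠ 0ᵠ}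
  ... | yes x≈0 = vanishing (π-≈0 (exponent x) (Z.trans q
          (Z.trans (Z.*-congˡ {π^ (l ℕ.* E)} (≈0ᵠ⇒num≈0 x≈0)) (Z.zeroʳ (π^ (l ℕ.* E)))))) Z.refl
  ... | no  x≉0 = let q , s = normalised l {v = ν em x x≉0} {E = E} (proj₂ (proj₂ (valuation em x x≉0)))
                                (proj₂ (𝓛-integral em l x x≉0)) X≈ in scaled q s
    where
    X≈ : ι X ≈ᵠ p^ (+ (l ℕ.* E)) *ᵠ x
    X≈ = mk≈ᵠ (Z.trans q (Z.sym (Z.*-identityˡ (π^ (l ℕ.* E) *ᶻ num x))))

  normalise : ExcludedMiddle 0ℓ → ∀ l .{{_ : NonZero l}} x → ∃ (Normalised l x)
  normalise em l x = 𝓛 em l (ι x) , 𝓛-Normalised em l (ι x) 0 x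
    (Z.reflexive (cong (λ i → π^ i *ᶻ x) (sym (ℕP.*-zeroʳ l))))

least : ExcludedMiddle 0ℓ → (Q : Pred ℕ 0ℓ) → ∃ Q → ∃ λ n → Q n × (∀ m → m < n → ¬ Q m)
least em Q (n , q) = <-rec (λ n → Q n → ∃ λ n → Q n × (∀ m → m < n → ¬ Q m)) step n q
  where
  step : ∀ n → (∀ {m} → m < n → Q m → ∃ λ n → Q n × (∀ m → m < n → ¬ Q m)) →
    Q n → ∃ λ n → Q n × (∀ m → m < n → ¬ Q m)
  step n rec q with em {∃ λ m → m < n × Q m}
  ... | yes (m , m<n , qm) = rec m<n qm
  ... | no  none           = n , q , λ m m<n qm → none (m , m<n , qm)

-- Finitely generated modules of sequences and their stability under sections

module Sequences (p : ℕ) (p-prime : Prime p) where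
  open Padic p p-prime hiding (Polynomial; NonZeroPolynomial; eval)
  open Arithmetic p p-prime
  open Solver using (solve; _:=_; _:+_; _:*_; _:-_; :-_; con)

  ≋-refl : ∀ {s} → s ≋ s
  ≋-refl n = Z.refl

  infixl 6 _⊕_
  infixl 7 _⊙_ _⊛_
  _⊕_ _⊛_ : Sequence → Sequence → Sequence
  (s ⊕ t) n = s n +ᶻ t n
  (s ⊛ t) n = s n *ᶻ t n

  _⊙_ : ℤ → Sequence → Sequence
  (c ⊙ s) n = fromℤ c *ᶻ s n

  Zero : Sequence
  Zero n = 0ᶻ

  section : ℕ → ℕ → Sequence → Sequence
  section k j s n = s (k ℕ.* n ℕ.+ j)

  Spanned : List Sequence → Pred Sequence 0ℓ
  Spanned gs = Span (λ s → Any (s ≋_) gs)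

  Span-least : ∀ {S T : Pred Sequence 0ℓ} → S ⊆ Span T → Span S ⊆ Span T
  Span-least h (gen g)     = h g
  Span-least h nil         = nil
  Span-least h (plus s t)  = plus (Span-least h s) (Span-least h t)
  Span-least h (scale c s) = scale c (Span-least h s)
  Span-least h (resp e s)  = resp e (Span-least h s)

  member : ∀ {gs s} → s ∈ gs → Spanned gs s
  member = gen ∘ Any.map λ { refl → ≋-refl }

  Spanned-least : ∀ {gs T} → (∀ {g} → g ∈ gs → Span T g) → Spanned gs ⊆ Span T
  Spanned-least {gs} {T} h = Span-least λ {s} any →
    let g , g∈gs , s≋g = find any in resp (λ n → Z.sym (s≋g n)) (h g∈gs)

  -- Finite generation of submodules

  -- In contrast to `Span` this exposes coefficients, which are needed to form ideals of ℤ and to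
  -- count residues. The generators may be dependent, so a sequence can have several coefficient
  -- vectors.
  Combination : List Sequence → Pred Sequence 0ℓ
  Combination []       s = s ≋ Zero
  Combination (g ∷ gs) s = ∃₂ λ c t → Combination gs t × s ≋ (c ⊙ g ⊕ t)

  Combination-resp : ∀ gs {s t} → s ≋ t → Combination gs s → Combination gs t
  Combination-resp []       s≋t s≋0           = λ n → Z.trans (Z.sym (s≋t n)) (s≋0 n)
  Combination-resp (g ∷ gs) s≋t (c , u , h , eq) = c , u , h , λ n → Z.trans (Z.sym (s≋t n)) (eq n)

  Combination-0 : ∀ gs → Combination gs Zero
  Combination-0 []       = ≋-refl
  Combination-0 (g ∷ gs) = + 0 , Zero , Combination-0 gs , λ n →
    solve 1 (λ x → con (+ 0) := con (+ 0) :* x :+ con (+ 0)) Z.refl (g n)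

  Combination-⊕ : ∀ gs {s t} → Combination gs s → Combination gs t → Combination gs (s ⊕ t)
  Combination-⊕ []       s≋0 t≋0 n = Z.trans (Z.+-cong (s≋0 n) (t≋0 n)) (Z.+-identityˡ 0ᶻ)
  Combination-⊕ (g ∷ gs) (c , u , h , eq) (c′ , u′ , h′ , eq′) =
    c ℤ.+ c′ , u ⊕ u′ , Combination-⊕ gs h h′ , λ n → Z.trans (Z.+-cong (eq n) (eq′ n))
      (Z.trans (solve 5 (λ c c′ x u u′ → (c :* x :+ u) :+ (c′ :* x :+ u′) := (c :+ c′) :* x :+ (u :+ u′))
        Z.refl (fromℤ c) (fromℤ c′) (g n) (u n) (u′ n)) (pointwise λ _ → refl))

  Combination-⊙ : ∀ gs d {s} → Combination gs s → Combination gs (d ⊙ s)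
  Combination-⊙ []       d s≋0 n = Z.trans (Z.*-congˡ {fromℤ d} (s≋0 n)) (Z.zeroʳ (fromℤ d))
  Combination-⊙ (g ∷ gs) d (c , u , h , eq) =
    d ℤ.* c , d ⊙ u , Combination-⊙ gs d h , λ n → Z.trans (Z.*-congˡ {fromℤ d} (eq n))
      (Z.trans (solve 4 (λ d c x u → d :* (c :* x :+ u) := (d :* c) :* x :+ d :* u)
        Z.refl (fromℤ d) (fromℤ c) (g n) (u n)) (pointwise λ _ → refl))

  Combination-member : ∀ gs {s} → Any (s ≋_) gs → Combination gs s
  Combination-member (g ∷ gs) (here s≋g)  = + 1 , Zero , Combination-0 gs , λ n →
    Z.trans (s≋g n) (solve 1 (λ x → x := con (+ 1) :* x :+ con (+ 0)) Z.refl (g n))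
  Combination-member (g ∷ gs) {s} (there any) = + 0 , s , Combination-member gs any , λ n →
    solve 2 (λ x s → s := con (+ 0) :* x :+ s) Z.refl (g n) (s n)

  Spanned⇒Combination : ∀ {gs} → Spanned gs ⊆ Combination gs
  Spanned⇒Combination {gs} (gen any)   = Combination-member gs any
  Spanned⇒Combination {gs} nil         = Combination-0 gs
  Spanned⇒Combination {gs} (plus s t)  =
    Combination-⊕ gs (Spanned⇒Combination s) (Spanned⇒Combination t)
  Spanned⇒Combination {gs} (scale c s) = Combination-⊙ gs c (Spanned⇒Combination s)
  Spanned⇒Combination {gs} (resp e s)  = Combination-resp gs e (Spanned⇒Combination s)

  record IsSubmodule (V : Pred Sequence 0ℓ) : Set₁ where
    field
      zeroᵛ  : V Zero
      plusᵛ  : ∀ {s t} → V s → V t → V (s ⊕ t)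
      scaleᵛ : ∀ c {s} → V s → V (c ⊙ s)
      respᵛ  : ∀ {s t} → s ≋ t → V s → V t

  module _ (em : ExcludedMiddle 0ℓ) where
    open Domain em

    private
      Leading : Pred Sequence 0ℓ → ℤ → Sequence → List Sequence → ℤ → Pred Sequence 0ℓ
      Leading V D g gs c s = V s × ∃ λ t → Combination gs t × (D ⊙ s) ≋ (c ⊙ g ⊕ t)

    -- The coefficients of g in D·V form an ideal of ℤ; a sequence realising
    -- its positive generator, together with generators of the part of V with
    -- coefficient 0, generates V.
    noetherian : ∀ {D} → D ≢ + 0 → ∀ {V} → IsSubmodule V → ∀ gs →
      (∀ {s} → V s → Combination gs (D ⊙ s)) →
      ∃ λ hs → All V hs × V ⊆ Spanned hs
    -- Sequences in ℤₚ form a torsion-free module, so D s = 0 forces s = 0.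
    noetherian {D} D≢0 {V} isSub [] h = [] , [] , λ {s} v →
      resp (λ n → Z.sym (no-zero-divisors (h v n) (fromℤ-≉0 D D≢0))) nil
    noetherian {D} D≢0 {V} isSub (g ∷ gs) h =
      conclude (em {∃ λ n → ∃ (Leading V D g gs (+ suc n))})
      where
      open IsSubmodule isSub
      V₀ : Pred Sequence 0ℓ
      V₀ s = V s × Combination gs (D ⊙ s)
      isSub₀ : IsSubmodule V₀
      isSub₀ = record
        { zeroᵛ  = zeroᵛ , Combination-resp gs (λ n → Z.sym (Z.zeroʳ (fromℤ D))) (Combination-0 gs)
        ; plusᵛ  = λ {s} {t} (v , a) (w , b) → plusᵛ v w ,
            Combination-resp gs (λ n → Z.sym (Z.distribˡ (fromℤ D) (s n) (t n))) (Combination-⊕ gs a b)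
        ; scaleᵛ = λ c {s} (v , a) → scaleᵛ c v , Combination-resp gs
            (λ n → solve 3 (λ c d x → c :* (d :* x) := d :* (c :* x)) Z.refl (fromℤ c) (fromℤ D) (s n))
            (Combination-⊙ gs c a)
        ; respᵛ  = λ e (v , a) → respᵛ e v , Combination-resp gs (λ n → Z.*-congˡ {fromℤ D} (e n)) a
        }
      tail = noetherian D≢0 isSub₀ gs proj₂
      hs = proj₁ tail
      V₀⊆ : V₀ ⊆ Spanned hs
      V₀⊆ = proj₂ (proj₂ tail)
      ⊆V : All V hs
      ⊆V = All.map proj₁ (proj₁ (proj₂ tail))
      leading-0 : ∀ {s} → Leading V D g gs (+ 0) s → V₀ s
      leading-0 (v , t , comb , eq) = v , Combination-resp gs
        (λ n → Z.sym (Z.trans (eq n) (solve 2 (λ x t → con (+ 0) :* x :+ t := t) Z.refl (g n) (t n)))) comb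
      conclude : Dec (∃ λ n → ∃ (Leading V D g gs (+ suc n))) → ∃ λ hs → All V hs × V ⊆ Spanned hs
      conclude (no none) = hs , ⊆V , λ v → V₀⊆ (small v (h v))
        where
        small : ∀ {s} → V s → Combination (g ∷ gs) (D ⊙ s) → V₀ s
        small v (+ zero     , t , comb , eq) = leading-0 (v , t , comb , eq)
        small {s} v (+ suc n    , t , comb , eq) = contradiction (n , s , v , t , comb , eq) none
        small {s} v (-[1+ n ] , t , comb , eq) = contradiction
          (n , ((ℤ.- + 1) ⊙ s) , scaleᵛ (ℤ.- + 1) v , ((ℤ.- + 1) ⊙ t) , Combination-⊙ gs (ℤ.- + 1) comb ,
            λ m → Z.trans (solve 2 (λ d x → d :* (con (ℤ.- + 1) :* x) := con (ℤ.- + 1) :* (d :* x)) Z.refl (fromℤ D) (s m))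
                   (Z.trans (Z.*-congˡ {fromℤ (ℤ.- + 1)} (eq m))
                   (Z.trans (solve 3 (λ c x t → con (ℤ.- + 1) :* (c :* x :+ t) := (:- c) :* x :+ con (ℤ.- + 1) :* t)
                     Z.refl (fromℤ -[1+ n ]) (g m) (t m)) (pointwise λ _ → refl)))) none
      conclude (yes found) = reduce (least em _ found)
        where
        reduce : (∃ λ n → ∃ (Leading V D g gs (+ suc n)) × (∀ m → m < n → ¬ ∃ (Leading V D g gs (+ suc m)))) →
          ∃ λ hs → All V hs × V ⊆ Spanned hs
        reduce (n , (s₀ , v₀ , t₀ , comb₀ , eq₀) , minimal) = s₀ ∷ hs , v₀ ∷ ⊆V , λ v → generated v (h v)
          where
          d = suc n
          generated : ∀ {s} → V s → Combination (g ∷ gs) (D ⊙ s) → Spanned (s₀ ∷ hs) s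
          generated {s} v (c , t , comb , eq) =
            resp (λ m → solve 3 (λ x q y → (x :+ (:- q) :* y) :+ q :* y := x) Z.refl (s m) (fromℤ q) (s₀ m))
              (plus (resp (λ m → Z.+-congˡ {s m} (Z.*-congʳ {s₀ m} (pointwise λ _ → refl)))
                      (Spanned-least (member ∘ there) (V₀⊆ (below (c %ℕ d) (n%ℕd<d c d) lead))))
                (scale q (member {s₀ ∷ hs} (here refl))))
            where
            q = c /ℕ d
            s′ = s ⊕ (ℤ.- q) ⊙ s₀
            -- After subtracting q s₀ the coefficient is the remainder of c modulo d. A positive one
            -- would contradict the minimality of d.
            below : ∀ r → r < d → Leading V D g gs (+ r) s′ → V₀ s′
            below zero    r<d       lead = leading-0 lead
            below (suc r) (s≤s r<d) lead = contradiction (s′ , lead) (minimal r r<d)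
            coefficient : ∀ {c} r → c ≡ + r ℤ.+ q ℤ.* + d → c ℤ.+ (ℤ.- q) ℤ.* + d ≡ + r
            coefficient r refl = int (+ r) q (+ d)
              where
              int : ∀ r q d → r ℤ.+ q ℤ.* d ℤ.+ (ℤ.- q) ℤ.* d ≡ r
              int = ℤSolver.solve-∀
            lead : Leading V D g gs (+ (c %ℕ d)) s′
            lead = plusᵛ v (scaleᵛ (ℤ.- q) v₀) , t ⊕ (ℤ.- q) ⊙ t₀ ,
              Combination-⊕ gs comb (Combination-⊙ gs (ℤ.- q) comb₀) , λ m → begin
                fromℤ D *ᶻ (s m +ᶻ fromℤ (ℤ.- q) *ᶻ s₀ m)
                  ≈⟨ solve 4 (λ d x q y → d :* (x :+ q :* y) := d :* x :+ q :* (d :* y)) Z.refl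
                       (fromℤ D) (s m) (fromℤ (ℤ.- q)) (s₀ m) ⟩
                fromℤ D *ᶻ s m +ᶻ fromℤ (ℤ.- q) *ᶻ (fromℤ D *ᶻ s₀ m)
                  ≈⟨ Z.+-cong (eq m) (Z.*-congˡ {fromℤ (ℤ.- q)} (eq₀ m)) ⟩
                fromℤ c *ᶻ g m +ᶻ t m +ᶻ fromℤ (ℤ.- q) *ᶻ (fromℤ (+ d) *ᶻ g m +ᶻ t₀ m)
                  ≈⟨ solve 6 (λ c x t q d t₀ → c :* x :+ t :+ q :* (d :* x :+ t₀) :=
                       (c :+ q :* d) :* x :+ (t :+ q :* t₀)) Z.refl
                       (fromℤ c) (g m) (t m) (fromℤ (ℤ.- q)) (fromℤ (+ d)) (t₀ m) ⟩
                (fromℤ c +ᶻ fromℤ (ℤ.- q) *ᶻ fromℤ (+ d)) *ᶻ g m +ᶻ (t m +ᶻ fromℤ (ℤ.- q) *ᶻ t₀ m)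
                  ≈⟨ Z.+-congʳ {t m +ᶻ fromℤ (ℤ.- q) *ᶻ t₀ m} (Z.*-congʳ {g m}
                       (pointwise λ _ → coefficient (c %ℕ d) (a≡a%ℕn+[a/ℕn]*n c d))) ⟩
                fromℤ (+ (c %ℕ d)) *ᶻ g m +ᶻ (t m +ᶻ fromℤ (ℤ.- q) *ᶻ t₀ m) ∎
              where open ZR

  -- Sequences whose k-kernel lies in a finitely generated module stable
  -- under all s ↦ section k j s

  Closed : ℕ → Pred (List Sequence) 0ℓ
  Closed k gs = ∀ {g} → g ∈ gs → ∀ j → j < k → Spanned gs (section k j g)

  Stable : ℕ → Pred Sequence 0ℓ
  Stable k s = ∃ λ gs → Closed k gs × Spanned gs s

  module _ {k : ℕ} where

    Spanned-section : ∀ {gs} → Closed k gs → ∀ j → j < k → ∀ {s} →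
      Spanned gs s → Spanned gs (section k j s)
    Spanned-section cl j j<k (gen any)   = let g , g∈gs , s≋g = find any in
      resp (λ n → Z.sym (s≋g (k ℕ.* n ℕ.+ j))) (cl g∈gs j j<k)
    Spanned-section cl j j<k nil         = nil
    Spanned-section cl j j<k (plus s t)  = plus (Spanned-section cl j j<k s) (Spanned-section cl j j<k t)
    Spanned-section cl j j<k (scale c s) = scale c (Spanned-section cl j j<k s)
    Spanned-section cl j j<k (resp e s)  = resp (λ n → e (k ℕ.* n ℕ.+ j)) (Spanned-section cl j j<k s)

    -- Base-k digits of j are consumed from the lowest: k (kⁱ n + j / k) + j % k = kⁱ⁺¹ n + j. Thus
    -- closure under single digits captures the whole kernel.
    Spanned-kernel : .{{_ : NonZero k}} → ∀ {gs} → Closed k gs → ∀ i j → j < k ℕ.^ i → ∀ {s} →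
      Spanned gs s → Spanned gs (section (k ℕ.^ i) j s)
    Spanned-kernel cl zero zero j<k {s} sp = resp (λ n → Z.reflexive (cong s (e n))) sp
      where
      e : ∀ n → n ≡ 1 ℕ.* n ℕ.+ 0
      e = ℕSolver.solve-∀
    Spanned-kernel cl zero (suc j) (s≤s ()) sp
    Spanned-kernel cl (suc i) j j<k {s} sp =
      resp (λ n → Z.reflexive (cong s (e n (m≡m%n+[m/n]*n j k))))
        (Spanned-kernel cl i (j / k) (m<n*o⇒m/o<n (subst (j <_) (ℕP.*-comm k (k ℕ.^ i)) j<k))
          (Spanned-section cl (j % k) (m%n<n j k) sp))
      where
      int : ∀ k K n q r → k ℕ.* (K ℕ.* n ℕ.+ q) ℕ.+ r ≡ k ℕ.* K ℕ.* n ℕ.+ (r ℕ.+ q ℕ.* k)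
      int = ℕSolver.solve-∀
      e : ∀ n {j′} → j′ ≡ j % k ℕ.+ j / k ℕ.* k →
        k ℕ.* (k ℕ.^ i ℕ.* n ℕ.+ j / k) ℕ.+ j % k ≡ k ℕ.* k ℕ.^ i ℕ.* n ℕ.+ j′
      e n refl = int k (k ℕ.^ i) n (j / k) (j % k)

    -- Stability places only D times the kernel module inside a finitely generated one, while
    -- `KRegular` asks for generators of the module itself; `noetherian` bridges this gap.
    Stable⇒KRegular : .{{_ : NonZero k}} → ExcludedMiddle 0ℓ → ∀ {D a} → D ≢ + 0 →
      Stable k (D ⊙ a) → KRegular k a
    Stable⇒KRegular em {D} {a} D≢0 (gs , cl , sp) =
      length hs , lookup hs ,
      (λ v → Span-least (λ {s} any → gen (Any.index any , AnyP.lookup-index any)) (V⊆ v)) ,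
      Span-least (λ {s} (i , s≋) → resp (λ n → Z.sym (s≋ n)) (All.lookup ⊆V (∈-lookup i)))
      where
      V = Span (Kernel k a)
      multiple : ∀ {s} → V s → Spanned gs (D ⊙ s)
      multiple (gen (i , j , s≋)) = resp (λ n → Z.*-congˡ {fromℤ D} (Z.sym (s≋ n)))
        (Spanned-kernel cl i (toℕ j) (FinP.toℕ<n j) sp)
      multiple nil = resp (λ n → Z.sym (Z.zeroʳ (fromℤ D))) nil
      multiple (plus {s} {t} v w) = resp (λ n → Z.sym (Z.distribˡ (fromℤ D) (s n) (t n)))
        (plus (multiple v) (multiple w))
      multiple (scale c {s} v) = resp
        (λ n → solve 3 (λ c d x → c :* (d :* x) := d :* (c :* x)) Z.refl (fromℤ c) (fromℤ D) (s n))
        (scale c (multiple v))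
      multiple (resp e v) = resp (λ n → Z.*-congˡ {fromℤ D} (e n)) (multiple v)
      basis = noetherian em D≢0 {V} (record { zeroᵛ = nil ; plusᵛ = plus ; scaleᵛ = scale ; respᵛ = resp })
        gs (λ v → Spanned⇒Combination (multiple v))
      hs = proj₁ basis
      ⊆V : All V hs
      ⊆V = proj₁ (proj₂ basis)
      V⊆ : V ⊆ Spanned hs
      V⊆ = proj₂ (proj₂ basis)

    Stable-resp : ∀ {s t} → s ≋ t → Stable k s → Stable k t
    Stable-resp e (gs , cl , sp) = gs , cl , resp e sp

    Closed-++ : ∀ {gs hs} → Closed k gs → Closed k hs → Closed k (gs ++ hs)
    Closed-++ {gs} {hs} cl cl′ g∈ j j<k with ∈-++⁻ gs g∈
    ... | inj₁ g∈gs = Spanned-least (member ∘ AnyP.++⁺ˡ) (cl g∈gs j j<k)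
    ... | inj₂ g∈hs = Spanned-least (member ∘ AnyP.++⁺ʳ gs) (cl′ g∈hs j j<k)

    Stable-⊕ : ∀ {s t} → Stable k s → Stable k t → Stable k (s ⊕ t)
    Stable-⊕ (gs , cl , sp) (hs , cl′ , sp′) = gs ++ hs , Closed-++ {gs} {hs} cl cl′ ,
      plus (Spanned-least (member ∘ AnyP.++⁺ˡ) sp) (Spanned-least (member ∘ AnyP.++⁺ʳ gs) sp′)

    Spanned-⊛ : ∀ {gs hs s t} → Spanned gs s → Spanned hs t →
      Spanned (cartesianProductWith _⊛_ gs hs) (s ⊛ t)
    Spanned-⊛ {gs} {hs} (gen any) sp = let g , g∈gs , s≋g = find any in
      resp (λ n → Z.*-congʳ (Z.sym (s≋g n))) (right g∈gs sp)
      where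
      right : ∀ {g} → g ∈ gs → ∀ {t} → Spanned hs t → Spanned (cartesianProductWith _⊛_ gs hs) (g ⊛ t)
      right {g} g∈gs (gen any)       = let h , h∈hs , t≋h = find any in
        resp (λ n → Z.*-congˡ {g n} (Z.sym (t≋h n))) (member (∈-cartesianProductWith⁺ _⊛_ g∈gs h∈hs))
      right {g} g∈gs nil             = resp (λ n → Z.sym (Z.zeroʳ (g n))) nil
      right {g} g∈gs (plus {s} {t} u v) = resp (λ n → Z.sym (Z.distribˡ (g n) (s n) (t n)))
        (plus (right g∈gs u) (right g∈gs v))
      right {g} g∈gs (scale c {s} u) = resp
        (λ n → solve 3 (λ c x y → c :* (x :* y) := x :* (c :* y)) Z.refl (fromℤ c) (g n) (s n))
        (scale c (right g∈gs u))
      right {g} g∈gs (resp e u)      = resp (λ n → Z.*-congˡ {g n} (e n)) (right g∈gs u)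
    Spanned-⊛ {t = t} nil                sp = resp (λ n → Z.sym (Z.zeroˡ (t n))) nil
    Spanned-⊛ {t = t} (plus {s} {s′} u v) sp = resp (λ n → Z.sym (Z.distribʳ (t n) (s n) (s′ n)))
      (plus (Spanned-⊛ u sp) (Spanned-⊛ v sp))
    Spanned-⊛ {t = t} (scale c {s} u)    sp =
      resp (λ n → Z.sym (Z.*-assoc (fromℤ c) (s n) (t n))) (scale c (Spanned-⊛ u sp))
    Spanned-⊛ {t = t} (resp e u)         sp = resp (λ n → Z.*-congʳ {t n} (e n)) (Spanned-⊛ u sp)

    Stable-⊛ : ∀ {s t} → Stable k s → Stable k t → Stable k (s ⊛ t)
    Stable-⊛ (gs , cl , sp) (hs , cl′ , sp′) = cartesianProductWith _⊛_ gs hs , closed , Spanned-⊛ sp sp′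
      where
      closed : Closed k (cartesianProductWith _⊛_ gs hs)
      closed x∈ j j<k with ∈-cartesianProductWith⁻ _⊛_ gs hs x∈
      ... | g , h , g∈ , h∈ , refl = Spanned-⊛ (cl g∈ j j<k) (cl′ h∈ j j<k)

    Stable-const : ∀ c → Stable k (λ _ → c)
    Stable-const c = (λ _ → c) ∷ [] , (λ { (here refl) j j<k → member (here refl) }) , member (here refl)

    Stable-id : Stable k (λ n → fromℤ (+ n))
    Stable-id = gs , closed , member (here refl)
      where
      N I : Sequence
      N n = fromℤ (+ n)
      I n = 1ᶻ
      gs = N ∷ I ∷ []
      e : ∀ n j → + k ℤ.* + n ℤ.+ + j ℤ.* + 1 ≡ + (k ℕ.* n ℕ.+ j)
      e n j = cong₂ ℤ._+_ (sym (ℤP.pos-* k n)) (ℤP.*-identityʳ (+ j))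
      closed : Closed k gs
      closed (here refl)         j j<k = resp {s = (+ k ⊙ N) ⊕ (+ j ⊙ I)} (λ n → pointwise λ _ → e n j)
        (plus (scale (+ k) (member {gs} (here refl))) (scale (+ j) (member {gs} (there (here refl)))))
      closed (there (here refl)) j j<k = member (there (here refl))

    Stable-^ : ∀ {s} e → Stable k s → Stable k (λ n → s n ^ e)
    Stable-^ zero    st = Stable-const 1ᶻ
    Stable-^ (suc e) st = Stable-⊛ st (Stable-^ e st)

    Stable-eval : ∀ {s} F → Stable k s → Stable k (λ n → ZPoly.eval F (s n))
    Stable-eval []      st = Stable-const 0ᶻ
    Stable-eval (c ∷ F) st = Stable-⊕ (Stable-const c) (Stable-⊛ st (Stable-eval F st))

    Stable-affine : ∀ a b → Stable k (λ n → fromℤ (+ (a ℕ.* n ℕ.+ b)))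
    Stable-affine a b = Stable-resp (λ n → pointwise λ _ → cong (ℤ._+ + b) (sym (ℤP.pos-* a n)))
      (Stable-⊕ (Stable-⊛ (Stable-const (fromℤ (+ a))) Stable-id) (Stable-const (fromℤ (+ b))))

    Stable-section : ∀ {s} j → j < k → Stable k s → Stable k (section k j s)
    Stable-section j j<k (gs , cl , sp) = gs , cl , Spanned-section cl j j<k sp

    private
      common : ∀ s (A : Pred ℕ 0ℓ) m → (∀ j → j < m → A j ⊎ Stable k (section k j s)) →
        ∃ λ hs → Closed k hs × (∀ j → j < m → A j ⊎ Spanned hs (section k j s))
      common s A zero    h = [] , (λ ()) , λ _ ()
      common s A (suc m) h with common s A m (λ j j<m → h j (ℕP.m<n⇒m<1+n j<m)) | h m ℕP.≤-refl
      ... | hs , cl , sp | inj₁ a = hs , cl , λ j j<1+m →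
        [ sp j , (λ { refl → inj₁ a }) ]′ (ℕP.m≤n⇒m<n∨m≡n (ℕ.s≤s⁻¹ j<1+m))
      ... | hs , cl , sp | inj₂ (hs′ , cl′ , sp′) = hs ++ hs′ , Closed-++ {hs} {hs′} cl cl′ , λ j j<1+m →
        [ Sum.map₂ (Spanned-least (member ∘ AnyP.++⁺ˡ)) ∘ sp j
        , (λ { refl → inj₂ (Spanned-least (member ∘ AnyP.++⁺ʳ hs) sp′) }) ]′
        (ℕP.m≤n⇒m<n∨m≡n (ℕ.s≤s⁻¹ j<1+m))

      completion : ∀ gs xs →
        (∀ {g} → g ∈ xs → ∀ j → j < k → Spanned gs (section k j g) ⊎ Stable k (section k j g)) →
        ∃ λ hs → Closed k hs ×
          (∀ {g} → g ∈ xs → ∀ j → j < k → Spanned gs (section k j g) ⊎ Spanned hs (section k j g))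
      completion gs []       h = [] , (λ ()) , λ ()
      completion gs (x ∷ xs) h
        with completion gs xs (h ∘ there)
           | common x (λ j → Spanned gs (section k j x)) k (h (here refl))
      ... | hs , cl , sp | hs′ , cl′ , sp′ = hs ++ hs′ , Closed-++ {hs} {hs′} cl cl′ ,
        λ { (here refl) j j<k → Sum.map₂ (Spanned-least (member ∘ AnyP.++⁺ʳ hs)) (sp′ j j<k)
          ; (there g∈)  j j<k → Sum.map₂ (Spanned-least (member ∘ AnyP.++⁺ˡ)) (sp g∈ j j<k) }

    -- A section may leave the family as long as it is stable by itself: finitely many closed lists,
    -- one for each such section, are appended to the family.
    Stable-family : ∀ gs →
      (∀ {g} → g ∈ gs → ∀ j → j < k → Spanned gs (section k j g) ⊎ Stable k (section k j g)) →
      ∀ {s} → Spanned gs s → Stable k s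
    Stable-family gs h sp with completion gs gs h
    ... | hs , cl , sp′ = gs ++ hs , closed , left sp
      where
      left : Spanned gs ⊆ Spanned (gs ++ hs)
      left = Spanned-least (member ∘ AnyP.++⁺ˡ)
      right : Spanned hs ⊆ Spanned (gs ++ hs)
      right = Spanned-least (member ∘ AnyP.++⁺ʳ gs)
      closed : Closed k (gs ++ hs)
      closed g∈ j j<k with ∈-++⁻ gs g∈
      ... | inj₁ g∈gs = [ left , right ]′ (sp′ g∈gs j j<k)
      ... | inj₂ g∈hs = right (cl g∈hs j j<k)

    Stable-interleave : ∀ s → (∀ j → j < k → Stable k (section k j s)) → Stable k s
    Stable-interleave s h = Stable-family (s ∷ []) (λ { (here refl) j j<k → inj₂ (h j j<k) })
      (member (here refl))

    -- The family n ↦ c (u n + w) is finite because u and w count only modulo M, and it is closed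
    -- because n ↦ k n + j replaces (u, w) by (u k, u j + w).
    Stable-periodic : ∀ M .{{_ : NonZero M}} (c : ℕ → ℤ) → (∀ x t → c (x ℕ.+ t ℕ.* M) ≡ c x) →
      Stable k (λ n → fromℤ (c n))
    Stable-periodic M c periodic = gs , closed , resp
      (λ n → Z.reflexive (cong fromℤ (trans (reduce 1 0 n) (cong c (e n))))) (member (mem 1 0))
      where
      e : ∀ n → 1 ℕ.* n ℕ.+ 0 ≡ n
      e = ℕSolver.solve-∀
      s : ℕ → ℕ → Sequence
      s u w n = fromℤ (c (u ℕ.* n ℕ.+ w))
      gs = cartesianProductWith s (upTo M) (upTo M)
      reduce : ∀ u w n → c (u % M ℕ.* n ℕ.+ w % M) ≡ c (u ℕ.* n ℕ.+ w)
      reduce u w n = sym (trans (cong c (mod {u₀ = u % M} {u / M} {w % M} {w / M} (m≡m%n+[m/n]*n u M) (m≡m%n+[m/n]*n w M)))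
        (periodic (u % M ℕ.* n ℕ.+ w % M) (u / M ℕ.* n ℕ.+ w / M)))
        where
        int : ∀ M n u₀ u₁ w₀ w₁ → (u₀ ℕ.+ u₁ ℕ.* M) ℕ.* n ℕ.+ (w₀ ℕ.+ w₁ ℕ.* M) ≡
              (u₀ ℕ.* n ℕ.+ w₀) ℕ.+ (u₁ ℕ.* n ℕ.+ w₁) ℕ.* M
        int = ℕSolver.solve-∀
        mod : ∀ {u w u₀ u₁ w₀ w₁ : ℕ} → u ≡ u₀ ℕ.+ u₁ ℕ.* M → w ≡ w₀ ℕ.+ w₁ ℕ.* M →
          u ℕ.* n ℕ.+ w ≡ (u₀ ℕ.* n ℕ.+ w₀) ℕ.+ (u₁ ℕ.* n ℕ.+ w₁) ℕ.* M
        mod {u₀ = u₀} {u₁} {w₀} {w₁} refl refl = int M n u₀ u₁ w₀ w₁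
      mem : ∀ u w → s (u % M) (w % M) ∈ gs
      mem u w = ∈-cartesianProductWith⁺ s (∈-upTo⁺ (m%n<n u M)) (∈-upTo⁺ (m%n<n w M))
      closed : Closed k gs
      closed g∈ j j<k with ∈-cartesianProductWith⁻ s (upTo M) (upTo M) g∈
      ... | u , w , _ , _ , refl = resp
        (λ n → Z.reflexive (cong fromℤ (trans (reduce (u ℕ.* k) (u ℕ.* j ℕ.+ w) n)
          (cong c (int u k n j w))))) (member (mem (u ℕ.* k) (u ℕ.* j ℕ.+ w)))
        where
        int : ∀ u k n j w → u ℕ.* k ℕ.* n ℕ.+ (u ℕ.* j ℕ.+ w) ≡ u ℕ.* (k ℕ.* n ℕ.+ j) ℕ.+ w
        int = ℕSolver.solve-∀

-- Compactness of ℤₚ and polynomials without roots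

module RegularValues (p : ℕ) (p-prime : Prime p) (em : ExcludedMiddle 0ℓ) where
  open Padic p p-prime hiding (Polynomial; NonZeroPolynomial; eval)
  open Arithmetic p p-prime
  open Domain em
  open Normalisation p p-prime
  open Sequences p p-prime
  open Solver using (solve; _:=_; _:+_; _:*_; _:-_; :-_; con)
  open ZPoly using (eval)

  fromℕ : ℕ → ℤₚ
  fromℕ n = fromℤ (+ n)

  -- Q N r is a property of the ball r + pᴺ ℤₚ. If it failed for ℤₚ, it would
  -- fail for a nested sequence of balls, hence near the point they share.
  ball-induction : (Q : ℕ → ℕ → Set) →
    (∀ N r → (∀ d → d < p → Q (suc N) (r ℕ.+ d ℕ.* p ℕ.^ N)) → Q N r) →
    (∀ x → ∃ λ N → ∀ r → fromℕ r ≡ x [p^ N ] → Q N r) → Q 0 0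
  ball-induction Q split local with em {Q 0 0}
  ... | yes q  = q
  ... | no  ¬q = contradiction (proj₂ (local x) (proj₁ (path N)) (≡-approx x N)) (proj₂ (path N))
    where
    bad-child : ∀ N r → ¬ Q N r → ∃ λ d → ¬ Q (suc N) (r ℕ.+ d ℕ.* p ℕ.^ N)
    bad-child N r ¬q with em {∃ λ d → ¬ Q (suc N) (r ℕ.+ d ℕ.* p ℕ.^ N)}
    ... | yes found = found
    ... | no  none  = contradiction (split N r λ d _ → good d) ¬q
      where
      good : ∀ d → Q (suc N) (r ℕ.+ d ℕ.* p ℕ.^ N)
      good d with em {Q (suc N) (r ℕ.+ d ℕ.* p ℕ.^ N)}
      ... | yes q  = q
      ... | no  ¬q = contradiction (d , ¬q) none
    path : ∀ N → ∃ λ r → ¬ Q N r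
    path zero    = 0 , ¬q
    path (suc N) = let r , ¬q = path N ; d , ¬q′ = bad-child N r ¬q in r ℕ.+ d ℕ.* p ℕ.^ N , ¬q′
    x : ℤₚ
    x .approx   N = + proj₁ (path N)
    x .coherent N = divides (+ d) (trans (int (+ r) (+ (d ℕ.* p ℕ.^ N))) (ℤP.pos-* d (p ℕ.^ N)))
      where
      r = proj₁ (path N)
      d = proj₁ (bad-child N r (proj₂ (path N)))
      int : ∀ r s → r ℤ.+ s ℤ.- r ≡ s
      int = ℤSolver.solve-∀
    N = proj₁ (local x)

  ball-child : ∀ N r d n → p ℕ.^ N ℕ.* (p ℕ.* n ℕ.+ d) ℕ.+ r ≡
                           p ℕ.^ suc N ℕ.* n ℕ.+ (r ℕ.+ d ℕ.* p ℕ.^ N)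
  ball-child N r d n = int (p ℕ.^ N) p n d r
    where
    int : ∀ q p n d r → q ℕ.* (p ℕ.* n ℕ.+ d) ℕ.+ r ≡ p ℕ.* q ℕ.* n ℕ.+ (r ℕ.+ d ℕ.* q)
    int = ℕSolver.solve-∀

  ball-whole : ∀ n → p ℕ.^ 0 ℕ.* n ℕ.+ 0 ≡ n
  ball-whole = ℕSolver.solve-∀

  ball-≡ : ∀ N r x → fromℕ r ≡ x [p^ N ] → ∀ n → fromℕ (p ℕ.^ N ℕ.* n ℕ.+ r) ≡ x [p^ N ]
  ball-≡ N r x r≡x n = ≡-trans {fromℕ (p ℕ.^ N ℕ.* n ℕ.+ r)} {fromℕ r} {x} N
    (divides (+ n) (trans (int (+ (p ℕ.^ N ℕ.* n)) (+ r))
      (trans (ℤP.pos-* (p ℕ.^ N) n) (ℤP.*-comm (P N) (+ n))))) r≡x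
    where
    int : ∀ s r → s ℤ.+ r ℤ.- r ≡ s
    int = ℤSolver.solve-∀

  P≢0 : ∀ n → P n ≢ + 0
  P≢0 n eq = ℕ.≢-nonZero⁻¹ (p ℕ.^ n) {{ℕP.m^n≢0 p n}} (ℤP.+-injective eq)

  eval-ball : ∀ F N r x → fromℕ r ≡ x [p^ N ] → ∀ n →
    eval F (fromℕ (p ℕ.^ N ℕ.* n ℕ.+ r)) ≡ eval F x [p^ N ]
  eval-ball F N r x r≡x n = ≡-eval {fromℕ (p ℕ.^ N ℕ.* n ℕ.+ r)} {x} N F (ball-≡ N r x r≡x n)

  nonzero-bound : ∀ {x} → ¬ x ≈ᶻ 0ᶻ → ∃ λ B → ¬ Div B x
  nonzero-bound x≉0 = let v , _ , ¬div = maximal-power x≉0 in suc v , ¬div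

  ¬Div-≡ : ∀ {x y n} → x ≡ y [p^ n ] → ¬ Div n y → ¬ Div n x
  ¬Div-≡ {x} {y} {n} x≡y ¬div div = ¬div (≡-Div {y} {x} n (≡-sym {x} {y} n x≡y) div)

  module _ (F : List ℤₚ) (rootless : ∀ x → ¬ eval F x ≈ᶻ 0ᶻ) where

    private
      Bounded : ℕ → ℕ → Set
      Bounded N r = ∃ λ B → ∀ n → ¬ Div B (eval F (fromℕ (p ℕ.^ N ℕ.* n ℕ.+ r)))

      uniform : ∀ N r m → (∀ d → d < m → Bounded (suc N) (r ℕ.+ d ℕ.* p ℕ.^ N)) →
        ∃ λ B → ∀ d → d < m → ∀ n → ¬ Div B (eval F (fromℕ (p ℕ.^ N ℕ.* (p ℕ.* n ℕ.+ d) ℕ.+ r)))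
      uniform N r zero    h = 0 , λ _ ()
      uniform N r (suc m) h with uniform N r m (λ d d<m → h d (ℕP.m<n⇒m<1+n d<m)) | h m ℕP.≤-refl
      -- The sum is a convenient common upper bound for the finitely many subballs.
      ... | B , b | B′ , b′ = B ℕ.+ B′ , λ d d<1+m n div →
        [ (λ d<m → b d d<m n (Div-mono {eval F (fromℕ (p ℕ.^ N ℕ.* (p ℕ.* n ℕ.+ d) ℕ.+ r))} (ℕP.m≤m+n B B′) div))
        , (λ { refl → b′ n (subst (λ i → Div B′ (eval F (fromℕ i))) (ball-child N r d n)
            (Div-mono {eval F (fromℕ (p ℕ.^ N ℕ.* (p ℕ.* n ℕ.+ d) ℕ.+ r))} (ℕP.m≤n+m B′ B) div)) }) ]′
        (ℕP.m≤n⇒m<n∨m≡n (ℕ.s≤s⁻¹ d<1+m))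

      split : ∀ N r → (∀ d → d < p → Bounded (suc N) (r ℕ.+ d ℕ.* p ℕ.^ N)) → Bounded N r
      split N r h with uniform N r p h
      ... | B , b = B , λ n div → b (n % p) (m%n<n n p) (n / p)
        (subst (λ i → Div B (eval F (fromℕ (p ℕ.^ N ℕ.* i ℕ.+ r)))) (e n) div)
        where
        e : ∀ n → n ≡ p ℕ.* (n / p) ℕ.+ n % p
        e n = trans (m≡m%n+[m/n]*n n p)
          (trans (ℕP.+-comm (n % p) (n / p ℕ.* p)) (cong (ℕ._+ n % p) (ℕP.*-comm (n / p) p)))

    rootless⇒bounded : ∃ λ B → ∀ n → ¬ Div B (eval F (fromℕ n))
    rootless⇒bounded = proj₁ bounded , λ n div →
      proj₂ bounded n (subst (λ i → Div (proj₁ bounded) (eval F (fromℕ i))) (sym (ball-whole n)) div)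
      where
      near : ∀ x → ∃ λ N → ∀ r → fromℕ r ≡ x [p^ N ] → Bounded N r
      near x = let B , ¬div = nonzero-bound (rootless x) in B , λ r r≡x → B , λ n →
        ¬Div-≡ {eval F (fromℕ (p ℕ.^ B ℕ.* n ℕ.+ r))} {eval F x} {B} (eval-ball F B r x r≡x n) ¬div
      bounded : Bounded 0 0
      bounded = ball-induction Bounded split near

  module _ (l : ℕ) .{{l≢0 : NonZero l}} (F : List ℤₚ) (a : Sequence)
           (a-spec : ∀ n → Normalised l (eval F (fromℕ n)) (a n)) where

    -- Here p^B a(n) = p^(B - l q(n)) F(n). The exponent q(n) is determined by F(n) modulo p^(B +
    -- l), hence by n modulo p^(B + l), so the first factor is periodic and the second is a
    -- polynomial; both are stable in every base.
    bounded⇒KRegular : ∀ k .{{_ : NonZero k}} B (q : ℕ → ℕ) →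
      (∀ n → l ℕ.* q n ≤ B) → (∀ n → Scaled l (q n) (eval F (fromℕ n)) (a n)) → KRegular k a
    bounded⇒KRegular k B q lq≤B a-scaled = Stable⇒KRegular em (P≢0 B)
        (Stable-resp cF≈ (Stable-⊛ (Stable-periodic (p ℕ.^ (B ℕ.+ l)) {{ℕP.m^n≢0 p (B ℕ.+ l)}} c periodic)
                                   (Stable-eval F Stable-id)))
      where
      c : ℕ → ℤ
      c n = P (B ℕ.∸ l ℕ.* q n)
      periodic : ∀ n t → c (n ℕ.+ t ℕ.* p ℕ.^ (B ℕ.+ l)) ≡ c n
      periodic n t = cong (λ i → P (B ℕ.∸ l ℕ.* i))
        (Scaled-exponents l (a-scaled n′) (proj₁ (proj₂
          (Scaled-perturb l {x′ = eval F (fromℕ n′)} {B} {l} (a-scaled n) (lq≤B n) ℕP.≤-refl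
            (≡-eval {fromℕ n′} {fromℕ n} (B ℕ.+ l) F n′≡n)))))
        where
        n′ = n ℕ.+ t ℕ.* p ℕ.^ (B ℕ.+ l)
        int : ∀ n s → n ℤ.+ s ℤ.- n ≡ s
        int = ℤSolver.solve-∀
        n′≡n : fromℕ n′ ≡ fromℕ n [p^ B ℕ.+ l ]
        n′≡n = divides (+ t) (trans (int (+ n) (+ (t ℕ.* p ℕ.^ (B ℕ.+ l)))) (ℤP.pos-* t (p ℕ.^ (B ℕ.+ l))))
      cF≈ : ((λ n → fromℤ (c n)) ⊛ (λ n → eval F (fromℕ n))) ≋ (P B ⊙ a)
      cF≈ n = Z.trans (Z.*-congˡ {fromℤ (c n)} (proj₁ (a-scaled n)))
        (Z.trans (Z.sym (π-+-* (B ℕ.∸ l ℕ.* q n) (l ℕ.* q n) (a n)))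
          (Z.reflexive (cong (λ i → π^ i *ᶻ a n) (ℕP.m∸n+n≡m (lq≤B n)))))

    rootless⇒KRegular : (∀ x → ¬ eval F x ≈ᶻ 0ᶻ) → ∀ k → 2 ≤ k → KRegular k a
    rootless⇒KRegular rootless k 2≤k = let B , ¬div = rootless⇒bounded F rootless in
      bounded⇒KRegular k {{ℕ.>-nonZero (ℕP.≤-trans (s≤s z≤n) 2≤k)}} B (λ n → proj₁ (a-scaled n))
        (λ n → Scaled-exponent l (proj₂ (a-scaled n))
          (λ div → ¬div n (Div-mono {eval F (fromℕ n)} (ℕP.n≤1+n B) div)))
        (λ n → proj₂ (a-scaled n))
      where
      a-scaled : ∀ n → ∃ λ q → Scaled l q (eval F (fromℕ n)) (a n)
      a-scaled n = ≉0⇒Scaled l (rootless (fromℕ n)) (a-spec n)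

-- Normalised powers of linear polynomials in base p

module LinearValues (p : ℕ) (p-prime : Prime p) (em : ExcludedMiddle 0ℓ) where
  open Padic p p-prime hiding (Polynomial; NonZeroPolynomial; eval)
  open Arithmetic p p-prime
  open Domain em
  open Normalisation p p-prime
  open Sequences p p-prime
  open RegularValues p p-prime em
  open Solver using (solve; _:=_; _:+_; _:*_; _:-_; :-_; con)
  open ZPoly using (eval)

  ¬Div1-^ : ∀ {x} e → ¬ Div 1 x → ¬ Div 1 (x ^ e)
  ¬Div1-^ {x} zero    ¬div div = p∤⇒¬Div 1 p∤1 div
  ¬Div1-^ {x} (suc e) ¬div div = [ ¬div , ¬Div1-^ e ¬div ]′ (Div-* 0 1 x (x ^ e) div)

  ^-π-* : ∀ N e x → (π^ N *ᶻ x) ^ e ≈ᶻ π^ (N ℕ.* e) *ᶻ x ^ e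
  ^-π-* N e x = Z.trans (^-distrib-* (π^ N) x e) (Z.*-congʳ {x ^ e} (π-^ N e))
    where
    π-^ : ∀ N e → (π^ N) ^ e ≈ᶻ π^ (N ℕ.* e)
    π-^ N zero    = Z.reflexive (cong π^_ (sym (ℕP.*-zeroʳ N)))
    π-^ N (suc e) = Z.trans (Z.*-congˡ {π^ N} (π-^ N e))
      (Z.trans (Z.sym (π-+ N (N ℕ.* e))) (Z.reflexive (cong π^_ (sym (ℕP.*-suc N e)))))

  unit-power-Normalised : ∀ l {ρ} → ρ < l → ∀ e w → ¬ Div 1 w →
    Normalised l (π^ ρ *ᶻ w ^ e) (π^ ρ *ᶻ w ^ e)
  unit-power-Normalised l {ρ} ρ<l e w ¬div = scaled 0
    (Z.trans (Z.sym (Z.*-identityˡ (π^ ρ *ᶻ w ^ e))) (Z.*-congʳ {π^ ρ *ᶻ w ^ e} π^0≈1) , λ div →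
    ¬Div1-^ {w} e ¬div (Div-π*⁻¹ ρ 1 (w ^ e)
      (Div-mono {π^ ρ *ᶻ w ^ e} (subst (_≤ l) (ℕP.+-comm 1 ρ) ρ<l) div)))
    where
    π^0≈1 : 1ᶻ ≈ᶻ π^ (l ℕ.* 0)
    π^0≈1 = Z.reflexive (cong π^_ (sym (ℕP.*-zeroʳ l)))

  module LinearPowers (l : ℕ) .{{l≢0 : NonZero l}} (b e : ℕ) where

    linear : ℤ → Sequence
    linear c n = fromℤ (+ b ℤ.* + n ℤ.- c)

    abstract
      -- These model 𝓛 (F n) near a root c / b of multiplicity e; ρ collects the powers of p that
      -- cannot be separated from the linear factor under 𝓛.
      U : ℤ → ℕ → Sequence
      U c ρ n = proj₁ (normalise em l (π^ ρ *ᶻ linear c n ^ e))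

      U-spec : ∀ c ρ n → Normalised l (π^ ρ *ᶻ linear c n ^ e) (U c ρ n)
      U-spec c ρ n = proj₂ (normalise em l (π^ ρ *ᶻ linear c n ^ e))

    Stable-linear : ∀ {k} c → Stable k (linear c)
    Stable-linear c = Stable-resp {s = ((λ n → fromℤ (+ b)) ⊛ (λ n → fromℤ (+ n))) ⊕ (λ n → fromℤ (ℤ.- c))}
      (λ n → pointwise λ _ → refl)
      (Stable-⊕ (Stable-⊛ (Stable-const (fromℤ (+ b))) Stable-id) (Stable-const (fromℤ (ℤ.- c))))

    -- The multiples of l in ρ are absorbed by the normalisation, so finitely many ρ suffice.
    U-% : ∀ c ρ → U c ρ ≋ U c (ρ % l)
    U-% c ρ n = Normalised-unique l (U-spec c ρ n)
      (Normalised-resp l (begin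
        π^ (l ℕ.* (ρ / l)) *ᶻ (π^ (ρ % l) *ᶻ w)  ≈⟨ π-+-* (l ℕ.* (ρ / l)) (ρ % l) w ⟨
        π^ (l ℕ.* (ρ / l) ℕ.+ ρ % l) *ᶻ w        ≡⟨ cong (λ i → π^ i *ᶻ w) ρ≡ ⟨
        π^ ρ *ᶻ w                                ∎) Z.refl
        (Normalised-π l (ρ / l) (U-spec c (ρ % l) n)))
      where
      open ZR
      w = linear c n ^ e
      ρ≡ : ρ ≡ l ℕ.* (ρ / l) ℕ.+ ρ % l
      ρ≡ = trans (m≡m%n+[m/n]*n ρ l) (trans (ℕP.+-comm (ρ % l) (ρ / l ℕ.* l))
             (cong (ℕ._+ ρ % l) (ℕP.*-comm (ρ / l) l)))

    linear-section : ∀ c j n → + b ℤ.* + (p ℕ.* n ℕ.+ j) ℤ.- c ≡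
      P 1 ℤ.* (+ b ℤ.* + n) ℤ.+ (+ b ℤ.* + j ℤ.- c)
    linear-section c j n = trans (cong (λ i → + b ℤ.* (i ℤ.+ + j) ℤ.- c) (trans (ℤP.pos-* p n)
      (cong (λ i → + i ℤ.* + n) (sym (ℕP.^-identityʳ p))))) (int (+ b) (P 1) (+ n) (+ j) c)
      where
      int : ∀ b q n j c → b ℤ.* (q ℤ.* n ℤ.+ j) ℤ.- c ≡ q ℤ.* (b ℤ.* n) ℤ.+ (b ℤ.* j ℤ.- c)
      int = ℤSolver.solve-∀

    -- By the choice of c′, b (p n + j) - c = p (b n - c′); raised to the power e this contributes
    -- pᵉ to p^ρ.
    U-section-near : ∀ c ρ j c′ → + b ℤ.* + j ℤ.- c ≡ ℤ.- c′ ℤ.* P 1 →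
      section p j (U c ρ) ≋ U c′ (ρ ℕ.+ e)
    U-section-near c ρ j c′ eq n = Normalised-unique l (U-spec c ρ (p ℕ.* n ℕ.+ j))
      (Normalised-resp l (begin
        π^ (ρ ℕ.+ e) *ᶻ w ^ e                     ≈⟨ π-+-* ρ e (w ^ e) ⟩
        π^ ρ *ᶻ (π^ e *ᶻ w ^ e)                   ≡⟨ cong (λ i → π^ ρ *ᶻ (π^ i *ᶻ w ^ e)) (ℕP.*-identityˡ e) ⟨
        π^ ρ *ᶻ (π^ (1 ℕ.* e) *ᶻ w ^ e)           ≈⟨ Z.*-congˡ {π^ ρ} (^-π-* 1 e w) ⟨
        π^ ρ *ᶻ (π^ 1 *ᶻ w) ^ e                   ≈⟨ Z.*-congˡ {π^ ρ} (^-congˡ e (pointwise λ _ → sym linear≡)) ⟩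
        π^ ρ *ᶻ linear c (p ℕ.* n ℕ.+ j) ^ e      ∎) Z.refl (U-spec c′ (ρ ℕ.+ e) n))
      where
      open ZR
      w = linear c′ n
      int : ∀ q b n c → q ℤ.* (b ℤ.* n) ℤ.+ (ℤ.- c) ℤ.* q ≡ q ℤ.* (b ℤ.* n ℤ.- c)
      int = ℤSolver.solve-∀
      linear≡ : + b ℤ.* + (p ℕ.* n ℕ.+ j) ℤ.- c ≡ P 1 ℤ.* (+ b ℤ.* + n ℤ.- c′)
      linear≡ = trans (linear-section c j n)
        (trans (cong (λ i → P 1 ℤ.* (+ b ℤ.* + n) ℤ.+ i) eq) (int (P 1) (+ b) (+ n) c′))

    -- Now b (p n + j) - c is a unit for every n, and p^ρ times a unit is its own normal form
    -- because ρ < l. Thus the section is a polynomial in n.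
    U-section-far : ∀ c ρ j → ρ < l → ¬ P 1 ∣ + b ℤ.* + j ℤ.- c →
      section p j (U c ρ) ≋ section p j (λ n → π^ ρ *ᶻ linear c n ^ e)
    U-section-far c ρ j ρ<l P∤ n = Normalised-unique l (U-spec c ρ m)
      (unit-power-Normalised l ρ<l e (linear c m) ¬div)
      where
      m = p ℕ.* n ℕ.+ j
      ¬div : ¬ Div 1 (linear c m)
      ¬div div = P∤ (∣m+n∣m⇒∣n {P 1} {P 1 ℤ.* (+ b ℤ.* + n)} {+ b ℤ.* + j ℤ.- c}
        (subst (P 1 ∣_) (linear-section c j n) div) (∣m⇒∣m*n {P 1} {P 1} (+ b ℤ.* + n) ∣-refl))

    private
      centres : ℕ → List ℤ
      centres B = map +_ (upTo (suc B)) ++ map (λ i → ℤ.- + i) (upTo (suc B))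

      ∈-centres : ∀ B c → ℤ.∣ c ∣ ≤ B → c ∈ centres B
      ∈-centres B (+ n)    n≤B = ∈-++⁺ˡ (∈-map⁺ +_ (∈-upTo⁺ (s≤s n≤B)))
      ∈-centres B -[1+ n ] n<B = ∈-++⁺ʳ (map +_ (upTo (suc B)))
        (∈-map⁺ (λ i → ℤ.- + i) (∈-upTo⁺ (s≤s n<B)))

      ∈-centres⁻ : ∀ B {c} → c ∈ centres B → ℤ.∣ c ∣ ≤ B
      ∈-centres⁻ B c∈ with ∈-++⁻ (map +_ (upTo (suc B))) c∈
      ... | inj₁ c∈ˡ with ∈-map⁻ +_ c∈ˡ
      ...   | i , i∈ , refl = ℕ.s≤s⁻¹ (∈-upTo⁻ i∈)
      ∈-centres⁻ B c∈ | inj₂ c∈ʳ with ∈-map⁻ (λ i → ℤ.- + i) c∈ʳ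
      ...   | i , i∈ , refl = subst (_≤ B) (sym (ℤP.∣-i∣≡∣i∣ (+ i))) (ℕ.s≤s⁻¹ (∈-upTo⁻ i∈))

      -- B ≥ b keeps the iterated centres c ↦ (c - b j) / p bounded.
      centre-bound : ∀ {B c j} c′ → b ≤ B → ℤ.∣ c ∣ ≤ B → j < p →
        + b ℤ.* + j ℤ.- c ≡ ℤ.- c′ ℤ.* P 1 → ℤ.∣ c′ ∣ ≤ B
      centre-bound {B} {c} {j} c′ b≤B c≤B j<p eq = ℕP.*-cancelʳ-≤ ℤ.∣ c′ ∣ B p (begin
        ℤ.∣ c′ ∣ ℕ.* p                       ≡⟨ abs-eq ⟩
        ℤ.∣ + b ℤ.* + j ℤ.- c ∣              ≤⟨ ℤP.∣i-j∣≤∣i∣+∣j∣ (+ b ℤ.* + j) c ⟩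
        ℤ.∣ + b ℤ.* + j ∣ ℕ.+ ℤ.∣ c ∣        ≡⟨ cong (ℕ._+ ℤ.∣ c ∣) (ℤP.abs-* (+ b) (+ j)) ⟩
        b ℕ.* j ℕ.+ ℤ.∣ c ∣                  ≤⟨ ℕP.+-mono-≤ (ℕP.*-monoˡ-≤ j b≤B) c≤B ⟩
        B ℕ.* j ℕ.+ B                        ≡⟨ ℕP.+-comm (B ℕ.* j) B ⟩
        B ℕ.+ B ℕ.* j                        ≡⟨ ℕP.*-suc B j ⟨
        B ℕ.* suc j                          ≤⟨ ℕP.*-monoʳ-≤ B j<p ⟩
        B ℕ.* p                              ∎)
        where
        open ℕP.≤-Reasoning
        abs-eq : ℤ.∣ c′ ∣ ℕ.* p ≡ ℤ.∣ + b ℤ.* + j ℤ.- c ∣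
        abs-eq = sym (trans (cong ℤ.∣_∣ eq) (trans (ℤP.abs-* (ℤ.- c′) (P 1))
          (cong₂ ℕ._*_ (ℤP.∣-i∣≡∣i∣ c′) (ℕP.^-identityʳ p))))

    Stable-U : ∀ c ρ → Stable p (U c ρ)
    Stable-U c ρ = Stable-family gs step (resp (λ n → Z.sym (U-% c ρ n)) (member (mem c (ℕP.m≤n+m ℤ.∣ c ∣ b) ρ)))
      where
      -- At least ∣c∣, to contain the initial centre, and at least b, as `centre-bound` demands.
      B = b ℕ.+ ℤ.∣ c ∣
      gs = cartesianProductWith U (centres B) (upTo l)
      mem : ∀ c → ℤ.∣ c ∣ ≤ B → ∀ ρ → U c (ρ % l) ∈ gs
      mem c c≤B ρ = ∈-cartesianProductWith⁺ U (∈-centres B c c≤B) (∈-upTo⁺ (m%n<n ρ l))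
      step′ : ∀ c ρ → c ∈ centres B → ρ < l → ∀ j → j < p → Dec (P 1 ∣ + b ℤ.* + j ℤ.- c) →
        Spanned gs (section p j (U c ρ)) ⊎ Stable p (section p j (U c ρ))
      step′ c ρ c∈ ρ<l j j<p (no  P∤) = inj₂ (Stable-resp
        (λ n → Z.sym (U-section-far c ρ j ρ<l P∤ n))
        (Stable-section j j<p (Stable-⊛ (Stable-const (π^ ρ)) (Stable-^ e (Stable-linear c)))))
      step′ c ρ c∈ ρ<l j j<p (yes (divides z eq)) = inj₁ (resp
        (λ n → Z.sym (Z.trans (U-section-near c ρ j (ℤ.- z) eq′ n) (U-% (ℤ.- z) (ρ ℕ.+ e) n)))
        (member (mem (ℤ.- z) (centre-bound (ℤ.- z) (ℕP.m≤m+n b _) (∈-centres⁻ B c∈) j<p eq′) (ρ ℕ.+ e))))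
        where
        eq′ : + b ℤ.* + j ℤ.- c ≡ ℤ.- (ℤ.- z) ℤ.* P 1
        eq′ = trans eq (cong (ℤ._* P 1) (sym (ℤP.neg-involutive z)))
      step : ∀ {g} → g ∈ gs → ∀ j → j < p → Spanned gs (section p j g) ⊎ Stable p (section p j g)
      step g∈ j j<p with ∈-cartesianProductWith⁻ U (centres B) (upTo l) g∈
      ... | c , ρ , c∈ , ρ∈ , refl = step′ c ρ c∈ (∈-upTo⁻ ρ∈) j j<p (P 1 ∣? + b ℤ.* + j ℤ.- c)

-- Regularity in base p when all roots are rational

module RationalRoots (p : ℕ) (p-prime : Prime p) (em : ExcludedMiddle 0ℓ) where
  open Padic p p-prime hiding (Polynomial; NonZeroPolynomial; eval)
  open Arithmetic p p-prime
  open Domain em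
  open Normalisation p p-prime
  open Sequences p p-prime
  open RegularValues p p-prime em
  open LinearValues p p-prime em
  open Solver using (solve; _:=_; _:+_; _:*_; _:-_; :-_; con)
  open ZPoly using (eval)

  private
    cleared-value : ∀ N v e {b y w Fy Hy h} → b *ᶻ y ≈ᶻ π^ N *ᶻ w →
      Fy ≈ᶻ y ^ e *ᶻ Hy → Hy ≈ᶻ π^ v *ᶻ h →
      h *ᶻ (π^ (v ℕ.+ N ℕ.* e) *ᶻ w ^ e) ≈ᶻ b ^ e *ᶻ Fy
    cleared-value N v e {b} {y} {w} {Fy} {Hy} {h} by≈ Fy≈ Hy≈ = Z.sym (begin
      b ^ e *ᶻ Fy                                 ≈⟨ Z.*-congˡ {b ^ e} Fy≈ ⟩
      b ^ e *ᶻ (y ^ e *ᶻ Hy)                      ≈⟨ Z.*-assoc (b ^ e) (y ^ e) Hy ⟨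
      b ^ e *ᶻ y ^ e *ᶻ Hy                        ≈⟨ Z.*-cong (Z.sym (^-distrib-* b y e)) Hy≈ ⟩
      (b *ᶻ y) ^ e *ᶻ (π^ v *ᶻ h)                 ≈⟨ Z.*-congʳ {π^ v *ᶻ h} (Z.trans (^-congˡ e by≈) (^-π-* N e w)) ⟩
      π^ (N ℕ.* e) *ᶻ w ^ e *ᶻ (π^ v *ᶻ h)        ≈⟨ shuffle (π^ (N ℕ.* e)) (w ^ e) (π^ v) h ⟩
      h *ᶻ (π^ v *ᶻ (π^ (N ℕ.* e) *ᶻ w ^ e))      ≈⟨ Z.*-congˡ {h} (π-+-* v (N ℕ.* e) (w ^ e)) ⟨
      h *ᶻ (π^ (v ℕ.+ N ℕ.* e) *ᶻ w ^ e)          ∎)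
      where
      open ZR
      shuffle : ∀ q w v h → q *ᶻ w *ᶻ (v *ᶻ h) ≈ᶻ h *ᶻ (v *ᶻ (q *ᶻ w))
      shuffle q w v h = solve 4 (λ q w v h → q :* w :* (v :* h) := h :* (v :* (q :* w))) Z.refl q w v h

    -- The units b and h pass through the normalisation, giving b a = h U. In the application h need
    -- not be a polynomial in n; multiplying by k = pᵛ turns it into the polynomial value H.
    normalised-product : ∀ l .{{_ : NonZero l}} {b h k W U F a H} → ¬ Div 1 b → ¬ Div 1 h →
      Normalised l W U → Normalised l F a → h *ᶻ W ≈ᶻ b *ᶻ F → H ≈ᶻ k *ᶻ h →
      b *ᶻ k *ᶻ a ≈ᶻ U *ᶻ H
    normalised-product l {b} {h} {k} {W} {U} {F} {a} {H} ¬div-b ¬div-h W↦U F↦a hW≈bF H≈ = begin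
      b *ᶻ k *ᶻ a        ≈⟨ solve 3 (λ b k a → b :* k :* a := k :* (b :* a)) Z.refl b k a ⟩
      k *ᶻ (b *ᶻ a)      ≈⟨ Z.*-congˡ {k} (Normalised-unique l (Normalised-unit l b ¬div-b F↦a)
                              (Normalised-resp l hW≈bF Z.refl (Normalised-unit l h ¬div-h W↦U))) ⟩
      k *ᶻ (h *ᶻ U)      ≈⟨ solve 3 (λ k h u → k :* (h :* u) := u :* (k :* h)) Z.refl k h U ⟩
      U *ᶻ (k *ᶻ h)      ≈⟨ Z.*-congˡ {U} H≈ ⟨
      U *ᶻ H             ∎
      where open ZR

    perturbed-value : ∀ l {q B x y x′ a} → Scaled l q x y → l ℕ.* q ≤ B →
      x′ ≡ x [p^ B ℕ.+ l ] → Normalised l x′ a → x′ ≈ᶻ π^ (l ℕ.* q) *ᶻ a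
    perturbed-value l {q} {B} {x} {y} {x′} s lq≤B x′≡x x′↦a =
      let y′ , s′ , _ = Scaled-perturb l {x′ = x′} {B} {l} s lq≤B ℕP.≤-refl x′≡x in
      Z.trans (proj₁ s′) (Z.*-congˡ {π^ (l ℕ.* q)} (Normalised-unique l (scaled q s′) x′↦a))

  -- The condition p ∤ b makes b a unit, so that bᵉ can be moved through 𝓛.
  LocallyRational : List ℤₚ → Set
  LocallyRational F = ∀ x → eval F x ≈ᶻ 0ᶻ →
    ∃₂ λ b c → ¬ p ℕ∣.∣ b × fromℕ b *ᶻ x ≈ᶻ fromℤ c

  ≢0-* : ∀ {i j} → i ≢ + 0 → j ≢ + 0 → i ℤ.* j ≢ + 0
  ≢0-* {i} i≢0 j≢0 eq = [ i≢0 , j≢0 ]′ (ℤP.i*j≡0⇒i≡0∨j≡0 i eq)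

  ≢0-^ : ∀ {i} e → i ≢ + 0 → i ℤ.^ e ≢ + 0
  ≢0-^ zero    i≢0 = λ ()
  ≢0-^ {i} (suc e) i≢0 = ≢0-* {i} {i ℤ.^ e} i≢0 (≢0-^ e i≢0)

  fromℤ-^ : ∀ i e → fromℤ (i ℤ.^ e) ≈ᶻ fromℤ i ^ e
  fromℤ-^ i zero    = Z.refl
  fromℤ-^ i (suc e) = Z.trans (fromℤ-* i (i ℤ.^ e)) (Z.*-congˡ {fromℤ i} (fromℤ-^ i e))

  module _ (l : ℕ) .{{l≢0 : NonZero l}} (F : List ℤₚ) (a : Sequence)
           (a-spec : ∀ n → Normalised l (eval F (fromℕ n)) (a n)) where

    private
      StableBall : ℕ → ℕ → Set
      StableBall N r = ∃ λ D → D ≢ + 0 × Stable p (D ⊙ section (p ℕ.^ N) r a)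

      Stable-multiple : ∀ {D s} E → Stable p (D ⊙ s) → Stable p ((E ℤ.* D) ⊙ s)
      Stable-multiple {D} {s} E st = Stable-resp
        (λ n → Z.trans (Z.sym (Z.*-assoc (fromℤ E) (fromℤ D) (s n))) (pointwise λ _ → refl))
        (Stable-⊛ (Stable-const (fromℤ E)) st)

      uniform : ∀ N r m → (∀ d → d < m → StableBall (suc N) (r ℕ.+ d ℕ.* p ℕ.^ N)) →
        ∃ λ D → D ≢ + 0 × (∀ d → d < m → Stable p (D ⊙ section (p ℕ.^ suc N) (r ℕ.+ d ℕ.* p ℕ.^ N) a))
      uniform N r zero    h = + 1 , (λ ()) , λ _ ()
      uniform N r (suc m) h with uniform N r m (λ d d<m → h d (ℕP.m<n⇒m<1+n d<m)) | h m ℕP.≤-refl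
      ... | D , D≢0 , st | E , E≢0 , st′ = E ℤ.* D , ≢0-* {E} {D} E≢0 D≢0 , λ d d<1+m →
        [ (λ d<m → Stable-multiple E (st d d<m))
        , (λ { refl → Stable-resp
             (λ n → Z.*-congʳ {a (p ℕ.^ suc N ℕ.* n ℕ.+ (r ℕ.+ d ℕ.* p ℕ.^ N))} (pointwise λ _ → ℤP.*-comm D E))
             (Stable-multiple D st′) }) ]′
        (ℕP.m≤n⇒m<n∨m≡n (ℕ.s≤s⁻¹ d<1+m))

      split : ∀ N r → (∀ d → d < p → StableBall (suc N) (r ℕ.+ d ℕ.* p ℕ.^ N)) → StableBall N r
      split N r h with uniform N r p h
      ... | D , D≢0 , st = D , D≢0 , Stable-interleave (D ⊙ section (p ℕ.^ N) r a) λ d d<p →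
        Stable-resp (λ n → Z.*-congˡ {fromℤ D} (Z.reflexive (cong a (sym (ball-child N r d n))))) (st d d<p)

      -- On this ball the exponent q does not change, so p^(l q) a is the polynomial F itself.
      local-nonroot : ∀ x v → ¬ Div (suc v) (eval F x) → ∀ q {y} → Scaled l q (eval F x) y →
        ∀ r → fromℕ r ≡ x [p^ v ℕ.+ l ] → StableBall (v ℕ.+ l) r
      local-nonroot x v ¬div q s r r≡x = P (l ℕ.* q) , P≢0 (l ℕ.* q) , Stable-resp F≈
        (Stable-eval F (Stable-affine (p ℕ.^ (v ℕ.+ l)) r))
        where
        F≈ : (λ n → eval F (fromℕ (p ℕ.^ (v ℕ.+ l) ℕ.* n ℕ.+ r))) ≋
             (P (l ℕ.* q) ⊙ section (p ℕ.^ (v ℕ.+ l)) r a)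
        F≈ n = perturbed-value l s (Scaled-exponent l s ¬div) (eval-ball F (v ℕ.+ l) r x r≡x n)
          (a-spec (p ℕ.^ (v ℕ.+ l) ℕ.* n ℕ.+ r))

      module _ (x : ℤₚ) (b : ℕ) (c : ℤ) (p∤b : ¬ p ℕ∣.∣ b) (bx≈c : fromℕ b *ᶻ x ≈ᶻ fromℤ c)
               (e : ℕ) (H : List ℤₚ) (F≈ : ∀ X → eval F X ≈ᶻ (X -ᶻ x) ^ e *ᶻ eval H X)
               (v : ℕ) (div : Div v (eval H x)) (¬div : ¬ Div (suc v) (eval H x))
               (r : ℕ) (r≡x : fromℕ r ≡ x [p^ suc v ]) where
        open LinearPowers l b e

        private
          -- One digit beyond the valuation of H x: this precision gives H the exact valuation v on
          -- the whole ball.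
          N = suc v
          X : ℕ → ℤₚ
          X n = fromℕ (p ℕ.^ N ℕ.* n ℕ.+ r)

          b≢0 : + b ≢ + 0
          b≢0 eq = p∤b (subst (p ℕ∣.∣_) (sym (ℤP.+-injective eq)) (p ℕ∣.∣0))

          br≡c : P N ∣ + b ℤ.* + r ℤ.- c
          br≡c = ≡-trans {fromℕ b *ᶻ fromℕ r} {fromℕ b *ᶻ x} {fromℤ c} N
            (≡-* {fromℕ b} {fromℕ b} {fromℕ r} {x} N (≡-refl {fromℕ b} N) r≡x) (≈⇒≡ N bx≈c)

          cofactor : ∀ n → ∃ λ h → eval H (X n) ≈ᶻ π^ v *ᶻ h × ¬ Div 1 h
          cofactor n = h , H≈ , λ div-h → ¬Div-≡ {eval H (X n)} {eval H x} {N} H≡ ¬div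
              (Div-≈ N (Z.sym H≈) (subst (λ i → Div i (π^ v *ᶻ h)) (ℕP.+-comm v 1) (Div-π* v 1 h div-h)))
            where
            H≡ : eval H (X n) ≡ eval H x [p^ N ]
            H≡ = eval-ball H N r x r≡x n
            dv : Div v (eval H (X n))
            dv = ≡-Div {eval H (X n)} {eval H x} v (≡-mono {eval H (X n)} {eval H x} (ℕP.n≤1+n v) H≡) div
            h = proj₁ (divisible (eval H (X n)) v dv)
            H≈ : eval H (X n) ≈ᶻ π^ v *ᶻ h
            H≈ = proj₂ (divisible (eval H (X n)) v dv)

          b[X-x]≈ : ∀ z → + b ℤ.* + r ℤ.- c ≡ z ℤ.* P N → ∀ n →
            fromℕ b *ᶻ (X n -ᶻ x) ≈ᶻ π^ N *ᶻ linear (ℤ.- z) n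
          b[X-x]≈ z eq n = begin
            fromℕ b *ᶻ (X n -ᶻ x)
              ≈⟨ solve 3 (λ b X x → b :* (X :- x) := b :* X :- b :* x) Z.refl (fromℕ b) (X n) x ⟩
            fromℕ b *ᶻ X n -ᶻ fromℕ b *ᶻ x
              ≈⟨ Z.+-congˡ {fromℕ b *ᶻ X n} (Z.-‿cong bx≈c) ⟩
            fromℕ b *ᶻ X n -ᶻ fromℤ c
              ≈⟨ pointwise (λ _ → linear≡) ⟩
            π^ N *ᶻ linear (ℤ.- z) n ∎
            where
            open ZR
            int : ∀ b q n r c → b ℤ.* (q ℤ.* n ℤ.+ r) ℤ.- c ≡ q ℤ.* (b ℤ.* n) ℤ.+ (b ℤ.* r ℤ.- c)
            int = ℤSolver.solve-∀
            int′ : ∀ q b n z → q ℤ.* (b ℤ.* n) ℤ.+ z ℤ.* q ≡ q ℤ.* (b ℤ.* n ℤ.- (ℤ.- z))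
            int′ = ℤSolver.solve-∀
            linear≡ : + b ℤ.* + (p ℕ.^ N ℕ.* n ℕ.+ r) ℤ.- c ≡ P N ℤ.* (+ b ℤ.* + n ℤ.- (ℤ.- z))
            linear≡ = trans (cong (λ i → + b ℤ.* (i ℤ.+ + r) ℤ.- c) (ℤP.pos-* (p ℕ.^ N) n))
              (trans (int (+ b) (P N) (+ n) (+ r) c)
                (trans (cong (λ i → P N ℤ.* (+ b ℤ.* + n) ℤ.+ i) eq) (int′ (P N) (+ b) (+ n) z)))

          product : ∀ z → + b ℤ.* + r ℤ.- c ≡ z ℤ.* P N → ∀ n →
            fromℕ b ^ e *ᶻ π^ v *ᶻ a (p ℕ.^ N ℕ.* n ℕ.+ r) ≈ᶻ
            U (ℤ.- z) (v ℕ.+ N ℕ.* e) n *ᶻ eval H (X n)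
          product z eq n = let h , H≈ , ¬div-h = cofactor n in
            normalised-product l {b = fromℕ b ^ e} {h} {π^ v} (¬Div1-^ {fromℕ b} e (p∤⇒¬Div b p∤b)) ¬div-h
              (U-spec (ℤ.- z) (v ℕ.+ N ℕ.* e) n) (a-spec (p ℕ.^ N ℕ.* n ℕ.+ r))
              (cleared-value N v e {fromℕ b} {X n -ᶻ x} (b[X-x]≈ z eq n) (F≈ (X n)) H≈) H≈

        local-root : StableBall (suc v) r
        local-root = stable br≡c
          where
          D = (+ b) ℤ.^ e ℤ.* P v
          D≈ : fromℤ D ≈ᶻ fromℕ b ^ e *ᶻ π^ v
          D≈ = Z.trans (fromℤ-* ((+ b) ℤ.^ e) (P v)) (Z.*-congʳ {π^ v} (fromℤ-^ (+ b) e))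
          stable : P N ∣ + b ℤ.* + r ℤ.- c → StableBall (suc v) r
          stable (divides z eq) = D , ≢0-* {(+ b) ℤ.^ e} {P v} (≢0-^ e b≢0) (P≢0 v) , Stable-resp
            (λ n → Z.sym (Z.trans (Z.*-congʳ {a (p ℕ.^ N ℕ.* n ℕ.+ r)} D≈) (product z eq n)))
            (Stable-⊛ (Stable-U (ℤ.- z) (v ℕ.+ N ℕ.* e)) (Stable-eval H (Stable-affine (p ℕ.^ N) r)))

    rational-roots⇒KRegular : ZPoly.NonZeroPolynomial F → LocallyRational F → KRegular p a
    rational-roots⇒KRegular F≢0 rational =
      conclude (ball-induction StableBall split (λ x → local x (em {eval F x ≈ᶻ 0ᶻ})))
      where
      local : ∀ x → Dec (eval F x ≈ᶻ 0ᶻ) → ∃ λ N → ∀ r → fromℕ r ≡ x [p^ N ] → StableBall N r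
      local x (no  Fx≉0) =
        let v , _ , ¬div = maximal-power Fx≉0
            q , s = ≉0⇒Scaled l Fx≉0 (proj₂ (normalise em l (eval F x)))
        in v ℕ.+ l , local-nonroot x v ¬div q s
      local x (yes Fx≈0) =
        let b , c , p∤b , bx≈c = rational x Fx≈0
            e , H , F≈ , Hx≉0 = factorisation F F≢0 x
            v , div , ¬div = maximal-power Hx≉0
        in suc v , local-root x b c p∤b bx≈c e H F≈ v div ¬div
      conclude : StableBall 0 0 → KRegular p a
      conclude (D , D≢0 , st) = Stable⇒KRegular em D≢0
        (Stable-resp (λ n → Z.*-congˡ {fromℤ D} (Z.reflexive (cong a (ball-whole n)))) st)

length-filter-¬ : ∀ {A : Set} {P : Pred A 0ℓ} (P? : Decidable P) xs →
  length (filter P? xs) ℕ.+ length (filter (¬? ∘ P?) xs) ≡ length xs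
length-filter-¬ P? []       = refl
length-filter-¬ P? (x ∷ xs) with P? x
... | yes _ = cong suc (length-filter-¬ P? xs)
... | no  _ = trans (ℕP.+-suc (length (filter P? xs)) _) (cong suc (length-filter-¬ P? xs))

-- Either the value N is taken more than d times, or removing its elements leaves more than N d
-- elements with values below N.
pigeonhole : ∀ {A : Set} N d (φ : A → ℕ) xs → All (λ x → φ x < N) xs → Unique xs → N ℕ.* d < length xs →
  ∃₂ λ v ys → All (λ x → φ x ≡ v) ys × Unique ys × d < length ys
pigeonhole zero    d φ []       _         _    ()
pigeonhole zero    d φ (x ∷ xs) (() ∷ _)  _    _
pigeonhole {A} (suc N) d φ xs φ<1+N uniq long with d ℕP.<? length (filter (λ x → φ x ℕP.≟ N) xs)
... | yes d<ys = N , _ , AllP.all-filter (λ x → φ x ℕP.≟ N) xs , UniqueP.filter⁺ (λ x → φ x ℕP.≟ N) uniq , d<ys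
... | no  d≮ys = pigeonhole N d φ (filter rest? xs)
      (All.zipWith (λ (φ<1+N , φ≢N) → ℕP.≤∧≢⇒< (ℕ.s≤s⁻¹ φ<1+N) φ≢N)
        (AllP.filter⁺ rest? φ<1+N , AllP.all-filter rest? xs))
      (UniqueP.filter⁺ rest? uniq)
      (ℕP.+-cancelˡ-< d (N ℕ.* d) _ (ℕP.<-≤-trans long (subst (_≤ d ℕ.+ length (filter rest? xs))
        (length-filter-¬ (λ x → φ x ℕP.≟ N) xs)
        (ℕP.+-monoˡ-≤ (length (filter rest? xs)) (ℕP.≮⇒≥ d≮ys)))))
  where
  rest? : Decidable (λ (x : A) → ¬ φ x ≡ N)
  rest? x = ¬? (φ x ℕP.≟ N)

-- Kernel sequences modulo powers of p, at roots and away from them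

module IrregularValues (p : ℕ) (p-prime : Prime p) (em : ExcludedMiddle 0ℓ) where
  open Padic p p-prime hiding (Polynomial; NonZeroPolynomial; eval)
  open Arithmetic p p-prime
  open Domain em
  open Normalisation p p-prime
  open Sequences p p-prime
  open RegularValues p p-prime em
  open LinearValues p p-prime em
  open Solver using (solve; _:=_; _:+_; _:*_; _:-_; :-_; con)
  open ZPoly using (eval)

  -- The code records the coefficients modulo pˢ, hence N = p^(s · length gs). It is read from a
  -- representation and not from the sequence, since representations need not be unique.
  residues : ∀ s gs → ∃ λ N → Σ (∀ {t} → Combination gs t → Fin N) λ code →
    ∀ {t t′} (h : Combination gs t) (h′ : Combination gs t′) → code h ≡ code h′ →
    ∀ n → t n ≡ t′ n [p^ s ]
  residues s []       = 1 , (λ _ → Fin.zero) , λ {t} {t′} h h′ _ n →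
    ≈⇒≡ {t n} {t′ n} s (Z.trans (h n) (Z.sym (h′ n)))
  residues s (g ∷ gs) with residues s gs
  ... | N , code , faithful = p ℕ.^ s ℕ.* N , code′ , faithful′
    where
    instance
      p^s≢0 : NonZero (p ℕ.^ s)
      p^s≢0 = ℕP.m^n≢0 p s
    digit : ℤ → Fin (p ℕ.^ s)
    digit c = fromℕ< (n%ℕd<d c (p ℕ.^ s))
    code′ : ∀ {t} → Combination (g ∷ gs) t → Fin (p ℕ.^ s ℕ.* N)
    code′ (c , u , h , _) = Fin.combine (digit c) (code h)
    digit-faithful : ∀ c c′ → digit c ≡ digit c′ → P s ∣ c ℤ.- c′
    digit-faithful c c′ eq = divides (c /ℕ p ℕ.^ s ℤ.- c′ /ℕ p ℕ.^ s)
      (lemma {r = + (c %ℕ p ℕ.^ s)} {c /ℕ p ℕ.^ s} {c′ /ℕ p ℕ.^ s} {P s}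
        (a≡a%ℕn+[a/ℕn]*n c (p ℕ.^ s))
        (trans (a≡a%ℕn+[a/ℕn]*n c′ (p ℕ.^ s)) (cong (λ r → + r ℤ.+ c′ /ℕ p ℕ.^ s ℤ.* P s) (sym same))))
      where
      same : c %ℕ p ℕ.^ s ≡ c′ %ℕ p ℕ.^ s
      same = FinP.fromℕ<-injective (c %ℕ p ℕ.^ s) (c′ %ℕ p ℕ.^ s)
        (n%ℕd<d c (p ℕ.^ s)) (n%ℕd<d c′ (p ℕ.^ s)) eq
      int : ∀ r q q′ P → (r ℤ.+ q ℤ.* P) ℤ.- (r ℤ.+ q′ ℤ.* P) ≡ (q ℤ.- q′) ℤ.* P
      int = ℤSolver.solve-∀
      lemma : ∀ {c c′ r q q′ P} → c ≡ r ℤ.+ q ℤ.* P → c′ ≡ r ℤ.+ q′ ℤ.* P → c ℤ.- c′ ≡ (q ℤ.- q′) ℤ.* P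
      lemma {r = r} {q} {q′} {P} refl refl = int r q q′ P
    faithful′ : ∀ {t t′} (h : Combination (g ∷ gs) t) (h′ : Combination (g ∷ gs) t′) → code′ h ≡ code′ h′ →
      ∀ n → t n ≡ t′ n [p^ s ]
    faithful′ {t} {t′} (c , u , h , eq) (c′ , u′ , h′ , eq′) same n =
      ≡-trans {t n} {fromℤ c *ᶻ g n +ᶻ u n} {t′ n} s (≈⇒≡ s (eq n))
        (≡-trans {fromℤ c *ᶻ g n +ᶻ u n} {fromℤ c′ *ᶻ g n +ᶻ u′ n} {t′ n} s
          (≡-+ {fromℤ c *ᶻ g n} {fromℤ c′ *ᶻ g n} {u n} {u′ n} s
            (≡-* {fromℤ c} {fromℤ c′} {g n} {g n} s
              (digit-faithful c c′ (proj₁ (FinP.combine-injective (digit c) (code h) (digit c′) (code h′) same)))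
              (≡-refl {g n} s))
            (faithful h h′ (proj₂ (FinP.combine-injective (digit c) (code h) (digit c′) (code h′) same)) n))
          (≈⇒≡ s (Z.sym (eq′ n))))

  -- The irregularity proof uses regularity only through this finiteness.
  kernel-residues : ∀ s {k a} → KRegular k a → ∃ λ N → Σ (∀ i j → j < k ℕ.^ i → Fin N) λ code →
    ∀ i j j< i′ j′ j′< → code i j j< ≡ code i′ j′ j′< →
    ∀ n → a (k ℕ.^ i ℕ.* n ℕ.+ j) ≡ a (k ℕ.^ i′ ℕ.* n ℕ.+ j′) [p^ s ]
  kernel-residues s {k} {a} (r , g , ⊆Span , _) =
    let N , code , faithful = residues s gs in
    N , (λ i j j< → code (combination i j j<)) ,
    λ i j j< i′ j′ j′< → faithful (combination i j j<) (combination i′ j′ j′<)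
    where
    gs = tabulate g
    combination : ∀ i j → j < k ℕ.^ i → Combination gs (section (k ℕ.^ i) j a)
    combination i j j< = Spanned⇒Combination
      (Span-least (λ (m , t≋g) → gen (AnyP.tabulate⁺ m t≋g))
        (⊆Span (gen (i , fromℕ< j< , λ n → Z.reflexive
          (cong (λ m → a (k ℕ.^ i ℕ.* n ℕ.+ m)) (sym (FinP.toℕ-fromℕ< j<)))))))

  representative : ∀ x n → ∃ λ r → r < p ℕ.^ n × fromℕ r ≡ x [p^ n ]
  representative x n = r , n%ℕd<d (approx x n) (p ℕ.^ n) ,
    ≡-trans {fromℕ r} {fromℤ (approx x n)} {x} n
      (divides (ℤ.- q) (lemma (a≡a%ℕn+[a/ℕn]*n (approx x n) (p ℕ.^ n)))) (≡-approx x n)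
    where
    instance
      p^n≢0 : NonZero (p ℕ.^ n)
      p^n≢0 = ℕP.m^n≢0 p n
    r = approx x n %ℕ p ℕ.^ n
    q = approx x n /ℕ p ℕ.^ n
    int : ∀ r q P → r ℤ.- (r ℤ.+ q ℤ.* P) ≡ ℤ.- q ℤ.* P
    int = ℤSolver.solve-∀
    lemma : ∀ {c} → c ≡ + r ℤ.+ q ℤ.* P n → + r ℤ.- c ≡ ℤ.- q ℤ.* P n
    lemma refl = int (+ r) q (P n)

  affine-≡ : ∀ K j {n x} N → fromℕ n ≡ x [p^ N ] → fromℕ (K ℕ.* n ℕ.+ j) ≡ fromℕ K *ᶻ x +ᶻ fromℕ j [p^ N ]
  affine-≡ K j {n} {x} N n≡x = ≡-trans {fromℕ (K ℕ.* n ℕ.+ j)} {fromℕ K *ᶻ fromℕ n +ᶻ fromℕ j} {fromℕ K *ᶻ x +ᶻ fromℕ j} N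
    (≈⇒≡ {fromℕ (K ℕ.* n ℕ.+ j)} {fromℕ K *ᶻ fromℕ n +ᶻ fromℕ j} N (pointwise λ _ → cong (ℤ._+ + j) (ℤP.pos-* K n)))
    (≡-+ {fromℕ K *ᶻ fromℕ n} {fromℕ K *ᶻ x} {fromℕ j} {fromℕ j} N
      (≡-* {fromℕ K} {fromℕ K} {fromℕ n} {x} N (≡-refl {fromℕ K} N) n≡x) (≡-refl {fromℕ j} N))

  module _ (l : ℕ) .{{l≢0 : NonZero l}} where

    private
      Scaled-perturb-value : ∀ {q B s x y x′ a} → Scaled l q x y → l ℕ.* q ≤ B → l ≤ s →
        x′ ≡ x [p^ B ℕ.+ s ] → Normalised l x′ a → a ≡ y [p^ s ]
      Scaled-perturb-value {q} {B} {s} {x} {y} {x′} {a} sc lq≤B l≤s x′≡x x′↦a =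
        let y′ , sc′ , y′≡y = Scaled-perturb l {x′ = x′} {B} {s} sc lq≤B l≤s x′≡x in
        ≡-trans {a} {y′} {y} s (≈⇒≡ {a} {y′} s (Normalised-unique l x′↦a (scaled q sc′))) y′≡y

    module _ (F : List ℤₚ) (a : Sequence) (a-spec : ∀ n → Normalised l (eval F (fromℕ n)) (a n)) where

      -- Where F does not vanish its valuation is finite, so `Scaled-perturb` turns the continuity
      -- of F into that of 𝓛 ∘ F.
      locally-constant : ∀ s → l ≤ s → ∀ K j γ → ¬ eval F (fromℕ K *ᶻ γ +ᶻ fromℕ j) ≈ᶻ 0ᶻ →
        ∃₂ λ N y → ∀ n → fromℕ n ≡ γ [p^ N ] → a (K ℕ.* n ℕ.+ j) ≡ y [p^ s ]
      locally-constant s l≤s K j γ Fx≉0 =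
        let v , _ , ¬div = maximal-power Fx≉0
            y , x↦y      = normalise em l (eval F (fromℕ K *ᶻ γ +ᶻ fromℕ j))
            q , sc       = ≉0⇒Scaled l Fx≉0 x↦y
        in v ℕ.+ s , y , λ n n≡γ → Scaled-perturb-value {x′ = eval F (fromℕ (K ℕ.* n ℕ.+ j))} sc
             (Scaled-exponent l sc ¬div) l≤s
             (≡-eval {fromℕ (K ℕ.* n ℕ.+ j)} {fromℕ K *ᶻ γ +ᶻ fromℕ j} (v ℕ.+ s) F (affine-≡ K j {n} {γ} (v ℕ.+ s) n≡γ))
             (a-spec (K ℕ.* n ℕ.+ j))

      -- Near α, F behaves like κ (X - α)ᵉ: the value at γ + pᴹ w, where K γ + j = α,
      -- is determined modulo pˢ by the unit w through the factor wᵉ.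
      module NearRoot {α : ℤₚ} {e : ℕ} {H : List ℤₚ} (F≈ : ∀ X → eval F X ≈ᶻ (X -ᶻ α) ^ e *ᶻ eval H X)
               (K j : ℕ) (γ : ℤₚ) (Kγ+j≈α : fromℕ K *ᶻ γ +ᶻ fromℕ j ≈ᶻ α) where

        κ : ℤₚ
        κ = fromℕ K ^ e *ᶻ eval H α

        value-near : ∀ M R → R ≤ M → ∀ w n → fromℕ n ≡ γ +ᶻ π^ M *ᶻ w [p^ M ℕ.+ R ] →
          eval F (fromℕ (K ℕ.* n ℕ.+ j)) ≡ w ^ e *ᶻ (π^ (M ℕ.* e) *ᶻ κ) [p^ M ℕ.* e ℕ.+ R ]
        value-near M R R≤M w n n≡ = near (difference {fromℕ n} (M ℕ.+ R) n≡)
          where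
          X = fromℕ (K ℕ.* n ℕ.+ j)
          near : (∃ λ z → fromℕ n ≈ᶻ γ +ᶻ π^ M *ᶻ w +ᶻ π^ (M ℕ.+ R) *ᶻ z) →
            eval F X ≡ w ^ e *ᶻ (π^ (M ℕ.* e) *ᶻ κ) [p^ M ℕ.* e ℕ.+ R ]
          near (z , n≈) = ≡-trans {eval F X} {π^ (M ℕ.* e) *ᶻ u} {w ^ e *ᶻ (π^ (M ℕ.* e) *ᶻ κ)} (M ℕ.* e ℕ.+ R)
              (≈⇒≡ (M ℕ.* e ℕ.+ R) F≈′)
              (Div-≈ (M ℕ.* e ℕ.+ R) factor-out (Div-π* (M ℕ.* e) R (u -ᶻ (fromℕ K *ᶻ w) ^ e *ᶻ eval H α) u≡))
            where
            open ZR
            w′ = w +ᶻ π^ R *ᶻ z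
            u = (fromℕ K *ᶻ w′) ^ e *ᶻ eval H X
            X-α≈ : X -ᶻ α ≈ᶻ π^ M *ᶻ (fromℕ K *ᶻ w′)
            X-α≈ = begin
              X -ᶻ α
                ≈⟨ Z.+-cong (pointwise λ _ → cong (ℤ._+ + j) (ℤP.pos-* K n)) (Z.-‿cong (Z.sym Kγ+j≈α)) ⟩
              fromℕ K *ᶻ fromℕ n +ᶻ fromℕ j -ᶻ (fromℕ K *ᶻ γ +ᶻ fromℕ j)
                ≈⟨ solve 4 (λ K n j γ → (K :* n :+ j) :- (K :* γ :+ j) := K :* (n :- γ)) Z.refl
                     (fromℕ K) (fromℕ n) (fromℕ j) γ ⟩
              fromℕ K *ᶻ (fromℕ n -ᶻ γ)
                ≈⟨ Z.*-congˡ {fromℕ K} (Z.+-congʳ { -ᶻ γ } (Z.trans n≈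
                     (Z.+-congˡ {γ +ᶻ π^ M *ᶻ w} (π-+-* M R z)))) ⟩
              fromℕ K *ᶻ (γ +ᶻ π^ M *ᶻ w +ᶻ π^ M *ᶻ (π^ R *ᶻ z) -ᶻ γ)
                ≈⟨ solve 5 (λ K γ m w r → K :* ((γ :+ m :* w :+ m :* r) :- γ) := m :* (K :* (w :+ r))) Z.refl
                     (fromℕ K) γ (π^ M) w (π^ R *ᶻ z) ⟩
              π^ M *ᶻ (fromℕ K *ᶻ w′) ∎
            F≈′ : eval F X ≈ᶻ π^ (M ℕ.* e) *ᶻ u
            F≈′ = begin
              eval F X                                              ≈⟨ F≈ X ⟩
              (X -ᶻ α) ^ e *ᶻ eval H X                              ≈⟨ Z.*-congʳ {eval H X} (Z.trans (^-congˡ e X-α≈) (^-π-* M e (fromℕ K *ᶻ w′))) ⟩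
              π^ (M ℕ.* e) *ᶻ (fromℕ K *ᶻ w′) ^ e *ᶻ eval H X       ≈⟨ Z.*-assoc (π^ (M ℕ.* e)) ((fromℕ K *ᶻ w′) ^ e) (eval H X) ⟩
              π^ (M ℕ.* e) *ᶻ u                                     ∎
            -- X is within pᴹ of α; R ≤ M is what lets H X be replaced by H α modulo pᴿ.
            X≡α : X ≡ α [p^ R ]
            X≡α = ≡-mono {X} {α} R≤M (Div-≈ M (Z.sym X-α≈) (Div-*ˡ {π^ M} M (fromℕ K *ᶻ w′) (Div-π M)))
            w′≡w : w′ ≡ w [p^ R ]
            w′≡w = Div-≈ R (solve 2 (λ w r → r := (w :+ r) :- w) Z.refl w (π^ R *ᶻ z))
              (Div-*ˡ {π^ R} R z (Div-π R))
            u≡ : u ≡ (fromℕ K *ᶻ w) ^ e *ᶻ eval H α [p^ R ]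
            u≡ = ≡-* {(fromℕ K *ᶻ w′) ^ e} {(fromℕ K *ᶻ w) ^ e} {eval H X} {eval H α} R
              (≡-^ {fromℕ K *ᶻ w′} {fromℕ K *ᶻ w} R e
                (≡-* {fromℕ K} {fromℕ K} {w′} {w} R (≡-refl {fromℕ K} R) w′≡w))
              (≡-eval {X} {α} R H X≡α)
            factor-out : π^ (M ℕ.* e) *ᶻ (u -ᶻ (fromℕ K *ᶻ w) ^ e *ᶻ eval H α) ≈ᶻ
              π^ (M ℕ.* e) *ᶻ u -ᶻ w ^ e *ᶻ (π^ (M ℕ.* e) *ᶻ κ)
            factor-out = begin
              π^ (M ℕ.* e) *ᶻ (u -ᶻ (fromℕ K *ᶻ w) ^ e *ᶻ eval H α)
                ≈⟨ Z.*-congˡ {π^ (M ℕ.* e)} (Z.+-congˡ {u} (Z.-‿cong (Z.*-congʳ {eval H α} (^-distrib-* (fromℕ K) w e)))) ⟩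
              π^ (M ℕ.* e) *ᶻ (u -ᶻ fromℕ K ^ e *ᶻ w ^ e *ᶻ eval H α)
                ≈⟨ solve 5 (λ m u k w h → m :* (u :- k :* w :* h) := m :* u :- w :* (m :* (k :* h))) Z.refl
                     (π^ (M ℕ.* e)) u (fromℕ K ^ e) (w ^ e) (eval H α) ⟩
              π^ (M ℕ.* e) *ᶻ u -ᶻ w ^ e *ᶻ (π^ (M ℕ.* e) *ᶻ κ) ∎

        -- The leading term wᵉ p^(M e) κ has valuation at most M e + v, so knowing F modulo p^(M e +
        -- v + s) determines the normalised value modulo pˢ.
        sequence-near : ∀ s → l ≤ s → ∀ v → ¬ Div (suc v) κ → ∀ M → v ℕ.+ s ≤ M →
          ∀ q y → Scaled l q (π^ (M ℕ.* e) *ᶻ κ) y → ∀ w → ¬ Div 1 w →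
          ∀ n → fromℕ n ≡ γ +ᶻ π^ M *ᶻ w [p^ M ℕ.+ (v ℕ.+ s) ] → a (K ℕ.* n ℕ.+ j) ≡ w ^ e *ᶻ y [p^ s ]
        sequence-near s l≤s v ¬div M v+s≤M q y sc w ¬div-w n n≡ =
          Scaled-perturb-value {B = M ℕ.* e ℕ.+ v} {x′ = eval F (fromℕ (K ℕ.* n ℕ.+ j))}
            (Scaled-unit l (w ^ e) (¬Div1-^ {w} e ¬div-w) sc)
            (Scaled-exponent l sc λ div → ¬div (Div-π*⁻¹ (M ℕ.* e) (suc v) κ
              (subst (λ i → Div i (π^ (M ℕ.* e) *ᶻ κ)) (sym (ℕP.+-suc (M ℕ.* e) v)) div)))
            l≤s
            (subst (λ i → eval F (fromℕ (K ℕ.* n ℕ.+ j)) ≡ w ^ e *ᶻ (π^ (M ℕ.* e) *ᶻ κ) [p^ i ])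
              (sym (ℕP.+-assoc (M ℕ.* e) v s)) (value-near M (v ℕ.+ s) v+s≤M w n n≡))
            (a-spec (K ℕ.* n ℕ.+ j))

        -- A limit y₀ would satisfy y₀ ≡ y and y₀ ≡ (1 + p)ᵉ y modulo p^(t + l). Then p^(t + l)
        -- divides ((1 + p)ᵉ - 1) y; the first factor can supply at most pᵗ, so pˡ would divide y.
        not-locally-constant : ∀ t → ¬ Div (suc t) (fromℕ (suc p) ^ e -ᶻ 1ᶻ) → ¬ κ ≈ᶻ 0ᶻ →
          ∀ N y → ¬ (∀ n → fromℕ n ≡ γ [p^ N ] → a (K ℕ.* n ℕ.+ j) ≡ y [p^ t ℕ.+ l ])
        not-locally-constant t ¬div-t κ≉0 N y₀ const =
          let v , _ , ¬div = maximal-power κ≉0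
              -- Large enough both to stay in the ball of level N around γ and to satisfy v + s ≤ M
              -- in `sequence-near`.
              M = N ℕ.+ (v ℕ.+ s)
              y , x↦y = normalise em l (π^ (M ℕ.* e) *ᶻ κ)
              q , sc = ≉0⇒Scaled l (*-≉0 (fromℤ-≉0 (P (M ℕ.* e)) (P≢0 (M ℕ.* e))) κ≉0) x↦y
          in clash v ¬div M (ℕP.m≤m+n N (v ℕ.+ s)) (ℕP.m≤n+m (v ℕ.+ s) N) q y sc
          where
          s = t ℕ.+ l
          u = fromℕ (suc p)
          ¬div-u : ¬ Div 1 u
          ¬div-u = p∤⇒¬Div (suc p) p∤1+p
          ¬div-1 : ¬ Div 1 1ᶻ
          ¬div-1 = p∤⇒¬Div 1 p∤1
          1^e : ∀ e → 1ᶻ ^ e ≈ᶻ 1ᶻ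
          1^e zero    = Z.refl
          1^e (suc e) = Z.trans (Z.*-identityˡ (1ᶻ ^ e)) (1^e e)
          clash : ∀ v → ¬ Div (suc v) κ → ∀ M → N ≤ M → v ℕ.+ s ≤ M →
            ∀ q y → ¬ Scaled l q (π^ (M ℕ.* e) *ᶻ κ) y
          clash v ¬div M N≤M v+s≤M q y sc =
            [ ¬div-t , proj₂ sc ]′ (Div-* t l (u ^ e -ᶻ 1ᶻ) y
              (Div-≈ s (Z.trans (Z.+-congˡ {u ^ e *ᶻ y} (Z.-‿cong (Z.*-congʳ {y} (1^e e))))
                         (solve 2 (λ u y → u :* y :- con (+ 1) :* y := (u :- con (+ 1)) :* y) Z.refl (u ^ e) y))
                (≡-trans {u ^ e *ᶻ y} {y₀} {1ᶻ ^ e *ᶻ y} s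
                  (≡-sym {y₀} {u ^ e *ᶻ y} s (limit u ¬div-u)) (limit 1ᶻ ¬div-1))))
            where
            limit : ∀ w → ¬ Div 1 w → y₀ ≡ w ^ e *ᶻ y [p^ s ]
            limit w ¬div-w =
              let n , _ , n≡ = representative (γ +ᶻ π^ M *ᶻ w) (M ℕ.+ (v ℕ.+ s)) in
              ≡-trans {y₀} {a (K ℕ.* n ℕ.+ j)} {w ^ e *ᶻ y} s
                (≡-sym {a (K ℕ.* n ℕ.+ j)} {y₀} s (const n (near-γ n n≡)))
                (sequence-near s (ℕP.m≤n+m l t) v ¬div M v+s≤M q y sc w ¬div-w n n≡)
              where
              near-γ : ∀ n → fromℕ n ≡ γ +ᶻ π^ M *ᶻ w [p^ M ℕ.+ (v ℕ.+ s) ] → fromℕ n ≡ γ [p^ N ]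
              near-γ n n≡ = ≡-trans {fromℕ n} {γ +ᶻ π^ M *ᶻ w} {γ} N
                (≡-mono {fromℕ n} {γ +ᶻ π^ M *ᶻ w} (ℕP.≤-trans N≤M (ℕP.m≤m+n M (v ℕ.+ s))) n≡)
                (Div-≈ N (solve 2 (λ γ x → x := (γ :+ x) :- γ) Z.refl γ (π^ M *ᶻ w))
                  (Div-*ˡ {π^ M} N w (Div-mono {π^ M} N≤M (Div-π M))))

-- Counting the points where kernel members fail to be locally constant

^-distribʳ-* : ∀ m n i → (m ℕ.* n) ℕ.^ i ≡ m ℕ.^ i ℕ.* n ℕ.^ i
^-distribʳ-* m n zero    = refl
^-distribʳ-* m n (suc i) = trans (cong (m ℕ.* n ℕ.*_) (^-distribʳ-* m n i)) (int m n (m ℕ.^ i) (n ℕ.^ i))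
  where
  int : ∀ m n a b → m ℕ.* n ℕ.* (a ℕ.* b) ≡ m ℕ.* a ℕ.* (n ℕ.* b)
  int = ℕSolver.solve-∀

module Irregularity (p : ℕ) (p-prime : Prime p) (em : ExcludedMiddle 0ℓ) where
  open Padic p p-prime hiding (Polynomial; NonZeroPolynomial; eval)
  open Arithmetic p p-prime
  open Domain em
  open Normalisation p p-prime
  open Sequences p p-prime
  open RegularValues p p-prime em
  open LinearValues p p-prime em
  open IrregularValues p p-prime em
  open Solver using (solve; _:=_; _:+_; _:*_; _:-_; :-_; con)
  open ZPoly using (eval)

  -- A member n ↦ a (kⁱ n + j) of the k-kernel with the point that n ↦ kⁱ n + j
  -- maps to α.
  record Member (k : ℕ) (α : ℤₚ) : Set where
    field
      level offset : ℕ
      offset<  : offset < k ℕ.^ level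
      centre   : ℤₚ
      centre≈  : fromℕ (k ℕ.^ level) *ᶻ centre +ᶻ fromℕ offset ≈ᶻ α
  open Member

  Distinct : ∀ {k α M} → (Fin M → Member k α) → Set
  Distinct m = ∀ u v → centre (m u) ≈ᶻ centre (m v) → u ≡ v

  fromℕ-^ : ∀ m e → fromℕ (m ℕ.^ e) ≈ᶻ fromℕ m ^ e
  fromℕ-^ m zero    = Z.refl
  fromℕ-^ m (suc e) = Z.trans (pointwise λ _ → ℤP.pos-* m (m ℕ.^ e)) (Z.*-congˡ {fromℕ m} (fromℕ-^ m e))

  k^i≉0 : ∀ k .{{_ : NonZero k}} i → ¬ fromℕ (k ℕ.^ i) ≈ᶻ 0ᶻ
  k^i≉0 k i = fromℤ-≉0 (+ (k ℕ.^ i)) λ eq → ℕ.≢-nonZero⁻¹ (k ℕ.^ i) {{ℕP.m^n≢0 k i}} (ℤP.+-injective eq)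

  -- An integer greater than 1 has no positive power equal to 1, and ℤ embeds in ℤₚ.
  [1+p]^e≉1 : ∀ e → e ≢ 0 → ¬ fromℕ (suc p) ^ e -ᶻ 1ᶻ ≈ᶻ 0ᶻ
  [1+p]^e≉1 e e≢0 q = [ e≢0 , (λ 1+p≡1 → ℕ.≢-nonZero⁻¹ p (ℕP.suc-injective 1+p≡1)) ]′
    (ℕP.m^n≡1⇒n≡0∨m≡1 (suc p) e (ℤP.+-injective
      (fromℤ-injective {+ (suc p ℕ.^ e)} {+ 1} (Z.trans (fromℕ-^ (suc p) e) (-≈0⇒≈ q)))))

  module _ (l : ℕ) .{{l≢0 : NonZero l}} (F : List ℤₚ) (F≢0 : ZPoly.NonZeroPolynomial F)
           (a : Sequence) (a-spec : ∀ n → Normalised l (eval F (fromℕ n)) (a n))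
           (α : ℤₚ) (Fα≈0 : eval F α ≈ᶻ 0ᶻ) where

    module _ (k : ℕ) .{{k≢0 : NonZero k}} {e : ℕ} {H : List ℤₚ} (F≈ : ∀ X → eval F X ≈ᶻ (X -ᶻ α) ^ e *ᶻ eval H X)
             (Hα≉0 : ¬ eval H α ≈ᶻ 0ᶻ) (t : ℕ) (¬div : ¬ Div (suc t) (fromℕ (suc p) ^ e -ᶻ 1ᶻ))
             (code : ∀ i j → j < k ℕ.^ i → ℕ)
             (faithful : ∀ i j j< i′ j′ j′< → code i j j< ≡ code i′ j′ j′< →
               ∀ n → a (k ℕ.^ i ℕ.* n ℕ.+ j) ≡ a (k ℕ.^ i′ ℕ.* n ℕ.+ j′) [p^ t ℕ.+ l ]) where

      private
        codeᵐ : Member k α → ℕ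
        codeᵐ m = code (level m) (offset m) (offset< m)

        image : Member k α → ℤₚ → ℤₚ
        image m x = fromℕ (k ℕ.^ level m) *ᶻ x +ᶻ fromℕ (offset m)

        -- The member m′ is not locally constant at its centre. Having the same code, m is congruent
        -- to it and so fails there as well, which can happen only where the affine map of m hits a
        -- root.
        image-root : ∀ m m′ → codeᵐ m ≡ codeᵐ m′ → eval F (image m (centre m′)) ≈ᶻ 0ᶻ
        image-root m m′ same = decide (em {eval F (image m (centre m′)) ≈ᶻ 0ᶻ})
          where
          K = k ℕ.^ level m′
          j = offset m′
          decide : Dec (eval F (image m (centre m′)) ≈ᶻ 0ᶻ) → eval F (image m (centre m′)) ≈ᶻ 0ᶻ
          decide (yes q) = q
          decide (no ¬q) =
            let N , y , const = locally-constant l F a a-spec (t ℕ.+ l) (ℕP.m≤n+m l t)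
                                  (k ℕ.^ level m) (offset m) (centre m′) ¬q
            in contradiction
              (λ n n≡ → ≡-trans {a (K ℕ.* n ℕ.+ j)} {a (k ℕ.^ level m ℕ.* n ℕ.+ offset m)} {y} (t ℕ.+ l)
                (faithful (level m′) j (offset< m′) (level m) (offset m) (offset< m) (sym same) n) (const n n≡))
              (NearRoot.not-locally-constant l F a a-spec {α} {e} {H} F≈ K j (centre m′) (centre≈ m′) t ¬div
                (*-≉0 (^-≉0 e (k^i≉0 k (level m′))) Hα≉0) N y)

        image-injective : ∀ m {x y} → image m x ≈ᶻ image m y → x ≈ᶻ y
        image-injective m {x} {y} q = *-cancelˡ (k^i≉0 k (level m)) (begin
          K *ᶻ x                     ≈⟨ solve 2 (λ x j → x := (x :+ j) :- j) Z.refl (K *ᶻ x) j ⟩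
          K *ᶻ x +ᶻ j -ᶻ j           ≈⟨ Z.+-congʳ { -ᶻ j } q ⟩
          K *ᶻ y +ᶻ j -ᶻ j           ≈⟨ solve 2 (λ x j → (x :+ j) :- j := x) Z.refl (K *ᶻ y) j ⟩
          K *ᶻ y                     ∎)
          where
          open ZR
          K = fromℕ (k ℕ.^ level m)
          j = fromℕ (offset m)

      -- The affine map of one fixed member is injective, so the distinct centres of a class yield
      -- distinct roots of F.
      same-code-bound : ∀ {M} (m : Fin M → Member k α) → Distinct m → ∀ {c} ys →
        All (λ u → codeᵐ (m u) ≡ c) ys → Unique ys → length ys ≤ length F
      same-code-bound m distinct []       _    _    = z≤n
      same-code-bound m distinct (u ∷ ys) same@(q ∷ _) uniq =
        subst (_≤ length F) (ListP.length-map β (u ∷ ys)) (ℕP.<⇒≤ (roots-bound F F≢0 (map β (u ∷ ys))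
          (AllPairsP.map⁺ (AllPairs.map (λ {v} {w} v≢w r → v≢w (distinct v w (image-injective (m u) r))) uniq))
          (AllP.map⁺ (All.map (λ {v} r → image-root (m u) (m v) (trans q (sym r))) same))))
        where
        β : _ → ℤₚ
        β v = image (m u) (centre (m v))

    -- Members with the same code agree modulo pᵗ⁺ˡ, hence fail to be locally
    -- constant at the same points; in terms of one of them, these points come
    -- from roots of F, so there are boundedly many.
    ¬KRegular : ∀ k .{{_ : NonZero k}} →
      (∀ M → Σ (Fin M → Member k α) Distinct) → ¬ KRegular k a
    ¬KRegular k members reg = factored (factorisation F F≢0 α)
      where
      factored : Factorisation F α → _
      factored (zero  , H , F≈ , Hα≉0) = Hα≉0 (Z.trans (Z.sym (Z.*-identityˡ (eval H α)))
        (Z.trans (Z.sym (F≈ α)) Fα≈0))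
      factored (suc e , H , F≈ , Hα≉0) =
        let t , _ , ¬div = maximal-power ([1+p]^e≉1 (suc e) (λ ()))
            N , code , faithful = kernel-residues (t ℕ.+ l) {k} {a} reg
        in coded t ¬div N code faithful
        where
        coded : ∀ t → ¬ Div (suc t) (fromℕ (suc p) ^ suc e -ᶻ 1ᶻ) → ∀ N (code : ∀ i j → j < k ℕ.^ i → Fin N) →
          (∀ i j j< i′ j′ j′< → code i j j< ≡ code i′ j′ j′< →
            ∀ n → a (k ℕ.^ i ℕ.* n ℕ.+ j) ≡ a (k ℕ.^ i′ ℕ.* n ℕ.+ j′) [p^ t ℕ.+ l ]) → _
        coded t ¬div N code faithful =
          -- One member more than N classes of size at most `length F` can hold.
          let m , distinct = members (suc (N ℕ.* length F))
              c , ys , same , uniq , long = pigeonhole N (length F)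
                (λ u → toℕ (code (level (m u)) (offset (m u)) (offset< (m u)))) (allFin _)
                (All.tabulate λ {u} _ → FinP.toℕ<n (code (level (m u)) (offset (m u)) (offset< (m u))))
                (UniqueP.allFin⁺ _)
                (ℕP.≤-reflexive (sym (ListP.length-tabulate {n = suc (N ℕ.* length F)} id)))
          in ℕP.<⇒≱ long (same-code-bound k {suc e} {H} F≈ Hα≉0 t ¬div (λ i j j< → toℕ (code i j j<))
               (λ i j j< i′ j′ j′< eq → faithful i j j< i′ j′ j′< (FinP.toℕ-injective eq)) m distinct ys same uniq)

  PrimePart : ℕ → Set
  PrimePart k = ∃₂ λ t k′ → k ≡ p ℕ.^ t ℕ.* k′ × ¬ p ℕ∣.∣ k′

  prime-part : ∀ k → NonZero k → PrimePart k
  prime-part = <-rec (λ k → NonZero k → PrimePart k) λ k rec k≢0 → step k rec k≢0 (p ℕ∣.∣? k)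
    where
    step : ∀ k → (∀ {m} → m < k → NonZero m → PrimePart m) → NonZero k → Dec (p ℕ∣.∣ k) → PrimePart k
    step k rec k≢0 (no p∤k)                = 0 , k , sym (ℕP.*-identityˡ k) , p∤k
    step k rec k≢0 (yes (ℕ∣.divides q eq)) =
      let t , k′ , q≡ , p∤k′ = rec (subst (q <_) (sym eq) (ℕP.m<m*n q p p≥2)) q≢0 in
      suc t , k′ , trans eq (trans (ℕP.*-comm q p) (trans (cong (p ℕ.*_) q≡) (sym (ℕP.*-assoc p (p ℕ.^ t) k′)))) , p∤k′
      where
      instance
        q≢0 : NonZero q
        q≢0 = ℕ.≢-nonZero λ { refl → ℕ.≢-nonZero⁻¹ k {{k≢0}} eq }

  p∤-^ : ∀ {m} → ¬ p ℕ∣.∣ m → ∀ n → ¬ p ℕ∣.∣ m ℕ.^ n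
  p∤-^     p∤m zero    p∣1 = p∤1 p∣1
  p∤-^ {m} p∤m (suc n) q   = [ p∤m , p∤-^ p∤m n ]′ (euclidsLemma m (m ℕ.^ n) p-prime q)

  module _ (t k′ : ℕ) (p∤k′ : ¬ p ℕ∣.∣ k′) (α : ℤₚ) where

    private
      k : ℕ
      k = p ℕ.^ t ℕ.* k′

      k^i≡ : ∀ i → k ℕ.^ i ≡ p ℕ.^ (t ℕ.* i) ℕ.* k′ ℕ.^ i
      k^i≡ i = trans (^-distribʳ-* (p ℕ.^ t) k′ i) (cong (ℕ._* k′ ℕ.^ i) (ℕP.^-*-assoc p t i))

    -- Solving kⁱ γ + j = α splits into two divisions: p^(t i) divides α - j by hypothesis, and k′ⁱ
    -- is a p-adic unit.
    member-at : ∀ i j → j < k ℕ.^ i → fromℕ j ≡ α [p^ t ℕ.* i ] →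
      Σ (Member k α) λ m → level m ≡ i × offset m ≡ j
    member-at i j j< j≡α =
      let z , α≈ = difference {α} {fromℕ j} (t ℕ.* i) (≡-sym {fromℕ j} {α} (t ℕ.* i) j≡α)
          γ , z≈ = unit-divides (k′ ℕ.^ i) (p∤-^ p∤k′ i) z
      in record { level = i ; offset = j ; offset< = j< ; centre = γ ; centre≈ = begin
           fromℕ (k ℕ.^ i) *ᶻ γ +ᶻ fromℕ j
             ≡⟨ cong (λ K → fromℕ K *ᶻ γ +ᶻ fromℕ j) (k^i≡ i) ⟩
           fromℕ (p ℕ.^ (t ℕ.* i) ℕ.* k′ ℕ.^ i) *ᶻ γ +ᶻ fromℕ j
             ≈⟨ Z.+-congʳ {fromℕ j} (Z.*-congʳ {γ} (pointwise λ _ → ℤP.pos-* (p ℕ.^ (t ℕ.* i)) (k′ ℕ.^ i))) ⟩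
           π^ (t ℕ.* i) *ᶻ fromℕ (k′ ℕ.^ i) *ᶻ γ +ᶻ fromℕ j
             ≈⟨ Z.+-congʳ {fromℕ j} (Z.*-assoc (π^ (t ℕ.* i)) (fromℕ (k′ ℕ.^ i)) γ) ⟩
           π^ (t ℕ.* i) *ᶻ (fromℕ (k′ ℕ.^ i) *ᶻ γ) +ᶻ fromℕ j
             ≈⟨ Z.+-congʳ {fromℕ j} (Z.*-congˡ {π^ (t ℕ.* i)} z≈) ⟩
           π^ (t ℕ.* i) *ᶻ z +ᶻ fromℕ j
             ≈⟨ Z.+-comm (π^ (t ℕ.* i) *ᶻ z) (fromℕ j) ⟩
           fromℕ j +ᶻ π^ (t ℕ.* i) *ᶻ z
             ≈⟨ α≈ ⟨
           α ∎ } , refl , refl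
      where open ZR

    -- All centres at a fixed level i; there are k′ⁱ of them.
    level-members : 2 ≤ k′ → ∀ M → Σ (Fin M → Member k α) Distinct
    level-members 2≤k′ M = with-representative (representative α (t ℕ.* M))
      where
      q = p ℕ.^ (t ℕ.* M)
      M≤k′^M : ∀ M → M < k′ ℕ.^ M
      M≤k′^M zero    = s≤s z≤n
      M≤k′^M (suc M) = ℕP.≤-trans (s≤s (M≤k′^M M)) (ℕP.≤-trans
        (ℕP.+-monoˡ-≤ (k′ ℕ.^ M) (ℕP.≤-trans (s≤s z≤n) (M≤k′^M M)))
        (ℕP.≤-trans (ℕP.≤-reflexive (cong (k′ ℕ.^ M ℕ.+_) (sym (ℕP.+-identityʳ (k′ ℕ.^ M)))))
          (ℕP.*-monoˡ-≤ (k′ ℕ.^ M) 2≤k′)))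
      with-representative : (∃ λ r → r < q × fromℕ r ≡ α [p^ t ℕ.* M ]) → Σ (Fin M → Member k α) Distinct
      with-representative (r , r<q , r≡α) = (λ u → proj₁ (at u)) , distinct
        where
        j : Fin M → ℕ
        -- All these offsets are ≡ α modulo q = p^(t M). There are k′ᴹ of them below kᴹ = q k′ᴹ, and
        -- M < k′ᴹ gives room for M members.
        j u = r ℕ.+ toℕ u ℕ.* q
        at : ∀ u → Σ (Member k α) λ m → level m ≡ M × offset m ≡ j u
        at u = member-at M (j u) j< (≡-trans {fromℕ (j u)} {fromℕ r} {α} (t ℕ.* M)
          (divides (+ toℕ u) (trans (int (+ r) (+ (toℕ u ℕ.* q))) (ℤP.pos-* (toℕ u) q))) r≡α)
          where
          int : ∀ r s → r ℤ.+ s ℤ.- r ≡ s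
          int = ℤSolver.solve-∀
          j< : j u < k ℕ.^ M
          j< = ℕP.<-≤-trans (ℕP.+-monoˡ-< (toℕ u ℕ.* q) r<q)
            (ℕP.≤-trans (ℕP.*-monoˡ-≤ q (ℕP.≤-trans (FinP.toℕ<n u) (ℕP.<⇒≤ (M≤k′^M M))))
              (ℕP.≤-reflexive (trans (ℕP.*-comm (k′ ℕ.^ M) q) (sym (k^i≡ M)))))
        instance
          q≢0 : NonZero q
          q≢0 = ℕP.m^n≢0 p (t ℕ.* M)
        offset-unique : ∀ {m m′ : Member k α} → level m ≡ level m′ → centre m ≈ᶻ centre m′ → offset m ≡ offset m′
        offset-unique {m} {m′} lv c = ℤP.+-injective (fromℤ-injective {+ offset m} {+ offset m′} (begin
          fromℕ (offset m)
            ≈⟨ solve 2 (λ x j → j := (x :+ j) :- x) Z.refl (K *ᶻ centre m) (fromℕ (offset m)) ⟩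
          K *ᶻ centre m +ᶻ fromℕ (offset m) -ᶻ K *ᶻ centre m
            ≈⟨ Z.+-cong (Z.trans (centre≈ m) (Z.sym (centre≈ m′)))
                 (Z.-‿cong (Z.trans (Z.*-congˡ {K} c) (Z.reflexive (cong (λ i → fromℕ (k ℕ.^ i) *ᶻ centre m′) lv)))) ⟩
          K′ *ᶻ centre m′ +ᶻ fromℕ (offset m′) -ᶻ K′ *ᶻ centre m′
            ≈⟨ solve 2 (λ x j → (x :+ j) :- x := j) Z.refl (K′ *ᶻ centre m′) (fromℕ (offset m′)) ⟩
          fromℕ (offset m′) ∎))
          where
          open ZR
          K = fromℕ (k ℕ.^ level m)
          K′ = fromℕ (k ℕ.^ level m′)
        from-at : ∀ {u v} (x : Σ (Member k α) λ m → level m ≡ M × offset m ≡ j u)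
          (y : Σ (Member k α) λ m → level m ≡ M × offset m ≡ j v) →
          centre (proj₁ x) ≈ᶻ centre (proj₁ y) → u ≡ v
        from-at {u} {v} (m , lv , os) (m′ , lv′ , os′) c = FinP.toℕ-injective
          (ℕP.*-cancelʳ-≡ (toℕ u) (toℕ v) q (ℕP.+-cancelˡ-≡ r (toℕ u ℕ.* q) (toℕ v ℕ.* q)
            (trans (sym os) (trans (offset-unique {m} {m′} (trans lv (sym lv′)) c) os′))))
        distinct : Distinct (λ u → proj₁ (at u))
        distinct u v = from-at (at u) (at v)

    -- If two of the centres (α - jᵢ) / kⁱ agree, then α is rational.
    irrational-members : 2 ≤ k → (∀ D E → D ≢ + 0 → ¬ fromℤ D *ᶻ α ≈ᶻ fromℤ E) →
      ∀ M → Σ (Fin M → Member k α) Distinct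
    irrational-members 2≤k irrational M = (λ u → proj₁ (at (toℕ u))) , λ u v c →
      FinP.toℕ-injective (from-at (at (toℕ u)) (at (toℕ v)) c)
      where
      instance
        k≢0 : NonZero k
        k≢0 = ℕ.>-nonZero (ℕP.≤-trans (s≤s z≤n) 2≤k)
      at : ∀ i → Σ (Member k α) λ m → level m ≡ i
      at i = let r , r<q , r≡α = representative α (t ℕ.* i)
                 m , lv , _    = member-at i r (ℕP.<-≤-trans r<q (q≤ i)) r≡α
             in m , lv
        where
        k′≢0 : NonZero k′
        k′≢0 = ℕ.≢-nonZero λ { refl → p∤k′ (p ℕ∣.∣0) }
        q≤ : ∀ i → p ℕ.^ (t ℕ.* i) ≤ k ℕ.^ i
        q≤ i = ℕP.≤-trans (ℕP.m≤m*n (p ℕ.^ (t ℕ.* i)) (k′ ℕ.^ i) {{ℕP.m^n≢0 k′ i {{k′≢0}}}})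
          (ℕP.≤-reflexive (sym (k^i≡ i)))
      ¬shared : ∀ (m m′ : Member k α) → level m < level m′ → ¬ centre m ≈ᶻ centre m′
      -- Eliminating the common centre c from K c + j = α = K′ c + j′ gives (K - K′) α = K j′ - K′
      -- j, and K ≠ K′ because the levels differ.
      ¬shared m m′ lv c = irrational (+ K ℤ.- + K′) (+ K ℤ.* + offset m′ ℤ.- + K′ ℤ.* + offset m)
        (λ eq → ℕP.<⇒≢ (ℕP.^-monoʳ-< k 2≤k lv) (ℤP.+-injective (ℤP.i-j≡0⇒i≡j (+ K) (+ K′) eq)))
        (begin
          fromℤ (+ K ℤ.- + K′) *ᶻ α
            ≈⟨ Z.trans (pointwise λ _ → refl)
                 (solve 3 (λ K K′ α → (K :- K′) :* α := K :* α :- K′ :* α) Z.refl (fromℕ K) (fromℕ K′) α) ⟩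
          fromℕ K *ᶻ α -ᶻ fromℕ K′ *ᶻ α
            ≈⟨ Z.+-cong (Z.*-congˡ {fromℕ K} (Z.trans (Z.sym (centre≈ m′)) (Z.+-congʳ {fromℕ (offset m′)} (Z.*-congˡ {fromℕ K′} (Z.sym c)))))
                 (Z.-‿cong (Z.*-congˡ {fromℕ K′} (Z.sym (centre≈ m)))) ⟩
          fromℕ K *ᶻ (fromℕ K′ *ᶻ centre m +ᶻ fromℕ (offset m′)) -ᶻ
          fromℕ K′ *ᶻ (fromℕ K *ᶻ centre m +ᶻ fromℕ (offset m))
            ≈⟨ solve 5 (λ K K′ c j j′ → K :* (K′ :* c :+ j′) :- K′ :* (K :* c :+ j) := K :* j′ :- K′ :* j) Z.refl
                 (fromℕ K) (fromℕ K′) (centre m) (fromℕ (offset m)) (fromℕ (offset m′)) ⟩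
          fromℕ K *ᶻ fromℕ (offset m′) -ᶻ fromℕ K′ *ᶻ fromℕ (offset m)
            ≈⟨ pointwise (λ _ → refl) ⟩
          fromℤ (+ K ℤ.* + offset m′ ℤ.- + K′ ℤ.* + offset m) ∎)
        where
        open ZR
        K = k ℕ.^ level m
        K′ = k ℕ.^ level m′
      from-at : ∀ {i i′} (x : Σ (Member k α) λ m → level m ≡ i) (y : Σ (Member k α) λ m → level m ≡ i′) →
        centre (proj₁ x) ≈ᶻ centre (proj₁ y) → i ≡ i′
      from-at (m , refl) (m′ , refl) c with ℕP.<-cmp (level m) (level m′)
      ... | tri< lt _ _ = contradiction c (¬shared m m′ lt)
      ... | tri≈ _ eq _ = eq
      ... | tri> _ _ gt = contradiction (Z.sym c) (¬shared m′ m gt)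

-- The three cases and the independence of l

⇔-both : ∀ {A B : Set} → A → B → A ⇔ B
⇔-both a b = mk⇔ (λ _ → b) (λ _ → a)

⇔-neither : ∀ {A B : Set} → ¬ A → ¬ B → A ⇔ B
⇔-neither ¬a ¬b = mk⇔ (λ a → contradiction a ¬a) (λ b → contradiction b ¬b)

module Conclusion (em : ExcludedMiddle 0ℓ) (p : ℕ) (p-prime : Prime p) where
  open Padic p p-prime
  open Arithmetic p p-prime
  open Domain em
  open Normalisation p p-prime
  open RegularValues p p-prime em using (fromℕ; rootless⇒KRegular)
  open RationalRoots p p-prime em using (LocallyRational; rational-roots⇒KRegular)
  open Irregularity p p-prime em

  Rational⇒fraction : ∀ x → Rational (ι x) → ∃₂ λ b c → ¬ p ℕ∣.∣ b × fromℕ b *ᶻ x ≈ᶻ fromℤ c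
  Rational⇒fraction x (mkℚ c d-1 coprime , q) = suc d-1 , c , p∤b , bx≈c
    where
    b = suc d-1
    bx≈c : fromℕ b *ᶻ x ≈ᶻ fromℤ c
    bx≈c = π-cancel 0 (cross q)
    p∤b : ¬ p ℕ∣.∣ b
    -- Since x is integral, p ∣ b gives p ∣ b x = c, which a reduced fraction c / b excludes.
    p∤b p∣b = ℕP.<⇒≢ p≥2 (sym (Coprimality.recompute coprime (p∣c , p∣b)))
      where
      P1∣b : P 1 ∣ + b
      P1∣b = ∣ᵤ⇒∣ (subst (ℕ∣._∣ b) (sym (ℕP.^-identityʳ p)) p∣b)
      p∣c : p ℕ∣.∣ ℤ.∣ c ∣
      p∣c = subst (ℕ∣._∣ ℤ.∣ c ∣) (ℕP.^-identityʳ p)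
        (∣⇒∣ᵤ (Div-≈ {fromℕ b *ᶻ x} {fromℤ c} 1 bx≈c (Div-*ˡ {fromℕ b} 1 x P1∣b)))

  fraction⇒Rational : ∀ x n c → fromℕ (suc n) *ᶻ x ≈ᶻ fromℤ c → Rational (ι x)
  fraction⇒Rational x n c nx≈c = q , mk≈ᵠ (Z.*-congˡ {π^ 0} (*-cancelˡ g≉0 (begin
    fromℤ g *ᶻ (fromℤ (↧ q) *ᶻ x)     ≈⟨ Z.*-assoc (fromℤ g) (fromℤ (↧ q)) x ⟨
    fromℤ g *ᶻ fromℤ (↧ q) *ᶻ x       ≈⟨ Z.*-congʳ {x} (pointwise λ _ → trans (ℤP.*-comm g (↧ q)) (ℚP.↧-/ c (suc n))) ⟩
    fromℕ (suc n) *ᶻ x                ≈⟨ nx≈c ⟩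
    fromℤ c                           ≈⟨ pointwise (λ _ → trans (ℤP.*-comm g (↥ q)) (ℚP.↥-/ c (suc n))) ⟨
    fromℤ g *ᶻ fromℤ (↥ q)            ∎)))
    where
    open ZR
    q = c ℚ./ suc n
    g = ℤGCD.gcd c (+ suc n)
    g≉0 : ¬ fromℤ g ≈ᶻ 0ᶻ
    g≉0 = fromℤ-≉0 g λ g≡0 → contradiction
      (trans (sym (ℚP.↧-/ c (suc n))) (trans (cong (↧ q ℤ.*_) g≡0) (ℤP.*-zeroʳ (↧ q)))) λ ()

  ¬Rational⇒irrational : ∀ x → ¬ Rational (ι x) → ∀ D E → D ≢ + 0 → ¬ fromℤ D *ᶻ x ≈ᶻ fromℤ E
  ¬Rational⇒irrational x ¬rat (+ zero)   E D≢0 _  = D≢0 refl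
  ¬Rational⇒irrational x ¬rat (+ suc n)  E _   eq = ¬rat (fraction⇒Rational x n E eq)
  ¬Rational⇒irrational x ¬rat (-[1+ n ]) E _   eq = ¬rat (fraction⇒Rational x n (ℤ.- E)
    (begin
      fromℕ (suc n) *ᶻ x             ≈⟨ pointwise (λ m → sym (ℤP.neg-distribˡ-* -[1+ n ] (approx x m))) ⟩
      -ᶻ (fromℤ -[1+ n ] *ᶻ x)       ≈⟨ Z.-‿cong eq ⟩
      -ᶻ fromℤ E                     ≈⟨ pointwise (λ _ → refl) ⟩
      fromℤ (ℤ.- E)                  ∎))
    where open ZR

  -- The base p + 1 separates regularity in every base from strict p-regularity.
  p-1+p-independent : MultiplicativelyIndependent p (suc p)
  p-1+p-independent (suc a) c _ _ eq = p∤-^ p∤1+p c (subst (p ℕ∣.∣_) eq (ℕ∣.m∣m*n (p ℕ.^ a)))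

  -- For k′ = 1 the base would be a power of p: either 1, or multiplicatively dependent on p.
  independent⇒prime-part≥2 : ∀ t k′ → 2 ≤ p ℕ.^ t ℕ.* k′ →
    MultiplicativelyIndependent p (p ℕ.^ t ℕ.* k′) → 2 ≤ k′
  independent⇒prime-part≥2 t       zero           2≤m ind =
    contradiction (subst (2 ≤_) (ℕP.*-zeroʳ (p ℕ.^ t)) 2≤m) λ ()
  independent⇒prime-part≥2 zero    (suc zero)     (s≤s ()) ind
  independent⇒prime-part≥2 (suc t) (suc zero)     2≤m ind = contradiction
    (sym (trans (ℕP.^-identityʳ (p ℕ.^ suc t ℕ.* 1)) (ℕP.*-identityʳ (p ℕ.^ suc t))))
    (ind (suc t) 1 (s≤s z≤n) (s≤s z≤n))
  independent⇒prime-part≥2 t       (suc (suc k′)) 2≤m ind = s≤s (s≤s z≤n)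

  exponent-bound : ∀ (f : Polynomial) → ∃ λ E → All (λ c → exponent c ≤ E) f
  exponent-bound []      = 0 , []
  exponent-bound (c ∷ f) = let E , h = exponent-bound f in exponent c ℕ.+ E ,
    ℕP.m≤m+n (exponent c) E ∷ All.map (λ ≤E → ℕP.≤-trans ≤E (ℕP.m≤n+m E (exponent c))) h

  module _ (f : Polynomial) (f≢0 : NonZeroPolynomial f) (l : ℕ) .{{l≢0 : NonZero l}} where

    private
      E : ℕ
      E = proj₁ (exponent-bound f)
      F : List ℤₚ
      -- The exponent is a multiple of l, so that clearing denominators does not change 𝓛.
      F = clear (l ℕ.* E) f
      h : All (λ c → exponent c ≤ l ℕ.* E) f
      h = All.map (λ ≤E → ℕP.≤-trans ≤E (ℕP.m≤n*m E l)) (proj₂ (exponent-bound f))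
      F≢0 : ZPoly.NonZeroPolynomial F
      F≢0 = clear-nonZero (l ℕ.* E) f≢0
      a : Sequence
      a = 𝓛-values em l f
      a-spec : ∀ n → Normalised l (ZPoly.eval F (fromℕ n)) (a n)
      a-spec n = 𝓛-Normalised em l (evalᵠ f (fromℕ n)) E (ZPoly.eval F (fromℕ n))
        (clear-eval (l ℕ.* E) f h (fromℕ n))

    empty⇒KRegular : Empty (Roots f) → ∀ k → 2 ≤ k → KRegular k a
    empty⇒KRegular empty = rootless⇒KRegular l F a a-spec λ x Fx≈0 → empty x (clear-root⇒root h Fx≈0)

    rational⇒StrictlyRegular : Satisfiable (Roots f) → Roots f ⊆ ι ⊢ Rational → StrictlyRegular p a
    rational⇒StrictlyRegular (α , root) rational =
      rational-roots⇒KRegular l F a a-spec F≢0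
        (λ x Fx≈0 → Rational⇒fraction x (rational (clear-root⇒root h Fx≈0))) ,
      λ m 2≤m independent → from-prime-part m 2≤m independent
        (prime-part m (ℕ.>-nonZero (ℕP.≤-trans (s≤s z≤n) 2≤m)))
      where
      from-prime-part : ∀ m → 2 ≤ m → MultiplicativelyIndependent p m → PrimePart m → ¬ KRegular m a
      from-prime-part m 2≤m independent (t , k′ , refl , p∤k′) =
        ¬KRegular l F F≢0 a a-spec α (root⇒clear-root h root) m {{ℕ.>-nonZero (ℕP.≤-trans (s≤s z≤n) 2≤m)}}
          (level-members t k′ p∤k′ α (independent⇒prime-part≥2 t k′ 2≤m independent))

    irrational⇒¬Regular : Roots f ⊈ ι ⊢ Rational → ¬ Regular a
    irrational⇒¬Regular ⊈rational (k , 2≤k , regular) =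
      from-root (em {∃ λ x → Roots f x × ¬ Rational (ι x)})
      where
      from-prime-part : ∀ α → Roots f α → ¬ Rational (ι α) → PrimePart k → ¬ KRegular k a
      from-prime-part α root ¬rational (t , k′ , refl , p∤k′) =
        ¬KRegular l F F≢0 a a-spec α (root⇒clear-root h root) k {{ℕ.>-nonZero (ℕP.≤-trans (s≤s z≤n) 2≤k)}}
          (irrational-members t k′ p∤k′ α 2≤k (¬Rational⇒irrational α ¬rational))
      rational? : ∀ {x} → ¬ (∃ λ x → Roots f x × ¬ Rational (ι x)) → Roots f x → Rational (ι x)
      rational? {x} none root with em {Rational (ι x)}
      ... | yes rat  = rat
      ... | no  ¬rat = contradiction (x , root , ¬rat) none
      from-root : Dec (∃ λ x → Roots f x × ¬ Rational (ι x)) → _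
      from-root (yes (α , root , ¬rat)) = from-prime-part α root ¬rat
        (prime-part k (ℕ.>-nonZero (ℕP.≤-trans (s≤s z≤n) 2≤k))) regular
      from-root (no none) = ⊈rational (rational? none)

  ¬all-regular : ∀ a → StrictlyRegular p a → ¬ (∀ k → 2 ≤ k → KRegular k a)
  ¬all-regular a (_ , strict) all = strict (suc p) 2≤1+p p-1+p-independent (all (suc p) 2≤1+p)
    where
    2≤1+p : 2 ≤ suc p
    2≤1+p = ℕP.m≤n⇒m≤1+n p≥2

  all-regular⇒Regular : ∀ a → (∀ k → 2 ≤ k → KRegular k a) → Regular a
  all-regular⇒Regular a all = p , p≥2 , all p p≥2

  StrictlyRegular⇒Regular : ∀ a → StrictlyRegular p a → Regular a
  StrictlyRegular⇒Regular a (regular , _) = p , p≥2 , regular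

  data RootType (f : Polynomial) : Set where
    none       : Empty (Roots f) → RootType f
    rational   : Satisfiable (Roots f) → Roots f ⊆ ι ⊢ Rational → RootType f
    irrational : Roots f ⊈ ι ⊢ Rational → RootType f

  rootType : ∀ f → RootType f
  rootType f with em {Satisfiable (Roots f)} | em {Roots f ⊆ ι ⊢ Rational}
  ... | no ¬root | _         = none λ x root → ¬root (x , root)
  ... | yes root | yes ⊆rat  = rational root ⊆rat
  ... | yes root | no ⊈rat   = irrational ⊈rat

  SameRegularity : Sequence → Sequence → Set
  SameRegularity a b =
    ((∀ k → 2 ≤ k → KRegular k a) ⇔ (∀ k → 2 ≤ k → KRegular k b))
    × (StrictlyRegular p a ⇔ StrictlyRegular p b)
    × (Regular a ⇔ Regular b)

  all-regular-same : ∀ a b → (∀ k → 2 ≤ k → KRegular k a) → (∀ k → 2 ≤ k → KRegular k b) →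
    SameRegularity a b
  all-regular-same a b all all′ = ⇔-both all all′
    , ⇔-neither (λ s → ¬all-regular a s all) (λ s → ¬all-regular b s all′)
    , ⇔-both (all-regular⇒Regular a all) (all-regular⇒Regular b all′)

  strictly-regular-same : ∀ a b → StrictlyRegular p a → StrictlyRegular p b → SameRegularity a b
  strictly-regular-same a b s s′ = ⇔-neither (¬all-regular a s) (¬all-regular b s′)
    , ⇔-both s s′
    , ⇔-both (StrictlyRegular⇒Regular a s) (StrictlyRegular⇒Regular b s′)

  not-regular-same : ∀ a b → ¬ Regular a → ¬ Regular b → SameRegularity a b
  not-regular-same a b ¬r ¬r′ = ⇔-neither (¬r ∘ all-regular⇒Regular a) (¬r′ ∘ all-regular⇒Regular b)
    , ⇔-neither (¬r ∘ StrictlyRegular⇒Regular a) (¬r′ ∘ StrictlyRegular⇒Regular b)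
    , ⇔-neither ¬r ¬r′

  -- The three root types are exhaustive and do not mention l, and each decides all three
  -- properties. This uses that regularity in every base and strict p-regularity exclude each other
  -- and that either implies regularity.
  independent-of-l : ∀ f → NonZeroPolynomial f → ∀ l l′ .{{_ : NonZero l}} .{{_ : NonZero l′}} →
    SameRegularity (𝓛-values em l f) (𝓛-values em l′ f)
  independent-of-l f f≢0 l l′ = from (rootType f)
    where
    a = 𝓛-values em l f
    b = 𝓛-values em l′ f
    from : RootType f → SameRegularity a b
    from (none empty)         = all-regular-same a b (empty⇒KRegular f f≢0 l empty) (empty⇒KRegular f f≢0 l′ empty)
    from (rational root ⊆rat) = strictly-regular-same a b
      (rational⇒StrictlyRegular f f≢0 l root ⊆rat) (rational⇒StrictlyRegular f f≢0 l′ root ⊆rat)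
    from (irrational ⊈rat)    = not-regular-same a b
      (irrational⇒¬Regular f f≢0 l ⊈rat) (irrational⇒¬Regular f f≢0 l′ ⊈rat)

theorem2p5 : (em : ExcludedMiddle 0ℓ) (p : ℕ) (p-prime : Prime p) →
    let open Padic p p-prime in
    (f : Polynomial) → NonZeroPolynomial f →
    ((l : ℕ) .{{_ : NonZero l}} →
    (Empty (Roots f) → ∀ k → 2 ≤ k → KRegular k (𝓛-values em l f))
    × (Satisfiable (Roots f) → Roots f ⊆ ι ⊢ Rational →
    StrictlyRegular p (𝓛-values em l f))
    × (Roots f ⊈ ι ⊢ Rational → ¬ Regular (𝓛-values em l f)))
    ×
    ((l l′ : ℕ) .{{_ : NonZero l}} .{{_ : NonZero l′}} →
    ((∀ k → 2 ≤ k → KRegular k (𝓛-values em l f)) ⇔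
    (∀ k → 2 ≤ k → KRegular k (𝓛-values em l′ f)))
    × (StrictlyRegular p (𝓛-values em l f) ⇔
    StrictlyRegular p (𝓛-values em l′ f))
    × (Regular (𝓛-values em l f) ⇔ Regular (𝓛-values em l′ f)))
theorem2p5 em p p-prime f f≢0 =
  (λ l → empty⇒KRegular f f≢0 l , rational⇒StrictlyRegular f f≢0 l , irrational⇒¬Regular f f≢0 l) ,
  (λ l l′ → independent-of-l f f≢0 l l′)
  where open Conclusion em p p-prime
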